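{- There is an absolute constant $C$ such that the following holds. Let $n\ge 5$ and let $P$ be a $4$-polytope with $n$ facets which is combinatorially equivalent to the dual (polar) of the cyclic $4$-polytope $C(n)=\operatorname{conv}\{(i,i^2,i^3,i^4)^T : i=0,1,\dots,n-1\}\subset\mathbb{R}^4$. Let $D$ be any acyclic unique sink orientation (AUSO) of the graph of $P$, and let $v_{\mathrm{st}}$ be any vertex of $P$. Then the random edge simplex algorithm started at $v_{\mathrm{st}}$ on $D$ reaches the global sink of $D$ after an expected number of at most $Cn$ pivot steps.
   Context: The graph of a polytope is its vertex–edge graph (1-skeleton). An orientation $D$ of the graph of a polytope $P$ is an acyclic unique sink orientation (AUSO) if $D$ has no directed cycle and, for every nonempty face $F$ of $P$, the subgraph of $D$ induced by the vertices of $F$ has exactly one sink (vertex without outgoing arcs). Every orientation induced by a generic linear objective function on a realization of $P$ is an AUSO. The global sink of $D$ is the unique sink of $D$ (the face $P$ itself). The random edge simplex algorithm: at the current vertex $v$, if $v$ is not the global sink, move along an outgoing arc of $v$ chosen uniformly at random among all outgoing arcs of $v$; repeat until the global sink is reached. A pivot step is one such move. -}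

module Defs where

open import Data.Nat as ℕ using (ℕ; zero; suc; _^_)
open import Data.Integer as ℤ using (ℤ; +_)
open import Data.Fin as Fin using (Fin; zero; suc; toℕ; punchIn; _<_)
open import Data.Fin.Subset using (Subset; _∈_; _∉_; _⊆_; _∩_; _∪_; ⁅_⁆; ∣_∣; inside; outside)
open import Data.Vec using (_∷_; [])
open import Data.List as List using (List; []; _∷_; _++_; filter; length)
open import Data.Bool using (Bool; true; false; T)
open import Data.Rational as ℚ using (ℚ; 0ℚ; 1ℚ)
open import Data.Product using (Σ; ∃; ∃-syntax; _×_; _,_)
open import Data.Sum using (_⊎_)
open import Relation.Binary.PropositionalEquality using (_≡_)
open import Relation.Nullary using (¬_)
open import Relation.Nullary.Decidable using (does)

det : (m : ℕ) → (Fin m → Fin m → ℤ) → ℤ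
det zero    M = + 1
det (suc m) M = go (suc m) (λ j → j)
  where
  sgn : ℕ → ℤ → ℤ
  sgn k x with k ℕ.% 2
  ... | zero = x
  ... | _    = ℤ.- x
  go : (r : ℕ) → (Fin r → Fin (suc m)) → ℤ
  go zero    f = + 0
  go (suc r) f =
    sgn (toℕ (f zero))
        (M zero (f zero) ℤ.* det m (λ i k → M (suc i) (punchIn (f zero) k)))
    ℤ.+ go r (λ i → f (suc i))

-- homogeneous coordinates (1, i, i², i³, i⁴) of the i-th point
hom : ∀ {n} → Fin n → Fin 5 → ℤ
hom i k = + (toℕ i ^ toℕ k)

-- the affine functional x ↦ det[(1,p_a);(1,p_b);(1,p_c);(1,p_d);(1,x)]
-- evaluated at the point p_x; it vanishes exactly on the hyperplane
-- spanned by p_a,…,p_d (these are affinely independent)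
side : ∀ {n} → Fin n → Fin n → Fin n → Fin n → Fin n → ℤ
side a b c d x = det 5 M
  where
  row : Fin 5 → _
  row zero = a
  row (suc zero) = b
  row (suc (suc zero)) = c
  row (suc (suc (suc zero))) = d
  row (suc (suc (suc (suc zero)))) = x
  M : Fin 5 → Fin 5 → ℤ
  M r k = hom (row r) k

IsFacet : (n : ℕ) → Subset n → Set
IsFacet n F =
  Σ (Fin n) λ a → Σ (Fin n) λ b → Σ (Fin n) λ c → Σ (Fin n) λ d →
    (a < b) × (b < c) × (c < d) ×
    (F ≡ ⁅ a ⁆ ∪ ⁅ b ⁆ ∪ ⁅ c ⁆ ∪ ⁅ d ⁆) ×
    ((∀ x → ℤ.0ℤ ℤ.≤ side a b c d x) ⊎ (∀ x → side a b c d x ℤ.≤ ℤ.0ℤ))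

-- The polar P = C(n)^Δ, described combinatorially.
-- Vertices of P  ↔  facets of C(n)  (we identify a vertex with the facet's
--                   vertex set F ⊆ {0,…,n-1}).
-- Edges of P     ↔  ridges of C(n): two facets sharing 3 vertices.
-- Nonempty faces of P ↔ faces G of C(n) (G ⊆ some facet, as C(n) is
--                   simplicial); the vertex set of that face of P is
--                   {F facet : G ⊆ F}.

Vertex : (n : ℕ) → Subset n → Set
Vertex n F = IsFacet n F

Adj : (n : ℕ) → Subset n → Subset n → Set
Adj n F F' = IsFacet n F × IsFacet n F' × ∣ F ∩ F' ∣ ≡ 3

IsFaceOfCyclic : (n : ℕ) → Subset n → Set
IsFaceOfCyclic n G = ∃[ F ] (IsFacet n F × G ⊆ F)

InFace : (n : ℕ) → Subset n → Subset n → Set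
InFace n G F = IsFacet n F × G ⊆ F

IsOrientation : (n : ℕ) → (Subset n → Subset n → Bool) → Set
IsOrientation n D =
  (∀ F F' → T (D F F') → Adj n F F') ×
  (∀ F F' → Adj n F F' → T (D F F') ⊎ T (D F' F))

data Walk {n : ℕ} (D : Subset n → Subset n → Bool) :
          Subset n → Subset n → ℕ → Set where
  here : ∀ {u} → Walk D u u 0
  step : ∀ {u v w k} → T (D u v) → Walk D v w k → Walk D u w (suc k)

Acyclic : (n : ℕ) → (Subset n → Subset n → Bool) → Set
Acyclic n D = ∀ u k → ¬ Walk D u u (suc k)

IsSinkIn : (n : ℕ) → (Subset n → Subset n → Bool) →
           (Subset n → Set) → Subset n → Set
IsSinkIn n D S F = S F × (∀ F' → S F' → ¬ T (D F F'))

UniqueSink : (n : ℕ) → (Subset n → Subset n → Bool) → Set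
UniqueSink n D =
  ∀ G → IsFaceOfCyclic n G →
    ∃[ F ] IsSinkIn n D (InFace n G) F ×
    (∀ F₁ F₂ → IsSinkIn n D (InFace n G) F₁ →
               IsSinkIn n D (InFace n G) F₂ → F₁ ≡ F₂)

IsAUSO : (n : ℕ) → (Subset n → Subset n → Bool) → Set
IsAUSO n D = IsOrientation n D × Acyclic n D × UniqueSink n D

allSubsets : (n : ℕ) → List (Subset n)
allSubsets zero    = [] ∷ []
allSubsets (suc n) =
  List.map (inside ∷_) (allSubsets n) ++ List.map (outside ∷_) (allSubsets n)

sumℚ : List ℚ → ℚ
sumℚ = List.foldr ℚ._+_ 0ℚ

-- expected number of steps of random edge from v, where the walk is
-- truncated after k steps.  For k ≥ (longest directed path) this is the
-- exact expectation: E(v) = 0 at a sink, and otherwise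
-- E(v) = 1 + (1/|out(v)|) Σ_{v→w} E(w).
expSteps : (n : ℕ) → (Subset n → Subset n → Bool) → ℕ → Subset n → ℚ
expSteps n D zero    v = 0ℚ
expSteps n D (suc k) v with filter (λ w → D v w Data.Bool.≟ true) (allSubsets n)
... | []           = 0ℚ
... | outs@(_ ∷ _) =
  1ℚ ℚ.+ sumℚ (List.map (expSteps n D k) outs) ℚ.* (+ 1 ℚ./ length outs)

-- exact expectation: 2^n exceeds the number of vertices, hence the
-- length of every directed path in an acyclic orientation.
ExpectedSteps : (n : ℕ) → (Subset n → Subset n → Bool) → Subset n → ℚ
ExpectedSteps n D v = expSteps n D (2 ^ n) v

{-# OPTIONS --safe #-}
-- By Gale's evenness condition, read off from a Vandermonde determinant, the vertices of the polar
-- are the crossings {p , p + 1 , q , q + 1} (mod n) of two of its n polygonal 2-faces {p , p + 1},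
-- and the four edges at such a vertex lead to its neighbours on the two polygons.  Number the
-- vertices by a height decreasing along the arcs.  What is used of an AUSO is that polygons have
-- one local minimum, hence one local maximum, and that quadrilaterals do not have two local minima.
--
-- Two neighbouring polygons form a wedge whose rungs are edges.  If a walk follows a rung from v
-- to w and the arcs of the two polygons at its ends disagree, then one polygon lies entirely below
-- v or the other entirely above w.  Any two polygons meet, so at a given height there cannot be
-- both a polygon above and one below.  This splits the walk into three phases.
--   1. Some polygon lies below the walk.  The polygons visited form intervals around the current
--      pair, which grow until they reach the last polygon to be visited.
--   2. No polygon lies above or below the walk.  The directions of the outgoing arcs never change
--      and each of the two polygons moves steadily around the cycle.
--   3. Some polygon lies above the walk.  The walk is confined to a box of polygons that shrinks.
-- In each phase a linearly bounded integer potential bounds the expected number of remaining steps: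
-- either every arc lowers it by 1, or, out of at most four arcs, one lowers it by 4 and none raises it.
module Submission where

-- Where the arcs at the ends of a rung disagree, the quadrilateral condition hands the disagreement
-- on to the next rung, along the wedge, until one of the polygons turns. A turning point of a
-- polygon is its global extremum, and this puts the whole polygon below v or above w. Steady
-- movement must still be shown to be short. Two polygons chasing each other around the cycle cannot
-- come back: the rows crossed on the way would all descend, down to the starting vertex, which is
-- higher than the walk. In phase 3 a step may bring no progress; the potential rewards moving away
-- from the nearer of the two sides behind, and an arc that does this exists unless a polygon has
-- just ended. The factor 4 belongs to random edge: a given arc is taken with probability at least
-- 1/4. Reversing the cyclic order and exchanging the two polygons act transitively on the four
-- directions, so most steps are analysed to the east only. All bounds hold for every truncation of
-- the walk, by induction on its length. Throughout n = m + 2, and each polygon has m vertices.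

-- The determinant `side` as a Vandermonde product.

module Vandermonde where
  open import Defs
  open import Data.Nat as ℕ using (ℕ; zero; suc; _^_)
  import Data.Nat.Properties as ℕ
  open import Data.Integer using (ℤ; +_; _*_; _-_; _+_; -_)
  open import Data.Integer.Properties
  open import Data.Integer.Solver using (module +-*-Solver)
  open +-*-Solver using (Polynomial; solve; con; _:+_; _:*_; _:=_; _:-_; :-_)
  open import Data.Fin using (Fin; zero; suc; toℕ)
  open import Relation.Binary.PropositionalEquality

  power : ℤ → ℕ → ℤ
  power a 0 = + 1
  power a 1 = a
  power a 2 = a * a
  power a 3 = a * (a * a)
  power a _ = a * (a * (a * a))

  private
    powerₚ : ∀ {k} → Polynomial k → ℕ → Polynomial k
    powerₚ a 0 = con (+ 1)
    powerₚ a 1 = a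
    powerₚ a 2 = a :* a
    powerₚ a 3 = a :* (a :* a)
    powerₚ a _ = a :* (a :* (a :* a))

    d₃ : (c d x : ℤ) (i j k : ℕ) → ℤ
    d₃ c d x i j k = det 3 λ where
      zero zero → power c i
      zero (suc zero) → power c j
      zero (suc (suc zero)) → power c k
      (suc zero) zero → power d i
      (suc zero) (suc zero) → power d j
      (suc zero) (suc (suc zero)) → power d k
      (suc (suc zero)) zero → power x i
      (suc (suc zero)) (suc zero) → power x j
      (suc (suc zero)) (suc (suc zero)) → power x k

    d₃ₚ : ∀ {l} (c d x : Polynomial l) (i j k : ℕ) → Polynomial l
    d₃ₚ c d x i j k = two c i (two′ d j k x) :+ (:- two c j (two′ d i k x) :+ (two c k (two′ d i j x) :+ con (+ 0)))
      where
      two : ∀ {l} → Polynomial l → ℕ → Polynomial l → Polynomial l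
      two c i m = powerₚ c i :* m
      one : ∀ {l} → Polynomial l → ℕ → Polynomial l
      one x k = powerₚ x k :* con (+ 1) :+ con (+ 0)
      two′ : ∀ {l} → Polynomial l → ℕ → ℕ → Polynomial l → Polynomial l
      two′ d j k x = powerₚ d j :* one x k :+ (:- (powerₚ d k :* one x j) :+ con (+ 0))

    w₃ : (c d x : ℤ) → ℤ
    w₃ c d x = (d - c) * ((x - c) * (x - d))

    w₃ₚ : ∀ {l} (c d x : Polynomial l) → Polynomial l
    w₃ₚ c d x = (d :- c) :* ((x :- c) :* (x :- d))

    -- The minors of the last three rows are Schur polynomials times the Vandermonde product w₃, which keeps
    -- the normal forms small; the whole determinant is out of reach of the ring solver.
    m012 : ∀ c d x → d₃ c d x 0 1 2 ≡ w₃ c d x * (+ 1)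
    m012 = solve 3 (λ c d x → d₃ₚ c d x 0 1 2 := w₃ₚ c d x :* (con (+ 1))) refl

    m013 : ∀ c d x → d₃ c d x 0 1 3 ≡ w₃ c d x * ((c + d + x))
    m013 = solve 3 (λ c d x → d₃ₚ c d x 0 1 3 := w₃ₚ c d x :* ((c :+ d :+ x))) refl

    m014 : ∀ c d x → d₃ c d x 0 1 4 ≡ w₃ c d x * ((c * c + d * d + x * x + c * d + c * x + d * x))
    m014 = solve 3 (λ c d x → d₃ₚ c d x 0 1 4 := w₃ₚ c d x :* ((c :* c :+ d :* d :+ x :* x :+ c :* d :+ c :* x :+ d :* x))) refl

    m023 : ∀ c d x → d₃ c d x 0 2 3 ≡ w₃ c d x * ((c * d + c * x + d * x))
    m023 = solve 3 (λ c d x → d₃ₚ c d x 0 2 3 := w₃ₚ c d x :* ((c :* d :+ c :* x :+ d :* x))) refl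

    m024 : ∀ c d x → d₃ c d x 0 2 4 ≡ w₃ c d x * (((c + d) * ((c + x) * (d + x))))
    m024 = solve 3 (λ c d x → d₃ₚ c d x 0 2 4 := w₃ₚ c d x :* (((c :+ d) :* ((c :+ x) :* (d :+ x))))) refl

    m034 : ∀ c d x → d₃ c d x 0 3 4 ≡ w₃ c d x * ((c * c * (d * d) + c * c * (x * x) + d * d * (x * x) + (c * (d * x)) * (c + d + x)))
    m034 = solve 3 (λ c d x → d₃ₚ c d x 0 3 4 := w₃ₚ c d x :* ((c :* c :* (d :* d) :+ c :* c :* (x :* x) :+ d :* d :* (x :* x) :+ (c :* (d :* x)) :* (c :+ d :+ x)))) refl

    m123 : ∀ c d x → d₃ c d x 1 2 3 ≡ w₃ c d x * ((c * (d * x)))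
    m123 = solve 3 (λ c d x → d₃ₚ c d x 1 2 3 := w₃ₚ c d x :* ((c :* (d :* x)))) refl

    m124 : ∀ c d x → d₃ c d x 1 2 4 ≡ w₃ c d x * (((c * (d * x)) * (c + d + x)))
    m124 = solve 3 (λ c d x → d₃ₚ c d x 1 2 4 := w₃ₚ c d x :* (((c :* (d :* x)) :* (c :+ d :+ x)))) refl

    m134 : ∀ c d x → d₃ c d x 1 3 4 ≡ w₃ c d x * (((c * (d * x)) * (c * d + c * x + d * x)))
    m134 = solve 3 (λ c d x → d₃ₚ c d x 1 3 4 := w₃ₚ c d x :* (((c :* (d :* x)) :* (c :* d :+ c :* x :+ d :* x)))) refl

    m234 : ∀ c d x → d₃ c d x 2 3 4 ≡ w₃ c d x * (((c * (d * x)) * (c * (d * x))))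
    m234 = solve 3 (λ c d x → d₃ₚ c d x 2 3 4 := w₃ₚ c d x :* (((c :* (d :* x)) :* (c :* (d :* x))))) refl

    expand₄ : (p₀ p₁ p₂ p₃ q₀ q₁ q₂ q₃ : ℤ) → ℤ
    expand₄ p₀ p₁ p₂ p₃ q₀ q₁ q₂ q₃ = p₀ * q₀ + (- (p₁ * q₁) + (p₂ * q₂ + (- (p₃ * q₃) + + 0)))

    expand₄-cong : ∀ p₀ p₁ p₂ p₃ {q₀ q₁ q₂ q₃ r₀ r₁ r₂ r₃} → q₀ ≡ r₀ → q₁ ≡ r₁ → q₂ ≡ r₂ → q₃ ≡ r₃ →
      expand₄ p₀ p₁ p₂ p₃ q₀ q₁ q₂ q₃ ≡ expand₄ p₀ p₁ p₂ p₃ r₀ r₁ r₂ r₃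
    expand₄-cong _ _ _ _ refl refl refl refl = refl

    w₄ : (b c d x : ℤ) → ℤ
    w₄ b c d x = (c - b) * ((d - b) * (x - b)) * w₃ c d x

    -- Deleting column k from the rows of b, c, d, x leaves the Vandermonde product `w₄` times the
    -- elementary symmetric polynomial of degree 4 - k; `n0` to `n4` are the five cases.
    n0 : ∀ b c d x → expand₄ (power b 1) (power b 2) (power b 3) (power b 4) (d₃ c d x 2 3 4) (d₃ c d x 1 3 4) (d₃ c d x 1 2 4) (d₃ c d x 1 2 3) ≡ w₄ b c d x * ((b * c * d * x))
    n0 b c d x = trans (expand₄-cong (power b 1) (power b 2) (power b 3) (power b 4) (m234 c d x) (m134 c d x) (m124 c d x) (m123 c d x))
      (solve 5 (λ b c d x w → powerₚ b 1 :* (w :* (((c :* (d :* x)) :* (c :* (d :* x))))) :+ (:- (powerₚ b 2 :* (w :* (((c :* (d :* x)) :* (c :* d :+ c :* x :+ d :* x))))) :+ (powerₚ b 3 :* (w :* (((c :* (d :* x)) :* (c :+ d :+ x)))) :+ (:- (powerₚ b 4 :* (w :* ((c :* (d :* x))))) :+ con (+ 0)))) := (c :- b) :* ((d :- b) :* (x :- b)) :* w :* ((b :* c :* d :* x))) refl b c d x (w₃ c d x))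

    n1 : ∀ b c d x → expand₄ (power b 0) (power b 2) (power b 3) (power b 4) (d₃ c d x 2 3 4) (d₃ c d x 0 3 4) (d₃ c d x 0 2 4) (d₃ c d x 0 2 3) ≡ w₄ b c d x * ((b * c * d) + (b * c * x) + (b * d * x) + (c * d * x))
    n1 b c d x = trans (expand₄-cong (power b 0) (power b 2) (power b 3) (power b 4) (m234 c d x) (m034 c d x) (m024 c d x) (m023 c d x))
      (solve 5 (λ b c d x w → powerₚ b 0 :* (w :* (((c :* (d :* x)) :* (c :* (d :* x))))) :+ (:- (powerₚ b 2 :* (w :* ((c :* c :* (d :* d) :+ c :* c :* (x :* x) :+ d :* d :* (x :* x) :+ (c :* (d :* x)) :* (c :+ d :+ x))))) :+ (powerₚ b 3 :* (w :* (((c :+ d) :* ((c :+ x) :* (d :+ x))))) :+ (:- (powerₚ b 4 :* (w :* ((c :* d :+ c :* x :+ d :* x)))) :+ con (+ 0)))) := (c :- b) :* ((d :- b) :* (x :- b)) :* w :* ((b :* c :* d) :+ (b :* c :* x) :+ (b :* d :* x) :+ (c :* d :* x))) refl b c d x (w₃ c d x))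

    n2 : ∀ b c d x → expand₄ (power b 0) (power b 1) (power b 3) (power b 4) (d₃ c d x 1 3 4) (d₃ c d x 0 3 4) (d₃ c d x 0 1 4) (d₃ c d x 0 1 3) ≡ w₄ b c d x * ((b * c) + (b * d) + (b * x) + (c * d) + (c * x) + (d * x))
    n2 b c d x = trans (expand₄-cong (power b 0) (power b 1) (power b 3) (power b 4) (m134 c d x) (m034 c d x) (m014 c d x) (m013 c d x))
      (solve 5 (λ b c d x w → powerₚ b 0 :* (w :* (((c :* (d :* x)) :* (c :* d :+ c :* x :+ d :* x)))) :+ (:- (powerₚ b 1 :* (w :* ((c :* c :* (d :* d) :+ c :* c :* (x :* x) :+ d :* d :* (x :* x) :+ (c :* (d :* x)) :* (c :+ d :+ x))))) :+ (powerₚ b 3 :* (w :* ((c :* c :+ d :* d :+ x :* x :+ c :* d :+ c :* x :+ d :* x))) :+ (:- (powerₚ b 4 :* (w :* ((c :+ d :+ x)))) :+ con (+ 0)))) := (c :- b) :* ((d :- b) :* (x :- b)) :* w :* ((b :* c) :+ (b :* d) :+ (b :* x) :+ (c :* d) :+ (c :* x) :+ (d :* x))) refl b c d x (w₃ c d x))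

    n3 : ∀ b c d x → expand₄ (power b 0) (power b 1) (power b 2) (power b 4) (d₃ c d x 1 2 4) (d₃ c d x 0 2 4) (d₃ c d x 0 1 4) (d₃ c d x 0 1 2) ≡ w₄ b c d x * ((b) + (c) + (d) + (x))
    n3 b c d x = trans (expand₄-cong (power b 0) (power b 1) (power b 2) (power b 4) (m124 c d x) (m024 c d x) (m014 c d x) (m012 c d x))
      (solve 5 (λ b c d x w → powerₚ b 0 :* (w :* (((c :* (d :* x)) :* (c :+ d :+ x)))) :+ (:- (powerₚ b 1 :* (w :* (((c :+ d) :* ((c :+ x) :* (d :+ x)))))) :+ (powerₚ b 2 :* (w :* ((c :* c :+ d :* d :+ x :* x :+ c :* d :+ c :* x :+ d :* x))) :+ (:- (powerₚ b 4 :* (w :* (con (+ 1)))) :+ con (+ 0)))) := (c :- b) :* ((d :- b) :* (x :- b)) :* w :* ((b) :+ (c) :+ (d) :+ (x))) refl b c d x (w₃ c d x))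

    n4 : ∀ b c d x → expand₄ (power b 0) (power b 1) (power b 2) (power b 3) (d₃ c d x 1 2 3) (d₃ c d x 0 2 3) (d₃ c d x 0 1 3) (d₃ c d x 0 1 2) ≡ w₄ b c d x * (+ 1)
    n4 b c d x = trans (expand₄-cong (power b 0) (power b 1) (power b 2) (power b 3) (m123 c d x) (m023 c d x) (m013 c d x) (m012 c d x))
      (solve 5 (λ b c d x w → powerₚ b 0 :* (w :* ((c :* (d :* x)))) :+ (:- (powerₚ b 1 :* (w :* ((c :* d :+ c :* x :+ d :* x)))) :+ (powerₚ b 2 :* (w :* ((c :+ d :+ x))) :+ (:- (powerₚ b 3 :* (w :* (con (+ 1)))) :+ con (+ 0)))) := (c :- b) :* ((d :- b) :* (x :- b)) :* w :* (con (+ 1))) refl b c d x (w₃ c d x))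

    expand₅ : (p₀ p₁ p₂ p₃ p₄ q₀ q₁ q₂ q₃ q₄ : ℤ) → ℤ
    expand₅ p₀ p₁ p₂ p₃ p₄ q₀ q₁ q₂ q₃ q₄ = p₀ * q₀ + (- (p₁ * q₁) + (p₂ * q₂ + (- (p₃ * q₃) + (p₄ * q₄ + + 0))))

    expand₅-cong : ∀ p₀ p₁ p₂ p₃ p₄ {q₀ q₁ q₂ q₃ q₄ r₀ r₁ r₂ r₃ r₄} → q₀ ≡ r₀ → q₁ ≡ r₁ → q₂ ≡ r₂ → q₃ ≡ r₃ → q₄ ≡ r₄ →
      expand₅ p₀ p₁ p₂ p₃ p₄ q₀ q₁ q₂ q₃ q₄ ≡ expand₅ p₀ p₁ p₂ p₃ p₄ r₀ r₁ r₂ r₃ r₄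
    expand₅-cong _ _ _ _ _ refl refl refl refl refl = refl

    -- The alternating sum of the elementary symmetric polynomials with powers of a is the expansion
    -- of (b - a)(c - a)(d - a)(x - a).
    vandermonde : ∀ a b c d x → expand₅ (power a 0) (power a 1) (power a 2) (power a 3) (power a 4)
      (expand₄ (power b 1) (power b 2) (power b 3) (power b 4) (d₃ c d x 2 3 4) (d₃ c d x 1 3 4) (d₃ c d x 1 2 4) (d₃ c d x 1 2 3))
      (expand₄ (power b 0) (power b 2) (power b 3) (power b 4) (d₃ c d x 2 3 4) (d₃ c d x 0 3 4) (d₃ c d x 0 2 4) (d₃ c d x 0 2 3))
      (expand₄ (power b 0) (power b 1) (power b 3) (power b 4) (d₃ c d x 1 3 4) (d₃ c d x 0 3 4) (d₃ c d x 0 1 4) (d₃ c d x 0 1 3))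
      (expand₄ (power b 0) (power b 1) (power b 2) (power b 4) (d₃ c d x 1 2 4) (d₃ c d x 0 2 4) (d₃ c d x 0 1 4) (d₃ c d x 0 1 2))
      (expand₄ (power b 0) (power b 1) (power b 2) (power b 3) (d₃ c d x 1 2 3) (d₃ c d x 0 2 3) (d₃ c d x 0 1 3) (d₃ c d x 0 1 2))
      ≡ (b - a) * ((c - a) * ((d - a) * (x - a))) * w₄ b c d x
    vandermonde a b c d x = trans (expand₅-cong (power a 0) (power a 1) (power a 2) (power a 3) (power a 4) (n0 b c d x) (n1 b c d x) (n2 b c d x) (n3 b c d x) (n4 b c d x))
      (solve 6 (λ a b c d x w → powerₚ a 0 :* (w :* ((b :* c :* d :* x))) :+ (:- (powerₚ a 1 :* (w :* ((b :* c :* d) :+ (b :* c :* x) :+ (b :* d :* x) :+ (c :* d :* x)))) :+ (powerₚ a 2 :* (w :* ((b :* c) :+ (b :* d) :+ (b :* x) :+ (c :* d) :+ (c :* x) :+ (d :* x))) :+ (:- (powerₚ a 3 :* (w :* ((b) :+ (c) :+ (d) :+ (x)))) :+ (powerₚ a 4 :* (w :* (con (+ 1))) :+ con (+ 0))))) := (b :- a) :* ((c :- a) :* ((d :- a) :* (x :- a))) :* w) refl a b c d x (w₄ b c d x))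

    detRows : (α β γ δ ξ : ℕ → ℤ) → ℤ
    detRows α β γ δ ξ = det 5 λ where
      zero k → α (toℕ k)
      (suc zero) k → β (toℕ k)
      (suc (suc zero)) k → γ (toℕ k)
      (suc (suc (suc zero))) k → δ (toℕ k)
      (suc (suc (suc (suc zero)))) k → ξ (toℕ k)

    row : (a₀ a₁ a₂ a₃ a₄ : ℤ) → ℕ → ℤ
    row a₀ a₁ a₂ a₃ a₄ 0 = a₀
    row a₀ a₁ a₂ a₃ a₄ 1 = a₁
    row a₀ a₁ a₂ a₃ a₄ 2 = a₂
    row a₀ a₁ a₂ a₃ a₄ 3 = a₃
    row a₀ a₁ a₂ a₃ a₄ _ = a₄

    powers homs : ∀ {n} → Fin n → ℕ → ℤ
    powers i = row (+ 1) a (a * a) (a * (a * a)) (a * (a * (a * a)))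
      where a = + toℕ i
    homs i = row (+ (toℕ i ^ 0)) (+ (toℕ i ^ 1)) (+ (toℕ i ^ 2)) (+ (toℕ i ^ 3)) (+ (toℕ i ^ 4))

    homs≡powers : ∀ {n} (i : Fin n) → homs i ≡ powers i
    homs≡powers i = cong₄ (row (+ 1)) e₁ e₂ e₃ e₄
      where
      a = toℕ i
      cong₄ : ∀ (f : ℤ → ℤ → ℤ → ℤ → ℕ → ℤ) {x y z w x′ y′ z′ w′} → x ≡ x′ → y ≡ y′ → z ≡ z′ → w ≡ w′ → f x y z w ≡ f x′ y′ z′ w′
      cong₄ f refl refl refl refl = refl
      e₁ : + (a ^ 1) ≡ + a
      e₁ = cong +_ (ℕ.*-identityʳ a)
      e₂ : + (a ^ 2) ≡ + a * + a
      e₂ = trans (pos-* a (a ^ 1)) (cong (+ a *_) e₁)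
      e₃ : + (a ^ 3) ≡ + a * (+ a * + a)
      e₃ = trans (pos-* a (a ^ 2)) (cong (+ a *_) e₂)
      e₄ : + (a ^ 4) ≡ + a * (+ a * (+ a * + a))
      e₄ = trans (pos-* a (a ^ 3)) (cong (+ a *_) e₃)

    cong₅ : ∀ {A : Set} (f : A → A → A → A → A → ℤ) {a b c d x a′ b′ c′ d′ x′} →
            a ≡ a′ → b ≡ b′ → c ≡ c′ → d ≡ d′ → x ≡ x′ → f a b c d x ≡ f a′ b′ c′ d′ x′
    cong₅ f refl refl refl refl refl = refl

  -- The factors are grouped so that the first bracket is independent of x, and positive when a < b
  -- < c < d; the sign of `side` is then that of the second bracket.
  side-vandermonde : ∀ {n} (a b c d x : Fin n) → let A = + toℕ a; B = + toℕ b; C = + toℕ c; D = + toℕ d; X = + toℕ x in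
    side a b c d x ≡ (((B - A) * (C - A) * (D - A)) * ((C - B) * (D - B)) * (D - C)) * (((X - A) * (X - B)) * ((X - C) * (X - D)))
  side-vandermonde a b c d x = begin
    side a b c d x                                            ≡⟨⟩
    detRows (homs a) (homs b) (homs c) (homs d) (homs x)      ≡⟨ cong₅ detRows (homs≡powers a) (homs≡powers b) (homs≡powers c) (homs≡powers d) (homs≡powers x) ⟩
    detRows (powers a) (powers b) (powers c) (powers d) (powers x) ≡⟨ vandermonde (+ toℕ a) (+ toℕ b) (+ toℕ c) (+ toℕ d) (+ toℕ x) ⟩
    _                                                         ≡⟨ regroup (B - A) (C - A) (D - A) (X - A) (C - B) (D - B) (X - B) (D - C) (X - C) (X - D) ⟩
    _ ∎
    where
    open ≡-Reasoning
    A = + toℕ a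
    B = + toℕ b
    C = + toℕ c
    D = + toℕ d
    X = + toℕ x
    regroup : ∀ ba ca da xa cb db xb dc xc xd →
      ba * (ca * (da * xa)) * (cb * (db * xb) * (dc * (xc * xd))) ≡ ba * ca * da * (cb * db) * dc * (xa * xb * (xc * xd))
    regroup = solve 10 (λ ba ca da xa cb db xb dc xc xd →
      ba :* (ca :* (da :* xa)) :* (cb :* (db :* xb) :* (dc :* (xc :* xd))) := ba :* ca :* da :* (cb :* db) :* dc :* (xa :* xb :* (xc :* xd))) refl

-- Gale's evenness condition for the facets.

module GaleEvenness where
  open import Defs
  open import Data.Nat as ℕ using (ℕ; zero; suc; z≤n; s≤s)
  import Data.Nat.Properties as ℕ
  open import Data.Integer using (ℤ; +_; -[1+_]; +[1+_]; _*_; _-_; _≤_; _<_; 0ℤ; +≤+; -≤+; +<+; -<+)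
  open import Data.Integer.Properties
  open import Data.Fin using (Fin; zero; suc; toℕ)
  open import Data.Empty using (⊥; ⊥-elim)
  open import Data.Fin using (fromℕ<)
  open import Data.Fin.Properties using (toℕ-fromℕ<; toℕ<n)
  open import Data.Fin.Subset using (Subset; _∪_; ⁅_⁆)
  open import Data.Product using (_×_; _,_)
  open import Data.Sum using (_⊎_; inj₁; inj₂)
  open import Relation.Nullary using (yes; no)
  open import Relation.Binary.PropositionalEquality
  open Vandermonde

  quad : ∀ {n} → Fin n → Fin n → Fin n → Fin n → Subset n
  quad a b c d = ⁅ a ⁆ ∪ ⁅ b ⁆ ∪ ⁅ c ⁆ ∪ ⁅ d ⁆

  private
    ≥0*≥0 : ∀ {p q} → 0ℤ ≤ p → 0ℤ ≤ q → 0ℤ ≤ p * q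
    ≥0*≥0 {+ m} {+ n} _ _ = subst (0ℤ ≤_) (pos-* m n) (+≤+ z≤n)
    ≤0*≤0 : ∀ {p q} → p ≤ 0ℤ → q ≤ 0ℤ → 0ℤ ≤ p * q
    ≤0*≤0 {+ zero} (+≤+ z≤n) b = ≤-refl
    ≤0*≤0 { -[1+ m ]} {+ zero} a (+≤+ z≤n) = ≤-reflexive (sym (*-zeroʳ -[1+ m ]))
    ≤0*≤0 { -[1+ m ]} { -[1+ n ]} a b = +≤+ z≤n
    ≤0*≥0 : ∀ {p q} → p ≤ 0ℤ → 0ℤ ≤ q → p * q ≤ 0ℤ
    ≤0*≥0 {+ zero} (+≤+ z≤n) b = ≤-refl
    ≤0*≥0 { -[1+ m ]} {+ zero} a b = ≤-reflexive (*-zeroʳ -[1+ m ])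
    ≤0*≥0 { -[1+ m ]} {+[1+ n ]} a b = -≤+
    >0*>0 : ∀ {p q} → 0ℤ < p → 0ℤ < q → 0ℤ < p * q
    >0*>0 {+[1+ m ]} {+[1+ n ]} _ _ = +<+ (s≤s z≤n)
    >0*>0 {+ zero} (+<+ ()) _
    >0*>0 {+[1+ m ]} {+ zero} _ (+<+ ())
    <0*<0 : ∀ {p q} → p < 0ℤ → q < 0ℤ → 0ℤ < p * q
    <0*<0 { -[1+ m ]} { -[1+ n ]} _ _ = +<+ (s≤s z≤n)
    <0*<0 {+ m} (+<+ ()) _
    <0*<0 { -[1+ m ]} {+ n} _ (+<+ ())
    >0*<0 : ∀ {p q} → 0ℤ < p → q < 0ℤ → p * q < 0ℤ
    >0*<0 {+[1+ m ]} { -[1+ n ]} _ _ = -<+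
    >0*<0 {+ zero} (+<+ ()) _
    >0*<0 {+[1+ m ]} {+ n} _ (+<+ ())

    >0 : ∀ {x y} → x ℕ.< y → 0ℤ < + y - + x
    >0 {x} {y} l = subst (0ℤ <_) (sym (trans (m-n≡m⊖n y x) (⊖-≥ (ℕ.<⇒≤ l)))) (+<+ (ℕ.m<n⇒0<n∸m l))
    <0 : ∀ {x y} → x ℕ.< y → + x - + y < 0ℤ
    <0 {x} {y} l = subst (_< 0ℤ) (trans (neg-distrib x y) refl) (neg-mono-< (>0 l))
      where
      neg-distrib : ∀ x y → Data.Integer.- (+ y - + x) ≡ + x - + y
      neg-distrib x y = trans (cong Data.Integer.-_ (m-n≡m⊖n y x)) (trans (sym (⊖-swap x y)) (sym (m-n≡m⊖n x y)))
    ≥0 : ∀ {x y} → x ℕ.≤ y → 0ℤ ≤ + y - + x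
    ≥0 l = i≤j⇒0≤j-i (+≤+ l)
    ≤0 : ∀ {x y} → x ℕ.≤ y → + x - + y ≤ 0ℤ
    ≤0 l = i≤j⇒i-j≤0 (+≤+ l)

  module Signs {n} (a b c d : Fin n) (a<b : toℕ a ℕ.< toℕ b) (b<c : toℕ b ℕ.< toℕ c) (c<d : toℕ c ℕ.< toℕ d) where
    private
      A = toℕ a
      B = toℕ b
      C = toℕ c
      D = toℕ d
      volume : ℤ
      volume = ((+ B - + A) * (+ C - + A) * (+ D - + A)) * ((+ C - + B) * (+ D - + B)) * (+ D - + C)
      volume>0 : 0ℤ < volume
      volume>0 = >0*>0 (>0*>0 (>0*>0 (>0*>0 (>0 a<b) (>0 (ℕ.<-trans a<b b<c))) (>0 (ℕ.<-trans a<b (ℕ.<-trans b<c c<d))))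
                     (>0*>0 (>0 b<c) (>0 (ℕ.<-trans b<c c<d)))) (>0 c<d)
      product : Fin n → ℤ
      product x = ((+ toℕ x - + A) * (+ toℕ x - + B)) * ((+ toℕ x - + C) * (+ toℕ x - + D))
      pos : ∀ x → 0ℤ < product x → 0ℤ < side a b c d x
      pos x p = subst (0ℤ <_) (sym (side-vandermonde a b c d x)) (>0*>0 volume>0 p)
      neg : ∀ x → product x < 0ℤ → side a b c d x < 0ℤ
      neg x p = subst (_< 0ℤ) (sym (side-vandermonde a b c d x)) (>0*<0 volume>0 p)
      -- No integer lies strictly between y and y + 1, so both factors have the same sign.
      pair : ∀ {y z} → z ≡ suc y → ∀ x → 0ℤ ≤ (+ x - + y) * (+ x - + z)
      pair {y} refl x with suc y ℕ.≤? x
      ... | yes l = ≥0*≥0 (≥0 (ℕ.<⇒≤ l)) (≥0 l)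
      ... | no l = ≤0*≤0 (≤0 (ℕ.≤-pred (ℕ.≰⇒> l))) (≤0 (ℕ.≤-trans (ℕ.≤-pred (ℕ.≰⇒> l)) (ℕ.n≤1+n y)))

    side≥0 : B ≡ suc A → D ≡ suc C → ∀ x → 0ℤ ≤ side a b c d x
    side≥0 e f x = subst (0ℤ ≤_) (sym (side-vandermonde a b c d x)) (≥0*≥0 (<⇒≤ volume>0) (≥0*≥0 (pair e (toℕ x)) (pair f (toℕ x))))

    -- The outer factors belonging to a and d have opposite signs because a and d are the extreme
    -- indices; the inner ones belong to consecutive indices.
    side≤0 : A ≡ 0 → C ≡ suc B → (∀ (x : Fin n) → toℕ x ℕ.≤ D) → ∀ x → side a b c d x ≤ 0ℤ
    side≤0 e f last x = subst (_≤ 0ℤ) (sym (trans (side-vandermonde a b c d x) (trans (*-comm volume (product x)) (cong (_* volume) (shuffle X A′ B′ C′ D′)))))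
       (≤0*≥0 (≤0*≥0 (subst (_≤ 0ℤ) (*-comm (X - D′) (X - A′)) (≤0*≥0 (≤0 (last x)) (≥0 (subst (ℕ._≤ toℕ x) (sym e) z≤n)))) (pair f (toℕ x))) (<⇒≤ volume>0))
      where
      X = + toℕ x
      A′ = + A
      B′ = + B
      C′ = + C
      D′ = + D
      shuffle : ∀ X A B C D → ((X - A) * (X - B)) * ((X - C) * (X - D)) ≡ ((X - A) * (X - D)) * ((X - B) * (X - C))
      shuffle X A B C D = trans (*-assoc (X - A) (X - B) ((X - C) * (X - D))) (trans (cong ((X - A) *_) (trans (sym (*-assoc (X - B) (X - C) (X - D))) (*-comm ((X - B) * (X - C)) (X - D))))
                            (sym (*-assoc (X - A) (X - D) ((X - B) * (X - C)))))

    module _ (f : ∀ x → 0ℤ ≤ side a b c d x) (x : Fin n) where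
      not-inside₁ : A ℕ.< toℕ x → toℕ x ℕ.< B → ⊥
      not-inside₁ l m = <-irrefl refl (≤-<-trans (f x) (neg x (subst (_< 0ℤ) (*-comm ((+ toℕ x - + C) * (+ toℕ x - + D)) ((+ toℕ x - + A) * (+ toℕ x - + B)))
        (>0*<0 (<0*<0 (<0 (ℕ.<-trans m b<c)) (<0 (ℕ.<-trans m (ℕ.<-trans b<c c<d)))) (>0*<0 (>0 l) (<0 m))))))
      not-inside₃ : C ℕ.< toℕ x → toℕ x ℕ.< D → ⊥
      not-inside₃ l m = <-irrefl refl (≤-<-trans (f x) (neg x
        (>0*<0 (>0*>0 (>0 (ℕ.<-trans a<b (ℕ.<-trans b<c l))) (>0 (ℕ.<-trans b<c l))) (>0*<0 (>0 l) (<0 m)))))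

    module _ (f : ∀ x → side a b c d x ≤ 0ℤ) (x : Fin n) where
      not-below : toℕ x ℕ.< A → ⊥
      not-below l = <-irrefl refl (<-≤-trans (pos x (>0*>0 (<0*<0 (<0 l) (<0 (ℕ.<-trans l a<b)))
        (<0*<0 (<0 (ℕ.<-trans l (ℕ.<-trans a<b b<c))) (<0 (ℕ.<-trans l (ℕ.<-trans a<b (ℕ.<-trans b<c c<d))))))) (f x))
      not-above : D ℕ.< toℕ x → ⊥
      not-above l = <-irrefl refl (<-≤-trans (pos x (>0*>0 (>0*>0 (>0 (ℕ.<-trans a<b (ℕ.<-trans b<c (ℕ.<-trans c<d l)))) (>0 (ℕ.<-trans b<c (ℕ.<-trans c<d l))))
        (>0*>0 (>0 (ℕ.<-trans c<d l)) (>0 l)))) (f x))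
      not-inside₂ : B ℕ.< toℕ x → toℕ x ℕ.< C → ⊥
      not-inside₂ l m = <-irrefl refl (<-≤-trans (pos x (>0*>0 (>0*>0 (>0 (ℕ.<-trans a<b l)) (>0 l))
        (<0*<0 (<0 m) (<0 (ℕ.<-trans m c<d))))) (f x))

  -- The two shapes in dimension 4: two consecutive pairs, or one consecutive pair together with the
  -- pair {n - 1, 0} that wraps around.
  Even : ∀ {n} (a b c d : Fin n) → Set
  Even {n} a b c d = toℕ b ≡ suc (toℕ a) × toℕ d ≡ suc (toℕ c) ⊎
                     toℕ a ≡ 0 × toℕ c ≡ suc (toℕ b) × suc (toℕ d) ≡ n

  record Facet (n : ℕ) (F : Subset n) : Set where
    constructor facet
    field
      {a b c d} : Fin n
      a<b : toℕ a ℕ.< toℕ b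
      b<c : toℕ b ℕ.< toℕ c
      c<d : toℕ c ℕ.< toℕ d
      F≡ : F ≡ quad a b c d
      even : Even a b c d

  private
    next : ∀ {n} (x y : Fin n) → toℕ x ℕ.< toℕ y → (∀ z → toℕ x ℕ.< toℕ z → toℕ z ℕ.< toℕ y → ⊥) → suc (toℕ x) ≡ toℕ y
    next x y l g with suc (toℕ x) ℕ.≟ toℕ y
    ... | yes z = z
    ... | no z = ⊥-elim (g (fromℕ< l″) (ℕ.≤-reflexive (sym (toℕ-fromℕ< l″))) (subst (ℕ._< toℕ y) (sym (toℕ-fromℕ< l″)) l′))
      where
      l′ = ℕ.≤∧≢⇒< l z
      l″ = ℕ.<-trans l′ (toℕ<n y)

    least : ∀ {n} (x : Fin n) → (∀ z → toℕ z ℕ.< toℕ x → ⊥) → toℕ x ≡ 0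
    least x g with toℕ x ℕ.≟ 0
    ... | yes z = z
    ... | no z = ⊥-elim (g (fromℕ< 0<n) (subst (ℕ._< toℕ x) (sym (toℕ-fromℕ< 0<n)) (ℕ.n≢0⇒n>0 z)))
      where
      0<n = ℕ.≤-<-trans z≤n (toℕ<n x)

    greatest : ∀ {n} (x : Fin n) → (∀ z → toℕ x ℕ.< toℕ z → ⊥) → suc (toℕ x) ≡ n
    greatest {n} x g with suc (toℕ x) ℕ.≟ n
    ... | yes z = z
    ... | no z = ⊥-elim (g (fromℕ< l) (ℕ.≤-reflexive (sym (toℕ-fromℕ< l))))
      where
      l = ℕ.≤∧≢⇒< (toℕ<n x) z

  abstract
    gale⁺ : ∀ {n F} → Facet n F → IsFacet n F
    gale⁺ (facet {a} {b} {c} {d} l₁ l₂ l₃ F≡ (inj₁ (p , q))) = a , b , c , d , l₁ , l₂ , l₃ , F≡ , inj₁ (Signs.side≥0 a b c d l₁ l₂ l₃ p q)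
    gale⁺ (facet {a} {b} {c} {d} l₁ l₂ l₃ F≡ (inj₂ (p , q , r))) = a , b , c , d , l₁ , l₂ , l₃ , F≡ ,
      inj₂ (Signs.side≤0 a b c d l₁ l₂ l₃ p q (λ x → ℕ.≤-pred (ℕ.≤-trans (toℕ<n x) (ℕ.≤-reflexive (sym r)))))

    -- An index in one of the gaps would be a point strictly on the wrong side of the hyperplane, so
    -- the gaps are empty and their ends consecutive.
    gale⁻ : ∀ {n F} → IsFacet n F → Facet n F
    gale⁻ (a , b , c , d , l₁ , l₂ , l₃ , F≡ , inj₁ f) = facet l₁ l₂ l₃ F≡ (inj₁ (sym (next a b l₁ (not-inside₁ f)) , sym (next c d l₃ (not-inside₃ f))))
      where
      open Signs a b c d l₁ l₂ l₃
    gale⁻ (a , b , c , d , l₁ , l₂ , l₃ , F≡ , inj₂ f) = facet l₁ l₂ l₃ F≡ (inj₂ (least a (not-below f) , sym (next b c l₂ (not-inside₂ f)) , greatest d (not-above f)))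
      where
      open Signs a b c d l₁ l₂ l₃

open import Data.Nat using (ℕ; zero; suc; _+_; _∸_; _≤_; _<_; z≤n; s≤s; _*_; _⊔_; _≤?_; _<?_; _≟_; _^_)
open import Data.Nat.Properties
open import Data.Product using (_×_; _,_; ∃; ∃-syntax; proj₂; proj₁)
open import Data.Sum using (_⊎_; inj₁; inj₂; [_,_]′)
open import Data.Empty using (⊥; ⊥-elim)
open import Relation.Nullary using (Dec; yes; no; map′; ¬_)
open import Relation.Binary.PropositionalEquality
open import Relation.Binary.Definitions using (tri<; tri≈; tri>)

-- Two neighbouring polygons and the rungs between them.

module Wedges where
  ≢⇒<⊎> : ∀ {a b : ℕ} → a ≢ b → a < b ⊎ b < a
  ≢⇒<⊎> {a} {b} ne with <-cmp a b
  ... | tri< l _ _ = inj₁ l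
  ... | tri≈ _ e _ = ⊥-elim (ne e)
  ... | tri> _ _ g = inj₂ g

  -- Two cycles of m vertices, given by their heights and listed from 1 to m,
  -- sharing the edge {1 , m}; the remaining vertices are joined by rungs.
  record Wedge (m : ℕ) (X Y : ℕ → ℕ) : Set where
    field
      first   : X 1 ≡ Y 1
      last    : X m ≡ Y m
      closing : X 1 ≢ X m
      X-edge  : ∀ {i} → 1 ≤ i → i < m → X i ≢ X (suc i)
      Y-edge  : ∀ {i} → 1 ≤ i → i < m → Y i ≢ Y (suc i)
      rung    : ∀ {i} → 2 ≤ i → i < m → X i ≢ Y i
      quad₁   : ∀ {i} → 2 ≤ i → suc i < m →
                X (suc i) < X i → X (suc i) < Y (suc i) → Y i < X i → Y i < Y (suc i) → ⊥
      quad₂   : ∀ {i} → 2 ≤ i → suc i < m →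
                X i < X (suc i) → X i < Y i → Y (suc i) < X (suc i) → Y (suc i) < Y i → ⊥
      X-peak  : ∀ {i} → 1 ≤ i → suc i < m → X i < X (suc i) → X (suc (suc i)) < X (suc i) →
                ∀ {k} → 1 ≤ k → k ≤ m → X k ≤ X (suc i)
      Y-peak  : ∀ {i} → 1 ≤ i → suc i < m → Y i < Y (suc i) → Y (suc (suc i)) < Y (suc i) →
                ∀ {k} → 1 ≤ k → k ≤ m → Y k ≤ Y (suc i)
      X-pit   : ∀ {i} → 1 ≤ i → suc i < m → X (suc i) < X i → X (suc i) < X (suc (suc i)) →
                ∀ {k} → 1 ≤ k → k ≤ m → X (suc i) ≤ X k
      Y-pit   : ∀ {i} → 1 ≤ i → suc i < m → Y (suc i) < Y i → Y (suc i) < Y (suc (suc i)) →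
                ∀ {k} → 1 ≤ k → k ≤ m → Y (suc i) ≤ Y k
      X-peak₁ : X 2 < X 1 → X m < X 1 → ∀ {k} → 1 ≤ k → k ≤ m → X k ≤ X 1
      Y-peak₁ : Y 2 < Y 1 → Y m < Y 1 → ∀ {k} → 1 ≤ k → k ≤ m → Y k ≤ Y 1
      X-pit₁  : X 1 < X 2 → X 1 < X m → ∀ {k} → 1 ≤ k → k ≤ m → X 1 ≤ X k
      Y-pit₁  : Y 1 < Y 2 → Y 1 < Y m → ∀ {k} → 1 ≤ k → k ≤ m → Y 1 ≤ Y k
      X-peakₘ : ∀ {i} → suc i ≡ m → X i < X m → X 1 < X m → ∀ {k} → 1 ≤ k → k ≤ m → X k ≤ X m
      Y-peakₘ : ∀ {i} → suc i ≡ m → Y i < Y m → Y 1 < Y m → ∀ {k} → 1 ≤ k → k ≤ m → Y k ≤ Y m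
      X-pitₘ  : ∀ {i} → suc i ≡ m → X m < X i → X m < X 1 → ∀ {k} → 1 ≤ k → k ≤ m → X m ≤ X k
      Y-pitₘ  : ∀ {i} → suc i ≡ m → Y m < Y i → Y m < Y 1 → ∀ {k} → 1 ≤ k → k ≤ m → Y m ≤ Y k

  module _ {m : ℕ} {X Y : ℕ → ℕ} (W : Wedge m X Y) where
    open Wedge W

    -- The alternatives for a move from height v on the X-cycle to height w on
    -- the Y-cycle: the Y-cycle lies below v, or the X-cycle lies above w.
    Event : ℕ → ℕ → Set
    Event v w = (∀ {k} → 1 ≤ k → k ≤ m → Y k < v) ⊎ (∀ {k} → 1 ≤ k → k ≤ m → w < X k)

    weaken : ∀ {v w v' w'} → v ≤ v' → w' ≤ w → Event v w → Event v' w'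
    weaken p q (inj₁ f) = inj₁ λ a b → <-≤-trans (f a b) p
    weaken p q (inj₂ f) = inj₂ λ a b → ≤-<-trans q (f a b)

    -- While the two cycles run in opposite directions, the quadrilaterals force
    -- all rungs to point the same way; the zone ends at a source of Y or a sink of X.
    scanUp : ∀ d i → d + suc i ≡ m → 2 ≤ i → Y i < X i → X (suc i) < X i → Y i < Y (suc i) →
             Event (X i) (Y i)
    -- At the end of the wedge the polygons share their last vertex, and the direction of the
    -- closing edge decides whether it is a maximum of Y or a minimum of X.
    scanUp zero i refl 2≤i r x y with ≢⇒<⊎> closing
    ... | inj₁ X₁<Xₘ = inj₁ λ a b → ≤-<-trans (Y-peakₘ refl y (subst₂ _<_ first last X₁<Xₘ) a b)
                                              (subst (_< X i) last x)
    ... | inj₂ Xₘ<X₁ = inj₂ λ a b → <-≤-trans (subst (Y i <_) (sym last) y) (X-pitₘ refl x Xₘ<X₁ a b)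
    scanUp (suc d) i e 2≤i r x y = go (≢⇒<⊎> (rung (≤-trans 2≤i (n≤1+n i)) si<m))
      where
      si<m : suc i < m
      si<m = subst (suc i <_) e (s≤s (m≤n+m (suc i) d))
      1≤i = ≤-trans (s≤s z≤n) 2≤i
      go : X (suc i) < Y (suc i) ⊎ Y (suc i) < X (suc i) → Event (X i) (Y i)
      -- A rung pointing back would make X at i + 1 and Y at i two local minima of one
      -- quadrilateral.
      go (inj₁ b) = ⊥-elim (quad₁ 2≤i si<m x b r y)
      go (inj₂ r') with ≢⇒<⊎> (Y-edge (s≤s z≤n) si<m)
      ... | inj₂ y< = inj₁ λ a b → ≤-<-trans (Y-peak 1≤i si<m y y< a b) (<-trans r' x)
      ... | inj₁ y' with ≢⇒<⊎> (X-edge (s≤s z≤n) si<m)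
      ... | inj₁ x> = inj₂ λ a b → <-≤-trans (<-trans y r') (X-pit 1≤i si<m x x> a b)
      ... | inj₂ x' = weaken (<⇒≤ x) (<⇒≤ y)
                        (scanUp d (suc i) (trans (+-suc d (suc i)) e) (≤-trans 2≤i (n≤1+n i)) r' x' y')

    scanDown : ∀ i → 1 ≤ i → suc i < m → Y (suc i) < X (suc i) → X i < X (suc i) → Y (suc i) < Y i →
               Event (X (suc i)) (Y (suc i))
    scanDown (suc zero) 1≤i i<m r x y with ≢⇒<⊎> closing
    ... | inj₁ X₁<Xₘ = inj₂ λ a b → <-≤-trans (subst (Y 2 <_) (sym first) y) (X-pit₁ x X₁<Xₘ a b)
    ... | inj₂ Xₘ<X₁ = inj₁ λ a b → ≤-<-trans (Y-peak₁ y (subst₂ _<_ last first Xₘ<X₁) a b)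
                                              (subst (_< X 2) first x)
    scanDown (suc (suc i)) 1≤i i<m r x y =
      [ (λ e → e) , (λ (r' , x' , y') → weaken (<⇒≤ x) (<⇒≤ y) (scanDown (suc i) (s≤s z≤n) j<m r' x' y')) ]′
      (go (≢⇒<⊎> (rung (s≤s (s≤s z≤n)) j<m)))
      where
      j = suc (suc i)
      j<m = <-trans (n<1+n j) i<m
      go : X j < Y j ⊎ Y j < X j →
           Event (X (suc j)) (Y (suc j)) ⊎ (Y j < X j × X (suc i) < X j × Y j < Y (suc i))
      go (inj₁ b) = ⊥-elim (quad₂ (s≤s (s≤s z≤n)) i<m x b r y)
      go (inj₂ r') with ≢⇒<⊎> (Y-edge {suc i} (s≤s z≤n) (<-trans (n<1+n _) j<m))
      ... | inj₁ y< = inj₁ (inj₁ λ a b → ≤-<-trans (Y-peak (s≤s z≤n) j<m y< y a b) (<-trans r' x))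
      ... | inj₂ y' with ≢⇒<⊎> (X-edge {suc i} (s≤s z≤n) (<-trans (n<1+n _) j<m))
      ... | inj₂ x> = inj₁ (inj₂ λ a b → <-≤-trans (<-trans y r') (X-pit (s≤s z≤n) j<m x> x a b))
      ... | inj₁ x' = inj₂ (r' , x' , y')

    scanUp′ : ∀ {i} → 2 ≤ i → i < m → Y i < X i → X (suc i) < X i → Y i < Y (suc i) → Event (X i) (Y i)
    scanUp′ {i} a b = scanUp (m ∸ suc i) i (m∸n+n≡m b) a

    -- The four ways in which the directions at the two ends of a rung disagree.
    up-out : ∀ {i} → 1 ≤ i → suc i < m → Y (suc i) < X (suc i) →
             X (suc (suc i)) < X (suc i) → Y (suc i) < Y (suc (suc i)) → Event (X (suc i)) (Y (suc i))
    up-out a = scanUp′ (s≤s a)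

    down-out : ∀ {i} → 1 ≤ i → suc i < m → Y (suc i) < X (suc i) →
               X i < X (suc i) → Y (suc i) < Y i → Event (X (suc i)) (Y (suc i))
    down-out {i} = scanDown i

    -- Reduced to the outward case on the other side of the rung: unless the upper end is a minimum
    -- of X or the lower end a maximum of Y, the arcs there disagree outward.
    up-in : ∀ {i} → 1 ≤ i → suc i < m → Y (suc i) < X (suc i) →
            X (suc i) < X (suc (suc i)) → Y (suc (suc i)) < Y (suc i) → Event (X (suc i)) (Y (suc i))
    up-in {i} a b r x y with ≢⇒<⊎> (X-edge a (<-trans (n<1+n _) b))
    ... | inj₂ x< = inj₂ λ c d → <-≤-trans r (X-pit a b x< x c d)
    ... | inj₁ x' with ≢⇒<⊎> (Y-edge a (<-trans (n<1+n _) b))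
    ... | inj₁ y< = inj₁ λ c d → ≤-<-trans (Y-peak a b y< y c d) r
    ... | inj₂ y' = down-out a b r x' y'

    down-in : ∀ {i} → 1 ≤ i → suc i < m → Y (suc i) < X (suc i) →
              X (suc i) < X i → Y i < Y (suc i) → Event (X (suc i)) (Y (suc i))
    down-in {i} a b r x y with ≢⇒<⊎> (X-edge (s≤s z≤n) b)
    ... | inj₁ x< = inj₂ λ c d → <-≤-trans r (X-pit a b x x< c d)
    ... | inj₂ x' with ≢⇒<⊎> (Y-edge (s≤s z≤n) b)
    ... | inj₂ y< = inj₁ λ c d → ≤-<-trans (Y-peak a b y y< c d) r
    ... | inj₁ y' = up-out a b r x' y'

-- Abstract description of the polygons and their heights.

module Landscapes where
  open Wedges

  ≤R : ∀ {a b c : ℕ} → a ≡ b → c ≤ a → c ≤ b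
  ≤R refl p = p
  ≤L : ∀ {a b c : ℕ} → a ≡ b → a ≤ c → b ≤ c
  ≤L refl p = p
  <R : ∀ {a b c : ℕ} → a ≡ b → c < a → c < b
  <R refl p = p
  <L : ∀ {a b c : ℕ} → a ≡ b → a < c → b < c
  <L refl p = p

  iter : ∀ {A : Set} → (A → A) → ℕ → A → A
  iter f zero    a = a
  iter f (suc i) a = f (iter f i a)

  -- The 2-faces {p , nx p} of the polar are polygons; Pol p i is the crossing of the polygons p and
  -- p ⊕ i for 2 ≤ i ≤ m, while Pol p 1 and Pol p (suc m) both denote the vertex {pv p , p , nx p , nx (nx p)}.
  record Landscape {V : Set} (h : V → ℕ) (_⟶_ : V → V → Set) (m : ℕ) : Set₁ where
    field
      Poly : Set
      nx pv : Poly → Poly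
      nx-pv : ∀ p → nx (pv p) ≡ p
      pv-nx : ∀ p → pv (nx p) ≡ p

    infixl 6 _⊕_
    _⊕_ : Poly → ℕ → Poly
    p ⊕ i = iter nx i p

    K : ℕ
    K = suc m

    field
      3≤m       : 3 ≤ m
      cycle     : ∀ p → p ⊕ suc K ≡ p
      connected : ∀ p k → ∃[ e ] (e ≤ K × p ⊕ e ≡ k)
      Pol       : Poly → ℕ → V
      corner    : ∀ p → Pol p 1 ≡ Pol p K
      shift     : ∀ p → Pol p 2 ≡ Pol (nx p) 1
      swap      : ∀ {p i j} → 2 ≤ i → 2 ≤ j → i + j ≡ suc K → Pol p i ≡ Pol (p ⊕ i) j

    H : Poly → ℕ → ℕ
    H p i = h (Pol p i)

    field
      edge  : ∀ {p i} → 1 ≤ i → i < K → H p i ≢ H p (suc i)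
      quad₁ : ∀ {p i} → 2 ≤ i → 3 + i ≤ K → H p (2 + i) < H p (1 + i) → H p (2 + i) < H (nx p) (1 + i) →
              H (nx p) i < H p (1 + i) → H (nx p) i < H (nx p) (1 + i) → ⊥
      quad₂ : ∀ {p i} → 2 ≤ i → 3 + i ≤ K → H p (1 + i) < H p (2 + i) → H p (1 + i) < H (nx p) i →
              H (nx p) (1 + i) < H p (2 + i) → H (nx p) (1 + i) < H (nx p) i → ⊥
      peak  : ∀ {p i} → 1 ≤ i → suc i < K → H p i < H p (suc i) → H p (2 + i) < H p (suc i) →
              ∀ {k} → 1 ≤ k → k ≤ K → H p k ≤ H p (suc i)
      pit   : ∀ {p i} → 1 ≤ i → suc i < K → H p (suc i) < H p i → H p (suc i) < H p (2 + i) →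
              ∀ {k} → 1 ≤ k → k ≤ K → H p (suc i) ≤ H p k
      peak₁ : ∀ {p} → H p 2 < H p 1 → H p m < H p 1 → ∀ {k} → 1 ≤ k → k ≤ K → H p k ≤ H p 1
      pit₁  : ∀ {p} → H p 1 < H p 2 → H p 1 < H p m → ∀ {k} → 1 ≤ k → k ≤ K → H p 1 ≤ H p k
      any? : (P : Poly → Set) → (∀ y → Dec (P y)) → Dec (∃ P)
      descends : ∀ {v w} → v ⟶ w → h w < h v
      up   : ∀ {p i} → 1 ≤ i → i < K → H p (suc i) < H p i → Pol p i ⟶ Pol p (suc i)
      down : ∀ {p i} → 1 ≤ i → i < K → H p i < H p (suc i) → Pol p (suc i) ⟶ Pol p i
      ports : ∀ {p i j w} → 1 ≤ i → 1 ≤ j → suc i + suc j ≡ suc K → Pol p (suc i) ⟶ w →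
              (w ≡ Pol p (2 + i) ⊎ w ≡ Pol p i) ⊎ (w ≡ Pol (p ⊕ suc i) (2 + j) ⊎ w ≡ Pol (p ⊕ suc i) j)

    Below Above : Poly → ℕ → Set
    Below p t = ∀ {j} → 1 ≤ j → j ≤ K → H p j < t
    Above p t = ∀ {j} → 1 ≤ j → j ≤ K → t ≤ H p j

    nx-⊕ : ∀ p i → nx p ⊕ i ≡ nx (p ⊕ i)
    nx-⊕ p zero    = refl
    nx-⊕ p (suc i) = cong nx (nx-⊕ p i)

    ⊕-+ : ∀ p i j → p ⊕ i ⊕ j ≡ p ⊕ (i + j)
    ⊕-+ p i zero    = cong (p ⊕_) (sym (+-identityʳ i))
    ⊕-+ p i (suc j) = trans (cong nx (⊕-+ p i j)) (cong (p ⊕_) (sym (+-suc i j)))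

    ⊕-back : ∀ p {i j} → i + j ≡ suc K → p ⊕ i ⊕ j ≡ p
    ⊕-back p {i} {j} e = trans (⊕-+ p i j) (trans (cong (p ⊕_) e) (cycle p))

    pv-⊕K : ∀ p → p ⊕ K ≡ pv p
    pv-⊕K p = trans (sym (pv-nx _)) (cong pv (cycle p))

    shift′ : ∀ p → Pol p K ≡ Pol (nx p) m
    shift′ p = begin
      Pol p K               ≡⟨ sym (corner p) ⟩
      Pol p 1               ≡⟨ cong (λ r → Pol r 1) (sym (nx-pv p)) ⟩
      Pol (nx (pv p)) 1     ≡⟨ sym (shift (pv p)) ⟩
      Pol (pv p) 2          ≡⟨ cong (λ r → Pol r 2) (sym (trans (cong (λ r → r ⊕ m) (refl {x = nx p})) (trans (nx-⊕ p m) (pv-⊕K p)))) ⟩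
      Pol (nx p ⊕ m) 2      ≡⟨ sym (swap (≤-trans (n≤1+n 2) 3≤m) ≤-refl (+-comm m 2)) ⟩
      Pol (nx p) m          ∎
      where open ≡-Reasoning

    position : ∀ {k} → 1 ≤ k → k ≤ K → ∀ {P : V → Set} {p} →
               (∀ {l} → 1 ≤ l → l ≤ m → P (Pol p (suc l))) → P (Pol p k)
    position {suc zero} a b {P} {p} f = subst P (sym (corner p)) (f (≤-trans (s≤s z≤n) 3≤m) ≤-refl)
    position {suc (suc k)} a (s≤s b) f = f (s≤s z≤n) b

    position′ : ∀ {k} → 1 ≤ k → k ≤ K → ∀ {P : V → Set} {p} →
               (∀ {l} → 1 ≤ l → l ≤ m → P (Pol p l)) → P (Pol p k)
    position′ {k} a b {P} {p} f with k ≤? m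
    ... | yes c = f a c
    ... | no c rewrite ≤-antisym b (≰⇒> c) = subst P (corner p) (f ≤-refl (≤-trans (s≤s z≤n) 3≤m))

    cornerH : ∀ p → H p 1 ≡ H p K
    cornerH p = cong h (corner p)

    peakₖ : ∀ {p} → H p m < H p K → H p 2 < H p K → ∀ {k} → 1 ≤ k → k ≤ K → H p k ≤ H p K
    peakₖ {p} a b c d = ≤R (cornerH p)
      (peak₁ (<R (sym (cornerH p)) b) (<R (sym (cornerH p)) a) c d)

    pitₖ : ∀ {p} → H p K < H p m → H p K < H p 2 → ∀ {k} → 1 ≤ k → k ≤ K → H p K ≤ H p k
    pitₖ {p} a b c d = ≤L (cornerH p)
      (pit₁ (<L (sym (cornerH p)) b) (<L (sym (cornerH p)) a) c d)

    -- The rung is itself an edge of a polygon, namely of `p ⊕ suc i`.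
    rung≢ : ∀ {p i} → 2 ≤ i → i < m → H p (suc i) ≢ H (nx p) i
    rung≢ {p} {i} 2≤i i<m e = edge {nx p ⊕ i} {suc m ∸ i} (m<n⇒0<n∸m (≤-trans i<m (n≤1+n m)))
        (s≤s (≤-trans (∸-monoʳ-≤ (suc m) 2≤i) (m∸n≤m m 1)))
      (trans (cong h (trans (cong (λ r → Pol r (suc m ∸ i)) (nx-⊕ p i)) (sym (swap (≤-trans 2≤i (n≤1+n i)) (lem i<m) (cong suc (trans (m+[n∸m]≡n (≤-trans (<⇒≤ i<m) (n≤1+n m))) refl))))))
        (trans e (cong h (swap 2≤i (s≤s (≤-trans (n≤1+n 1) (lem i<m))) (trans (+-suc i _) (cong suc (m+[n∸m]≡n (≤-trans (<⇒≤ i<m) (n≤1+n m)))))))))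
      where
      lem : ∀ {i m} → i < m → 2 ≤ suc m ∸ i
      lem {zero} (s≤s _) = s≤s (s≤s z≤n)
      lem {suc i} (s≤s a) = lem a

    -- Positions 2 to K of p face positions 1 to m of `nx p`. The edge in common joins the two
    -- corners containing p, p + 1 and p + 2; naming one corner of each polygon by both 1 and K
    -- makes these index ranges contiguous.
    wedge : ∀ p → Wedge m (λ i → H p (suc i)) (H (nx p))
    wedge p = record
      { first = cong h (shift p) ; last = cong h (shift′ p)
      ; closing = λ e → edge {p} {1} ≤-refl (s≤s 1≤m) (trans (cornerH p) (sym e))
      ; X-edge = λ a b → edge (s≤s z≤n) (s≤s b)
      ; Y-edge = λ a b → edge a (≤-trans b (n≤1+n m))
      ; rung = rung≢
      ; quad₁ = λ a b → quad₁ a (s≤s b) ; quad₂ = λ a b → quad₂ a (s≤s b)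
      ; X-peak = λ a b x y c d → peak (s≤s z≤n) (s≤s b) x y (s≤s z≤n) (s≤s d)
      ; Y-peak = λ a b x y c d → peak a (≤-trans b (n≤1+n m)) x y c (≤-trans d (n≤1+n m))
      ; X-pit = λ a b x y c d → pit (s≤s z≤n) (s≤s b) x y (s≤s z≤n) (s≤s d)
      ; Y-pit = λ a b x y c d → pit a (≤-trans b (n≤1+n m)) x y c (≤-trans d (n≤1+n m))
      ; X-peak₁ = λ x y c d → peak ≤-refl (s≤s 2≤m) (subst (_< H p 2) (sym (cornerH p)) y) x (s≤s z≤n) (s≤s d)
      ; Y-peak₁ = λ x y c d → peak₁ x y c (≤-trans d (n≤1+n m))
      ; X-pit₁ = λ x y c d → pit ≤-refl (s≤s 2≤m) (subst (H p 2 <_) (sym (cornerH p)) y) x (s≤s z≤n) (s≤s d)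
      ; Y-pit₁ = λ x y c d → pit₁ x y c (≤-trans d (n≤1+n m))
      ; X-peakₘ = λ { refl x y c d → peakₖ x y (s≤s z≤n) (s≤s d) }
      ; X-pitₘ = λ { refl x y c d → pitₖ x y (s≤s z≤n) (s≤s d) }
      ; Y-peakₘ = λ { {suc i} refl x y c d → peak (s≤s z≤n) ≤-refl x (<L (cornerH (nx p)) y) c (≤-trans d (n≤1+n m))
                    ; {zero} refl x y c d → ⊥-elim (<-irrefl refl y) }
      ; Y-pitₘ = λ { {suc i} refl x y c d → pit (s≤s z≤n) ≤-refl x (<R (cornerH (nx p)) y) c (≤-trans d (n≤1+n m))
                   ; {zero} refl x y c d → ⊥-elim (<-irrefl refl y) }
      }
      where
      1≤m = ≤-trans (s≤s z≤n) 3≤m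
      2≤m = ≤-trans (n≤1+n 2) 3≤m

    -- An outward and an inward side at the two ends of a move v → w.
    Disagree : (a v w b : ℕ) → Set
    Disagree a v w b = (a < v × w < b) ⊎ (v < a × b < w)

    Turn : (X Y : Poly) (v w : ℕ) → Set
    Turn X Y v w = Below Y v ⊎ (∀ {j} → 1 ≤ j → j ≤ K → w < H X j)

    module _ {p : Poly} {i : ℕ} (1≤i : 1 ≤ i) (i<m : suc i < m) where
      private
        eastward : ∀ {v w} → Event (wedge p) v w → Turn p (nx p) v w
        eastward (inj₁ f) = inj₁ λ a b → position′ a b {λ x → h x < _} f
        eastward (inj₂ f) = inj₂ λ a b → position a b {λ x → _ < h x} f

      module _ (r : H (nx p) (suc i) < H p (2 + i)) where
        turnE↑ : Disagree (H p (3 + i)) (H p (2 + i)) (H (nx p) (suc i)) (H (nx p) (2 + i)) →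
                 Turn p (nx p) (H p (2 + i)) (H (nx p) (suc i))
        turnE↑ (inj₁ (a , b)) = eastward (up-out (wedge p) 1≤i i<m r a b)
        turnE↑ (inj₂ (a , b)) = eastward (up-in (wedge p) 1≤i i<m r a b)

        turnE↓ : Disagree (H p (1 + i)) (H p (2 + i)) (H (nx p) (suc i)) (H (nx p) i) →
                 Turn p (nx p) (H p (2 + i)) (H (nx p) (suc i))
        turnE↓ (inj₁ (a , b)) = eastward (down-out (wedge p) 1≤i i<m r a b)
        turnE↓ (inj₂ (a , b)) = eastward (down-in (wedge p) 1≤i i<m r a b)

      module _ (r : H p (2 + i) < H (nx p) (suc i)) where

-- Reversal of the cyclic order.

module Flip where
  open Wedges
  open Landscapes
  open import Data.Nat.Solver using (module +-*-Solver)
  open +-*-Solver using (solve; con; _:+_; _:=_)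

  iter-comm : ∀ {A : Set} (f : A → A) i a → iter f i (f a) ≡ f (iter f i a)
  iter-comm f zero    a = refl
  iter-comm f (suc i) a = cong f (iter-comm f i a)

  iter-inverse : ∀ {A : Set} {f g : A → A} → (∀ a → g (f a) ≡ a) → ∀ i a → iter g i (iter f i a) ≡ a
  iter-inverse gf zero    a = refl
  iter-inverse {f = f} {g} gf (suc i) a = trans (sym (iter-comm g i _)) (trans (cong (iter g i) (gf _)) (iter-inverse gf i a))

  module _ {V : Set} {h : V → ℕ} {_⟶_ : V → V → Set} {m : ℕ} where
   module Flipped (L : Landscape h _⟶_ m) where
    open Landscape L

    ⊖-⊕ : ∀ p i {j} → i + j ≡ suc K → iter pv i p ≡ p ⊕ j
    ⊖-⊕ p i {j} e = trans (cong (iter pv i) (sym (⊕-back p {j} {i} (trans (+-comm j i) e)))) (iter-inverse {f = nx} {pv} pv-nx i (p ⊕ j))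

    -- The polygon i steps back is the one `suc K ∸ i` steps ahead, since there are `suc K`
    -- polygons.
    Pol′ : Poly → ℕ → V
    Pol′ p i = Pol p (suc K ∸ i)

    mirror : ∀ p i {j} → i + j ≡ suc K → Pol′ p i ≡ Pol p j
    mirror p i {j} e = cong (Pol p) (trans (cong (_∸ i) (sym e)) (m+n∸m≡n i j))

    mirrorH : ∀ p i {j} → i + j ≡ suc K → H p j ≡ h (Pol′ p i)
    mirrorH p i e = cong h (sym (mirror p i e))

    private
      split : ∀ {i} → i ≤ K → ∃[ d ] (i + d ≡ K)
      split a = m≤n⇒∃[o]m+o≡n a

      around : ∀ {i d} → suc i + d ≡ K → i + (2 + d) ≡ suc K × suc i + suc d ≡ suc K × 2 + i + d ≡ suc K
      around {i} {d} e = trans (+-suc i (suc d)) (cong suc (trans (+-suc i d) e)) , cong suc (trans (+-suc i d) e) , cong suc e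

      room : ∀ {i d} → suc i + d ≡ K → 1 ≤ i → suc d < K
      room {i} {d} e a = ≤R e (s≤s (+-monoˡ-≤ d a))

      range : ∀ {k d} → 1 ≤ k → k + d ≡ K → 1 ≤ suc d × suc d ≤ K × k + suc d ≡ suc K
      range {k} {d} a e = s≤s z≤n , ≤R e (+-monoˡ-≤ d a) , trans (+-suc k d) (cong suc e)

      nz : ∀ {i d} → suc i + d ≡ K → suc i < K → 1 ≤ d
      nz {i} {zero} e l = ⊥-elim (<-irrefl (trans (sym (+-identityʳ _)) e) l)
      nz {i} {suc d} e l = s≤s z≤n

    flip : Landscape h _⟶_ m
    flip = record
      { Poly = Poly ; nx = pv ; pv = nx ; nx-pv = pv-nx ; pv-nx = nx-pv ; 3≤m = 3≤m
      ; cycle = λ p → trans (cong (iter pv (suc K)) (sym (cycle p))) (iter-inverse {f = nx} {pv} pv-nx (suc K) p)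
      ; connected = conn
      ; Pol = Pol′
      ; corner = λ p → sym (trans (mirror p K (+-comm K 1)) (corner p))
      ; shift = λ p → trans (mirror p 2 {m} refl) (trans (cong (λ r → Pol r m) (sym (nx-pv p)))
                        (trans (sym (shift′ (pv p))) (sym (mirror (pv p) 1 {K} refl))))
      ; swap = λ {p} {i} {j} a b e → trans (mirror p i e) (trans (swap b a (trans (+-comm j i) e))
                 (trans (cong (λ r → Pol r i) (sym (⊖-⊕ p i e))) (sym (mirror (iter pv i p) j (trans (+-comm j i) e)))))
      ; edge = edge′ ; quad₁ = q₁ ; quad₂ = q₂ ; peak = pk ; pit = pt ; peak₁ = pk₁ ; pit₁ = pt₁
      ; any? = any? ; descends = descends ; up = up′ ; down = down′ ; ports = ports′ }
      where
      conn : ∀ p k → ∃[ e ] (e ≤ K × iter pv e p ≡ k)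
      conn p k with connected p k
      ... | zero , a , b = zero , z≤n , b
      ... | suc e , a , b with split a
      ... | d , x = suc d , ≤R x (s≤s (m≤n+m d e)) , trans (⊖-⊕ p (suc d) (cong suc (trans (+-comm d (suc e)) x))) b
      edge′ : ∀ {p i} → 1 ≤ i → i < K → h (Pol′ p i) ≢ h (Pol′ p (suc i))
      edge′ {p} {i} a b e with split b
      ... | d , x with around {i} {d} x
      ... | x₀ , x₁ , x₂ = edge (s≤s z≤n) (room x a)
            (trans (mirrorH p (suc i) x₁) (trans (sym e) (sym (mirrorH p i x₀))))
      up′ : ∀ {p i} → 1 ≤ i → i < K → h (Pol′ p (suc i)) < h (Pol′ p i) → Pol′ p i ⟶ Pol′ p (suc i)
      up′ {p} {i} a b l with split b
      ... | d , x with around {i} {d} x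
      ... | x₀ , x₁ , x₂ = subst₂ _⟶_ (sym (mirror p i x₀)) (sym (mirror p (suc i) x₁))
            (down (s≤s z≤n) (room x a) (subst₂ _<_ (sym (mirrorH p (suc i) x₁)) (sym (mirrorH p i x₀)) l))
      down′ : ∀ {p i} → 1 ≤ i → i < K → h (Pol′ p i) < h (Pol′ p (suc i)) → Pol′ p (suc i) ⟶ Pol′ p i
      down′ {p} {i} a b l with split b
      ... | d , x with around {i} {d} x
      ... | x₀ , x₁ , x₂ = subst₂ _⟶_ (sym (mirror p (suc i) x₁)) (sym (mirror p i x₀))
            (up (s≤s z≤n) (room x a) (subst₂ _<_ (sym (mirrorH p i x₀)) (sym (mirrorH p (suc i) x₁)) l))
      ports′ : ∀ {p i j w} → 1 ≤ i → 1 ≤ j → suc i + suc j ≡ suc K → Pol′ p (suc i) ⟶ w →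
               (w ≡ Pol′ p (2 + i) ⊎ w ≡ Pol′ p i) ⊎ (w ≡ Pol′ (iter pv (suc i) p) (2 + j) ⊎ w ≡ Pol′ (iter pv (suc i) p) j)
      ports′ {p} {i} {j} {w} a b e ar =
        [ [ (λ z → inj₁ (inj₂ (trans z (sym (mirror p i e₀))))) , (λ z → inj₁ (inj₁ (trans z (sym (mirror p (2 + i) e₂))))) ]′
        , [ (λ z → inj₂ (inj₂ (trans z f₀))) , (λ z → inj₂ (inj₁ (trans z f₂))) ]′ ]′
        (ports b a (trans (+-comm (suc j) (suc i)) e) (subst (_⟶ w) (mirror p (suc i) e) ar))
        where
        e₀ : i + (2 + j) ≡ suc K
        e₀ = trans (+-suc i (suc j)) e
        e₂ : 2 + i + j ≡ suc K
        e₂ = trans (cong suc (sym (+-suc i j))) e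
        base = sym (⊖-⊕ p (suc i) e)
        f₀ : Pol (p ⊕ suc j) (2 + i) ≡ Pol′ (iter pv (suc i) p) j
        f₀ = trans (cong (λ r → Pol r (2 + i)) base) (sym (mirror _ j (trans (+-comm j (2 + i)) e₂)))
        f₂ : Pol (p ⊕ suc j) i ≡ Pol′ (iter pv (suc i) p) (2 + j)
        f₂ = trans (cong (λ r → Pol r i) base) (sym (mirror _ (2 + j) (trans (+-comm (2 + j) i) e₀)))
      pk : ∀ {p i} → 1 ≤ i → suc i < K → h (Pol′ p i) < h (Pol′ p (suc i)) → h (Pol′ p (2 + i)) < h (Pol′ p (suc i)) →
              ∀ {k} → 1 ≤ k → k ≤ K → h (Pol′ p k) ≤ h (Pol′ p (suc i))
      pk {p} {i} a b y z {k} c l with split (<⇒≤ b) | split l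
      ... | d , x | d' , x' with around {i} {d} x | range c x'
      ... | x₀ , x₁ , x₂ | g₁ , g₂ , g₃ =
        subst₂ _≤_ (mirrorH p k g₃) (mirrorH p (suc i) x₁) (peak (nz x b) (room x a)
          (subst₂ _<_ (sym (mirrorH p (2 + i) x₂)) (sym (mirrorH p (suc i) x₁)) z) (subst₂ _<_ (sym (mirrorH p i x₀)) (sym (mirrorH p (suc i) x₁)) y) g₁ g₂)
      pt : ∀ {p i} → 1 ≤ i → suc i < K → h (Pol′ p (suc i)) < h (Pol′ p i) → h (Pol′ p (suc i)) < h (Pol′ p (2 + i)) →
              ∀ {k} → 1 ≤ k → k ≤ K → h (Pol′ p (suc i)) ≤ h (Pol′ p k)
      pt {p} {i} a b y z {k} c l with split (<⇒≤ b) | split l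
      ... | d , x | d' , x' with around {i} {d} x | range c x'
      ... | x₀ , x₁ , x₂ | g₁ , g₂ , g₃ =
        subst₂ _≤_ (mirrorH p (suc i) x₁) (mirrorH p k g₃) (pit (nz x b) (room x a)
          (subst₂ _<_ (sym (mirrorH p (suc i) x₁)) (sym (mirrorH p (2 + i) x₂)) z) (subst₂ _<_ (sym (mirrorH p (suc i) x₁)) (sym (mirrorH p i x₀)) y) g₁ g₂)
      pk₁ : ∀ {p} → h (Pol′ p 2) < h (Pol′ p 1) → h (Pol′ p m) < h (Pol′ p 1) →
            ∀ {k} → 1 ≤ k → k ≤ K → h (Pol′ p k) ≤ h (Pol′ p 1)
      pk₁ {p} y z {k} c l with split l
      ... | d' , x' with range c x'
      ... | g₁ , g₂ , g₃ = subst₂ _≤_ (mirrorH p k g₃) (mirrorH p 1 {K} refl) (peakₖ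
          (subst₂ _<_ (sym (mirrorH p 2 {m} refl)) (sym (mirrorH p 1 {K} refl)) y)
          (subst₂ _<_ (sym (mirrorH p m {2} (+-comm m 2))) (sym (mirrorH p 1 {K} refl)) z) g₁ g₂)
      pt₁ : ∀ {p} → h (Pol′ p 1) < h (Pol′ p 2) → h (Pol′ p 1) < h (Pol′ p m) →
            ∀ {k} → 1 ≤ k → k ≤ K → h (Pol′ p 1) ≤ h (Pol′ p k)
      pt₁ {p} y z {k} c l with split l
      ... | d' , x' with range c x'
      ... | g₁ , g₂ , g₃ = subst₂ _≤_ (mirrorH p 1 {K} refl) (mirrorH p k g₃) (pitₖ
          (subst₂ _<_ (sym (mirrorH p 1 {K} refl)) (sym (mirrorH p 2 {m} refl)) y)
          (subst₂ _<_ (sym (mirrorH p 1 {K} refl)) (sym (mirrorH p m {2} (+-comm m 2))) z) g₁ g₂)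
      module Quad {p : Poly} {i d : ℕ} (e : 3 + i + d ≡ K) where
        A : H p (3 + d) ≡ h (Pol′ p (1 + i))
        A = mirrorH p (1 + i) (trans (lem i d) (cong suc e))
          where
          lem : ∀ i d → 1 + i + (3 + d) ≡ 4 + i + d
          lem = solve 2 (λ i d → con 1 :+ i :+ (con 3 :+ d) := con 4 :+ i :+ d) refl
        B : H p (2 + d) ≡ h (Pol′ p (2 + i))
        B = mirrorH p (2 + i) (trans (lem i d) (cong suc e))
          where
          lem : ∀ i d → 2 + i + (2 + d) ≡ 4 + i + d
          lem = solve 2 (λ i d → con 2 :+ i :+ (con 2 :+ d) := con 4 :+ i :+ d) refl
        C : H (pv p) (4 + d) ≡ h (Pol′ (pv p) i)
        C = mirrorH (pv p) i (trans (lem i d) (cong suc e))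
          where
          lem : ∀ i d → i + (4 + d) ≡ 4 + i + d
          lem = solve 2 (λ i d → i :+ (con 4 :+ d) := con 4 :+ i :+ d) refl
        D : H (pv p) (3 + d) ≡ h (Pol′ (pv p) (1 + i))
        D = mirrorH (pv p) (1 + i) (trans (lem i d) (cong suc e))
          where
          lem : ∀ i d → 1 + i + (3 + d) ≡ 4 + i + d
          lem = solve 2 (λ i d → con 1 :+ i :+ (con 3 :+ d) := con 4 :+ i :+ d) refl
        nx′ : ∀ {k} → H (nx (pv p)) k ≡ H p k
        nx′ {k} = cong (λ r → H r k) (nx-pv p)
        lim : 2 ≤ i → 5 + d ≤ K
        lim a = ≤R e (s≤s (s≤s (s≤s (+-monoˡ-≤ d a))))
      -- the quadrilateral of p and pv p at position i is the one of pv p and p at position 2 + d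
      q₁ : ∀ {p i} → 2 ≤ i → 3 + i ≤ K → h (Pol′ p (2 + i)) < h (Pol′ p (1 + i)) →
           h (Pol′ p (2 + i)) < h (Pol′ (pv p) (1 + i)) →
           h (Pol′ (pv p) i) < h (Pol′ p (1 + i)) → h (Pol′ (pv p) i) < h (Pol′ (pv p) (1 + i)) → ⊥
      q₁ {p} {i} a b w x y z with split b
      ... | d , e = quad₁ {pv p} {2 + d} (s≤s (s≤s z≤n)) (lim a)
            (subst₂ _<_ (sym C) (sym D) z) (subst₂ _<_ (sym C) (sym (trans nx′ A)) y)
            (subst₂ _<_ (sym (trans nx′ B)) (sym D) x) (subst₂ _<_ (sym (trans nx′ B)) (sym (trans nx′ A)) w)
        where open Quad {p} {i} {d} e
      q₂ : ∀ {p i} → 2 ≤ i → 3 + i ≤ K → h (Pol′ p (1 + i)) < h (Pol′ p (2 + i)) →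
           h (Pol′ p (1 + i)) < h (Pol′ (pv p) i) →
           h (Pol′ (pv p) (1 + i)) < h (Pol′ p (2 + i)) → h (Pol′ (pv p) (1 + i)) < h (Pol′ (pv p) i) → ⊥
      q₂ {p} {i} a b w x y z with split b
      ... | d , e = quad₂ {pv p} {2 + d} (s≤s (s≤s z≤n)) (lim a)
            (subst₂ _<_ (sym D) (sym C) z) (subst₂ _<_ (sym D) (sym (trans nx′ B)) y)
            (subst₂ _<_ (sym (trans nx′ A)) (sym C) x) (subst₂ _<_ (sym (trans nx′ A)) (sym (trans nx′ B)) w)
        where open Quad {p} {i} {d} e

-- Compass directions at a vertex.

module Frames where
  open Wedges
  open Landscapes
  open Flip

  module _ {V : Set} {h : V → ℕ} {_⟶_ : V → V → Set} {m : ℕ} where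
   module Framed (L : Landscape h _⟶_ m) where
    open Landscape L

    -- The vertex v as the crossing of the polygons p and q = p ⊕ suc i.
    record Frame (v : V) : Set where
      constructor frame
      field
        p q : Poly
        i j : ℕ
        q≡  : q ≡ p ⊕ suc i
        1≤i : 1 ≤ i
        1≤j : 1 ≤ j
        sum : suc i + suc j ≡ suc K
        v≡  : v ≡ Pol p (suc i)
      north south east west : ℕ
      north = H p (2 + i)
      south = H p i
      east  = H q (2 + j)
      west  = H q j
      v≡′ : v ≡ Pol q (suc j)
      v≡′ = trans v≡ (trans (swap (s≤s 1≤i) (s≤s 1≤j) sum) (cong (λ r → Pol r (suc j)) (sym q≡)))
      i+j : i + j ≡ m
      i+j = suc-injective (suc-injective (trans (cong suc (sym (+-suc i j))) sum))
      i<m : i < m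
      i<m = ≤R i+j (≤L (+-comm i 1) (+-monoʳ-≤ i 1≤j))
      j<m : j < m
      j<m = ≤R i+j (+-monoˡ-≤ j 1≤i)
      si<K : suc i < K
      si<K = s≤s i<m
      sj<K : suc j < K
      sj<K = s≤s j<m
      hp : h v ≡ H p (suc i)
      hp = cong h v≡
      hq : h v ≡ H q (suc j)
      hq = cong h v≡′

    open Frame

    -- Exchanges north with east and south with west, whereas reversal exchanges north with south
    -- and east with west. Together they carry every direction to east.
    swapF : ∀ {v} → Frame v → Frame v
    swapF F = frame (q F) (p F) (j F) (i F)
      (sym (trans (cong (_⊕ suc (j F)) (q≡ F)) (⊕-back (p F) {suc (i F)} {suc (j F)} (sum F))))
      (1≤j F) (1≤i F) (trans (+-comm (suc (j F)) (suc (i F))) (sum F)) (v≡′ F)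

    eastF : ∀ {v} (F : Frame v) {i′} → i F ≡ suc i′ → 1 ≤ i′ → Frame (Pol (q F) (2 + j F))
    eastF F {i′} i≡ c = frame (nx (p F)) (q F) i′ (suc (j F)) q≡₁ c (s≤s z≤n) sum₁
        (sym (trans (swap (s≤s c) (s≤s (s≤s z≤n)) sum₁) (cong (λ r → Pol r (2 + j F)) (sym q≡₁))))
      where
      q≡₁ : q F ≡ nx (p F) ⊕ suc i′
      q≡₁ = trans (q≡ F) (trans (cong (λ k → p F ⊕ suc k) i≡) (sym (nx-⊕ (p F) (suc i′))))
      sum₁ : suc i′ + suc (suc (j F)) ≡ suc K
      sum₁ = trans (+-suc (suc i′) (suc (j F))) (trans (cong (λ k → suc k + suc (j F)) (sym i≡)) (sum F))

    -- With q two places ahead of p there is no room for p to advance alone: the edge along q leads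
    -- from {p, p + 1, p + 2, p + 3} to {p + 1, p + 2, p + 3, p + 4}, and both polygons advance.
    cornerF : ∀ {v} (F : Frame v) → i F ≡ 1 → Frame (Pol (q F) (2 + j F))
    cornerF F i≡ = frame (nx (p F)) (nx (q F)) 1 (j F)
        (cong nx (trans (q≡ F) (trans (cong (λ k → p F ⊕ suc k) i≡) (sym (nx-⊕ (p F) 1))))) ≤-refl (1≤j F)
        (trans (cong (λ k → suc k + suc (j F)) (sym i≡)) (sum F))
        (trans (cong (Pol (q F)) (trans (cong (λ k → suc k + j F) (sym i≡)) (cong suc (i+j F))))
         (trans (sym (corner (q F))) (trans (cong (λ r → Pol r 1) (trans (q≡ F) (cong (λ k → p F ⊕ suc k) i≡)))
          (sym (shift (nx (p F)))))))

    module EastPure {v} (F : Frame v) {i′} (i≡ : i F ≡ suc i′) (c : 1 ≤ i′) (e : east F < h v) where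
      private
        F₁ = eastF F i≡ c
        w = Pol (q F) (2 + j F)
        hp₀ : h v ≡ H (p F) (2 + i′)
        hp₀ = trans (hp F) (cong (λ k → H (p F) (suc k)) i≡)
        conv : ∀ {a b c d a′ b′ c′} → a ≡ a′ → b ≡ b′ → c ≡ c′ → Disagree a b c d → Disagree a′ b′ c′ d
        conv refl refl refl x = x
        si′<m : suc i′ < m
        si′<m = ≤L (cong suc i≡) (i<m F)

      west₁ : h w < west F₁
      west₁ = <R (hq F) e

      turn↓ : Disagree (south F) (h v) (h w) (south F₁) → Turn (p F) (nx (p F)) (h v) (h w)
      turn↓ d = subst₂ (Turn (p F) (nx (p F))) (sym hp₀) (sym (hp F₁))
        (turnE↓ c si′<m (subst₂ _<_ (hp F₁) hp₀ e) (conv (cong (H (p F)) i≡) hp₀ (hp F₁) d))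

      turn↑ : Disagree (north F) (h v) (h w) (north F₁) → Turn (p F) (nx (p F)) (h v) (h w)
      turn↑ d = subst₂ (Turn (p F) (nx (p F))) (sym hp₀) (sym (hp F₁))
        (turnE↑ c si′<m (subst₂ _<_ (hp F₁) hp₀ e) (conv (cong (λ k → H (p F) (2 + k)) i≡) hp₀ (hp F₁) d))

    frameAt : ∀ p {k} → 2 ≤ k → k < K → Frame (Pol p k)
    frameAt p {suc (suc k)} (s≤s (s≤s a)) b = frame p (p ⊕ (2 + k)) (suc k) (K ∸ suc (suc k)) refl (s≤s z≤n)
      (m<n⇒0<n∸m b) (trans (+-suc (2 + k) _) (cong suc (m+[n∸m]≡n (<⇒≤ b)))) refl

    -- The corner of p is not a crossing of p with another polygon of the required distance; it is
    -- framed on the next polygon instead.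
    atVertex : ∀ p {k} → 1 ≤ k → k ≤ K → Frame (Pol p k)
    atVertex p {k} a b = position a b {Frame} go
      where
      go : ∀ {l} → 1 ≤ l → l ≤ m → Frame (Pol p (suc l))
      go {l} c d with l ≟ m
      ... | yes refl = subst Frame (sym (shift′ p)) (frameAt (nx p) (≤-trans (n≤1+n 2) 3≤m) ≤-refl)
      ... | no ne = frameAt p (s≤s c) (s≤s (≤∧≢⇒< d ne))

    module _ where
      open Flipped L

      aboveF : ∀ {p t} → Above p t → Landscape.Above flip p t
      aboveF {p} {t} f {j} a b = f (m<n⇒0<n∸m (s≤s b)) (∸-monoʳ-≤ (suc K) a)

      unmirror : ∀ {p} {R : ℕ → Set} → (∀ {j} → 1 ≤ j → j ≤ K → R (Landscape.H flip p j)) →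
                 ∀ {j} → 1 ≤ j → j ≤ K → R (H p j)
      unmirror {p} {R} f {j} a b = subst R (cong h (mirror p (suc K ∸ j) (m∸n+n≡m (≤-trans b (n≤1+n K)))))
                                 (f {suc K ∸ j} (m<n⇒0<n∸m (s≤s b)) (∸-monoʳ-≤ (suc K) a))

    Crossing : Poly → Poly → Set
    Crossing x y = ∃[ a ] ∃[ b ] (1 ≤ a × a ≤ K × 1 ≤ b × b ≤ K × Pol x a ≡ Pol y b)

    -- Neighbouring polygons share an edge and all others cross properly; K steps ahead is the
    -- neighbour behind.
    crossing : ∀ x y → Crossing x y
    crossing x y with connected x y
    ... | zero , a , refl = 1 , 1 , s≤s z≤n , s≤s z≤n , s≤s z≤n , s≤s z≤n , refl
    ... | suc zero , a , refl = 2 , 1 , s≤s z≤n , s≤s (≤-trans (s≤s z≤n) 3≤m) , s≤s z≤n , s≤s z≤n , shift x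
    ... | suc (suc e) , a , refl with suc (suc e) ≟ K
    ...   | yes z = 1 , 2 , s≤s z≤n , s≤s z≤n , s≤s z≤n , s≤s (≤-trans (s≤s z≤n) 3≤m) ,
                    trans (cong (λ r → Pol r 1) (sym (nx-pv x))) (trans (sym (shift (pv x)))
                      (cong (λ r → Pol r 2) (sym (trans (cong (x ⊕_) z) (pv-⊕K x)))))
    ...   | no z = suc (suc e) , suc K ∸ suc (suc e) , s≤s z≤n , a , m<n⇒0<n∸m {suc (suc e)} {suc K} (s≤s a) , ∸-monoʳ-≤ {m = 1} {n = suc (suc e)} (suc K) (s≤s z≤n) ,
                    swap (s≤s (s≤s z≤n)) (lem (≤∧≢⇒< a z)) (m+[n∸m]≡n (≤-trans a (n≤1+n K)))
      where
      lem : suc (suc e) < K → 2 ≤ suc K ∸ suc (suc e)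
      lem x = ≤-trans (≤-reflexive (sym (trans (cong (_∸ suc (suc e)) (+-comm 2 (suc (suc e)))) (m+n∸m≡n (suc (suc e)) 2)))) (∸-monoˡ-≤ {m = 2 + suc (suc e)} {n = suc K} (suc (suc e)) (s≤s x))

    -- Two polygons meet, so one cannot lie above and the other below the same height.
    above-below : ∀ {x y t} → Above x t → Below y t → ⊥
    above-below {x} {y} f g with crossing x y
    ... | a , b , a₁ , a₂ , b₁ , b₂ , e = <-irrefl refl (≤-<-trans (f a₁ a₂) (<L (cong h (sym e)) (g b₁ b₂)))

-- The potential for phase 3.

module Potential where
  open import Data.Nat.Solver using (module +-*-Solver)
  open +-*-Solver using (solve; con; _:+_; _:*_; _:=_)

  δ : ℕ → ℕ → ℕ
  δ a b with a ≟ b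
  ... | yes _ = 1
  ... | no  _ = 0

  δ≤1 : ∀ a b → δ a b ≤ 1
  δ≤1 a b with a ≟ b
  ... | yes _ = ≤-refl
  ... | no  _ = z≤n

  δ≡ : ∀ a → δ a a ≡ 1
  δ≡ a with a ≟ a
  ... | yes _ = refl
  ... | no  n = ⊥-elim (n refl)

  δ≢ : ∀ {a b} → a ≢ b → δ a b ≡ 0
  δ≢ {a} {b} n with a ≟ b
  ... | yes e = ⊥-elim (n e)
  ... | no  _ = refl

  -- b and c are the distances to the two sides of the box behind the current vertex, a and d
  -- those to the sides ahead.  Up to the last term this is 6 (a + b + c + d) − 5 min (b , c);
  -- the last term makes the potential strictly superharmonic on the diagonal b = c.
  abstract
    φ : (b c a d : ℕ) → ℕ
    φ b c a d = 6 * (a + d) + (b + c) + 5 * (b ⊔ c) + δ b c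

    private
      by : ∀ {x y} k → y ≡ x + k → x ≤ y
      by k refl = m≤m+n _ k

      above : ∀ {x y} → x ≤ y → ∃[ k ] x + k ≡ y
      above le = m≤n⇒∃[o]m+o≡n le

    φ-comm : ∀ b c a d → φ b c a d ≡ φ c b d a
    φ-comm b c a d rewrite ⊔-comm b c | +-comm b c | +-comm a d = cong (6 * (d + a) + (c + b) + 5 * (c ⊔ b) +_) (lem b c)
      where
      lem : ∀ b c → δ b c ≡ δ c b
      lem b c with b ≟ c
      ... | yes refl = sym (δ≡ b)
      ... | no n = sym (δ≢ (λ e → n (sym e)))

    -- The side ahead yields 6, the growth of b costs 1, and `δ` may cost 1 when b reaches c; 4
    -- remain.
    φ-below : ∀ {b c} a d → b < c → φ (suc b) c a d + 4 ≤ φ b c (suc a) d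
    φ-below {b} {c} a d l rewrite m≤n⇒m⊔n≡n l | m≤n⇒m⊔n≡n (<⇒≤ l) | δ≢ (<⇒≢ l) with above (δ≤1 (suc b) c)
    ... | k , e = by k (lem a d b c (δ (suc b) c) k e)
      where
      s : ∀ a d b c x k → 6 * (a + d) + (suc b + c) + 5 * c + x + 4 + k ≡ 6 * (a + d) + (suc b + c) + 5 * c + 4 + (x + k)
      s = solve 6 (λ a d b c x k → con 6 :* ( a :+ d ) :+ ( (con 1 :+ b) :+ c ) :+ con 5 :* c :+ x :+ con 4 :+ k := con 6 :* ( a :+ d ) :+ ( (con 1 :+ b) :+ c ) :+ con 5 :* c :+ con 4 :+ ( x :+ k )) refl
      r : ∀ a d b c → 6 * (suc a + d) + (b + c) + 5 * c + 0 ≡ 6 * (a + d) + (suc b + c) + 5 * c + 4 + 1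
      r = solve 4 (λ a d b c → con 6 :* ( (con 1 :+ a) :+ d ) :+ ( b :+ c ) :+ con 5 :* c :+ con 0 := con 6 :* ( a :+ d ) :+ ( (con 1 :+ b) :+ c ) :+ con 5 :* c :+ con 4 :+ con 1) refl
      lem : ∀ a d b c x k → x + k ≡ 1 → 6 * (suc a + d) + (b + c) + 5 * c + 0 ≡ 6 * (a + d) + (suc b + c) + 5 * c + x + 4 + k
      lem a d b c x k e = trans (r a d b c) (sym (trans (s a d b c x k) (cong (6 * (a + d) + (suc b + c) + 5 * c + 4 +_) e)))

    -- Now the maximum grows as well and 6 - 1 - 5 = 0. The whole gain is the `δ` lost on leaving
    -- the diagonal.
    φ-diag : ∀ b a d → φ (suc b) b a d + 1 ≤ φ b b (suc a) d
    φ-diag b a d rewrite m≥n⇒m⊔n≡m (n≤1+n b) | ⊔-idem b | δ≡ b | δ≢ (λ e → 1+n≢n {b} e) = by 0 (lem a d b)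
      where
      lem : ∀ a d b → 6 * (suc a + d) + (b + b) + 5 * b + 1 ≡ 6 * (a + d) + (suc b + b) + 5 * suc b + 0 + 1 + 0
      lem = solve 3 (λ a d b → con 6 :* ( (con 1 :+ a) :+ d ) :+ ( b :+ b ) :+ con 5 :* b :+ con 1 := con 6 :* ( a :+ d ) :+ ( (con 1 :+ b) :+ b ) :+ con 5 :* (con 1 :+ b) :+ con 0 :+ con 1 :+ con 0) refl

    φ-above : ∀ {b c} a d → c < b → φ (suc b) c a d ≤ φ b c (suc a) d
    φ-above {b} {c} a d l rewrite m≥n⇒m⊔n≡m (≤-trans (<⇒≤ l) (n≤1+n b)) | m≥n⇒m⊔n≡m (<⇒≤ l)
      | δ≢ (>⇒≢ l) | δ≢ (>⇒≢ (≤-trans l (n≤1+n b))) = by 0 (lem a d b c)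
      where
      lem : ∀ a d b c → 6 * (suc a + d) + (b + c) + 5 * b + 0 ≡ 6 * (a + d) + (suc b + c) + 5 * suc b + 0 + 0
      lem = solve 4 (λ a d b c → con 6 :* ( (con 1 :+ a) :+ d ) :+ ( b :+ c ) :+ con 5 :* b :+ con 0 := con 6 :* ( a :+ d ) :+ ( (con 1 :+ b) :+ c ) :+ con 5 :* (con 1 :+ b) :+ con 0 :+ con 0) refl

    φ-step : ∀ b c a d → φ (suc b) c a d ≤ φ b c (suc a) d
    φ-step b c a d with <-cmp b c
    ... | tri< l _ _ = ≤-trans (m≤m+n _ 4) (φ-below a d l)
    ... | tri≈ _ refl _ = ≤-trans (m≤m+n _ 1) (φ-diag b a d)
    ... | tri> _ _ l = φ-above a d l

    private
      lower : ∀ b c a d → 6 * (a + d) + b + 6 * c ≤ φ b c a d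
      lower b c a d with above (m≤n⊔m b c)
      ... | k , e rewrite sym e = by (5 * k + δ b c) (lem b c a d k (δ b c))
        where
        lem : ∀ b c a d k x → 6 * (a + d) + (b + c) + 5 * (c + k) + x ≡ 6 * (a + d) + b + 6 * c + (5 * k + x)
        lem = solve 6 (λ b c a d k x → con 6 :* ( a :+ d ) :+ ( b :+ c ) :+ con 5 :* ( c :+ k ) :+ x := con 6 :* ( a :+ d ) :+ b :+ con 6 :* c :+ ( con 5 :* k :+ x )) refl
      lower′ : ∀ b c a d → 6 * (a + d) + c + 6 * b ≤ φ b c a d
      lower′ b c a d with above (m≤m⊔n b c)
      ... | k , e rewrite sym e = by (5 * k + δ b c) (lem b c a d k (δ b c))
        where
        lem : ∀ b c a d k x → 6 * (a + d) + (b + c) + 5 * (b + k) + x ≡ 6 * (a + d) + c + 6 * b + (5 * k + x)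
        lem = solve 6 (λ b c a d k x → con 6 :* ( a :+ d ) :+ ( b :+ c ) :+ con 5 :* ( b :+ k ) :+ x := con 6 :* ( a :+ d ) :+ c :+ con 6 :* b :+ ( con 5 :* k :+ x )) refl
      upper₀ : ∀ c a d → φ 0 c a d ≤ 6 * (a + d) + 6 * c + 1
      upper₀ c a d with above (δ≤1 0 c)
      ... | k , e = by k (trans (lem′ c a d) (trans (cong (6 * (a + d) + 6 * c +_) (sym e)) (lem c a d k (δ 0 c))))
        where
        lem′ : ∀ c a d → 6 * (a + d) + 6 * c + 1 ≡ 6 * (a + d) + 6 * c + 1
        lem′ c a d = refl
        lem : ∀ c a d k x → 6 * (a + d) + 6 * c + (x + k) ≡ 6 * (a + d) + (0 + c) + 5 * c + x + k
        lem = solve 5 (λ c a d k x → con 6 :* ( a :+ d ) :+ con 6 :* c :+ ( x :+ k ) := con 6 :* ( a :+ d ) :+ ( con 0 :+ c ) :+ con 5 :* c :+ x :+ k) refl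
      chain : ∀ {x y z w} → x ≤ y → y + 4 ≤ z → z ≤ w → x + 4 ≤ w
      chain p q r = ≤-trans (+-monoˡ-≤ 4 p) (≤-trans q r)

    -- For a step after which the polygon just left lies above the walk: it becomes the side behind,
    -- at distance 0.
    φ-dead : ∀ b c a d → φ 0 c a d + 4 ≤ φ b c (suc a) d
    φ-dead b c a d = chain (upper₀ c a d) (by (b + 1) (lem b c a d)) (lower b c (suc a) d)
      where
      lem : ∀ b c a d → 6 * (suc a + d) + b + 6 * c ≡ 6 * (a + d) + 6 * c + 1 + 4 + (b + 1)
      lem = solve 4 (λ b c a d → con 6 :* ( (con 1 :+ a) :+ d ) :+ b :+ con 6 :* c := con 6 :* ( a :+ d ) :+ con 6 :* c :+ con 1 :+ con 4 :+ ( b :+ con 1 )) refl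

    -- For a step at which the other polygon reverses its direction, so that its sides behind and
    -- ahead trade places.
    φ-turn : ∀ b c a d → φ 0 d a c + 4 ≤ φ b c (suc a) d
    φ-turn b c a d = chain (upper₀ d a c) (by (b + 1) (lem b c a d)) (lower b c (suc a) d)
      where
      lem : ∀ b c a d → 6 * (suc a + d) + b + 6 * c ≡ 6 * (a + c) + 6 * d + 1 + 4 + (b + 1)
      lem = solve 4 (λ b c a d → con 6 :* ( (con 1 :+ a) :+ d ) :+ b :+ con 6 :* c := con 6 :* ( a :+ c ) :+ con 6 :* d :+ con 1 :+ con 4 :+ ( b :+ con 1 )) refl

    φ-corner : ∀ b c a d → φ (suc b) (suc c) a d + 4 ≤ φ b c (suc a) (suc d)
    φ-corner b c a d = by 1 (trans (cong (6 * (suc a + suc d) + (b + c) + 5 * (b ⊔ c) +_) (lemδ b c)) (lem b c a d (b ⊔ c) (δ (suc b) (suc c))))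
      where
      lemδ : ∀ b c → δ b c ≡ δ (suc b) (suc c)
      lemδ b c with b ≟ c
      ... | yes refl = sym (δ≡ (suc b))
      ... | no n = sym (δ≢ (λ e → n (suc-injective e)))
      lem : ∀ b c a d x y → 6 * (suc a + suc d) + (b + c) + 5 * x + y ≡ 6 * (a + d) + (suc b + suc c) + 5 * (suc x) + y + 4 + 1
      lem = solve 6 (λ b c a d x y → con 6 :* ( (con 1 :+ a) :+ (con 1 :+ d) ) :+ ( b :+ c ) :+ con 5 :* x :+ y := con 6 :* ( a :+ d ) :+ ( (con 1 :+ b) :+ (con 1 :+ c) ) :+ con 5 :* ( (con 1 :+ x) ) :+ y :+ con 4 :+ con 1) refl

    φ-corner-sink : ∀ b c a d → φ 0 0 (suc b) d + 4 ≤ φ b c (suc a) (suc d)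
    φ-corner-sink b c a d = chain (upper₀ 0 (suc b) d) (by (6 * a + c + 1) (lem b c a d)) (lower′ b c (suc a) (suc d))
      where
      lem : ∀ b c a d → 6 * (suc a + suc d) + c + 6 * b ≡ 6 * (suc b + d) + 6 * 0 + 1 + 4 + (6 * a + c + 1)
      lem = solve 4 (λ b c a d → con 6 :* ( (con 1 :+ a) :+ (con 1 :+ d) ) :+ c :+ con 6 :* b := con 6 :* ( (con 1 :+ b) :+ d ) :+ con 6 :* con 0 :+ con 1 :+ con 4 :+ ( con 6 :* a :+ c :+ con 1 )) refl

    φ-corner-turn : ∀ b c a d → φ 0 (suc d) a c + 4 ≤ φ b (suc c) (suc a) d
    φ-corner-turn b c a d = chain (upper₀ (suc d) a c) (by (b + 1) (lem b c a d)) (lower b (suc c) (suc a) d)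
      where
      lem : ∀ b c a d → 6 * (suc a + d) + b + 6 * suc c ≡ 6 * (a + c) + 6 * (suc d) + 1 + 4 + (b + 1)
      lem = solve 4 (λ b c a d → con 6 :* ( (con 1 :+ a) :+ d ) :+ b :+ con 6 :* (con 1 :+ c) := con 6 :* ( a :+ c ) :+ con 6 :* ( (con 1 :+ d) ) :+ con 1 :+ con 4 :+ ( b :+ con 1 )) refl

    φ-corner-turn-sink : ∀ b c a d → φ 0 0 0 c + 4 ≤ φ b (suc c) (suc a) d
    φ-corner-turn-sink b c a d = chain (upper₀ 0 0 c) (by (6 * a + 6 * d + b + 7) (lem b c a d)) (lower b (suc c) (suc a) d)
      where
      lem : ∀ b c a d → 6 * (suc a + d) + b + 6 * suc c ≡ 6 * (0 + c) + 6 * 0 + 1 + 4 + (6 * a + 6 * d + b + 7)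
      lem = solve 4 (λ b c a d → con 6 :* ( (con 1 :+ a) :+ d ) :+ b :+ con 6 :* (con 1 :+ c) := con 6 :* ( con 0 :+ c ) :+ con 6 :* con 0 :+ con 1 :+ con 4 :+ ( con 6 :* a :+ con 6 :* d :+ b :+ con 7 )) refl

    φ-bound : ∀ b c a d {M} → b + a ≤ M → c + d ≤ M → φ b c a d ≤ 12 * M + 1
    φ-bound b c a d {M} p q with above (m≤m⊔n b c) | above (δ≤1 b c) | above p | above q
    ... | _ | _ , e | x , ex | y , ey = ≤-trans (+-mono-≤ (+-monoʳ-≤ (6 * (a + d) + (b + c)) (*-monoʳ-≤ 5 (m⊔n≤m+n b c))) (δ≤1 b c))
        (subst (λ z → 6 * (a + d) + (b + c) + 5 * (b + c) + 1 ≤ z) (cong (_+ 1) (lem M)) (by (6 * (x + y)) (trans (cong₂ (λ u v → 6 * u + 6 * v + 1) (sym ex) (sym ey)) (lem′ a b c d x y))))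
      where
      lem : ∀ M → 6 * M + 6 * M ≡ 12 * M
      lem = solve 1 (λ M → con 6 :* M :+ con 6 :* M := con 12 :* M) refl
      lem′ : ∀ a b c d x y → 6 * (b + a + x) + 6 * (c + d + y) + 1 ≡ 6 * (a + d) + (b + c) + 5 * (b + c) + 1 + 6 * (x + y)
      lem′ = solve 6 (λ a b c d x y → con 6 :* ( b :+ a :+ x ) :+ con 6 :* ( c :+ d :+ y ) :+ con 1 := con 6 :* ( a :+ d ) :+ ( b :+ c ) :+ con 5 :* ( b :+ c ) :+ con 1 :+ con 6 :* ( x :+ y )) refl

-- Phase 3: descent inside a shrinking box.

module Phase3 where
  open Wedges
  open Landscapes
  open Flip
  open Frames
  open Potential

  -- An abstract family of upper bounds B k v a for the expected number of steps
  -- from v truncated after k steps.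
  record Bounds {V : Set} (_⟶_ : V → V → Set) : Set₁ where
    field
      B    : ℕ → V → ℕ → Set
      base : ∀ {v a} → B 0 v a
      mono : ∀ {k v a b} → a ≤ b → B k v a → B k v b
      all  : ∀ {k v a} → (∀ w → v ⟶ w → B k w a) → B (suc k) v (suc a)
      one  : ∀ {k v a} {x₁ x₂ x₃ x₄ : V} →
             (∀ w → v ⟶ w → (w ≡ x₁ ⊎ w ≡ x₂) ⊎ (w ≡ x₃ ⊎ w ≡ x₄)) →
             (∀ w → v ⟶ w → B k w (4 + a)) → ∀ {w₀} → v ⟶ w₀ → B k w₀ a → B (suc k) v (4 + a)

  module _ {V : Set} {h : V → ℕ} {_⟶_ : V → V → Set} {m : ℕ} where

   module Ports (L : Landscape h _⟶_ m) {v : V} (F : Framed.Frame L v) where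
    open Landscape L
    open Framed L
    open Frame F
    open Flipped L

    toE : east < h v → v ⟶ Pol q (2 + j)
    toE l = subst (_⟶ _) (sym v≡′) (up (s≤s z≤n) sj<K (<R hq l))
    toN : north < h v → v ⟶ Pol p (2 + i)
    toN l = subst (_⟶ _) (sym v≡) (up (s≤s z≤n) si<K (<R hp l))

    ways : ∀ w → v ⟶ w → (w ≡ Pol p (2 + i) ⊎ w ≡ Pol p i) ⊎ (w ≡ Pol q (2 + j) ⊎ w ≡ Pol q j)
    ways w a = subst (λ r → (w ≡ Pol p (2 + i) ⊎ w ≡ Pol p i) ⊎ (w ≡ Pol r (2 + j) ⊎ w ≡ Pol r j)) (sym q≡)
                 (ports 1≤i 1≤j sum (subst (_⟶ w) v≡ a))

    e≢ : east ≢ h v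
    e≢ e = edge (s≤s z≤n) sj<K (sym (trans e hq))
    w≢ : west ≢ h v
    w≢ e = edge 1≤j (≤-trans (n≤1+n _) sj<K) (trans e hq)
    n≢ : north ≢ h v
    n≢ e = edge (s≤s z≤n) si<K (sym (trans e hp))
    s≢ : south ≢ h v
    s≢ e = edge 1≤i (≤-trans (n≤1+n _) si<K) (trans e hp)

    flipF : Framed.Frame flip v
    flipF = record
      { p = p ; q = q ; i = j ; j = i
      ; q≡ = trans q≡ (sym (⊖-⊕ p (suc j) (trans (+-comm (suc j) (suc i)) sum)))
      ; 1≤i = 1≤j ; 1≤j = 1≤i ; sum = trans (+-comm (suc j) (suc i)) sum
      ; v≡ = trans v≡ (sym (mirror p (suc j) (trans (+-comm (suc j) (suc i)) sum))) }

    private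
      ij : j + (2 + i) ≡ suc K
      ij = trans (+-suc j (suc i)) (trans (cong suc (+-comm j (suc i))) (trans (sym (+-suc (suc i) j)) sum))
      ji : i + (2 + j) ≡ suc K
      ji = trans (+-suc i (suc j)) sum

    flip-north : Framed.Frame.north flipF ≡ south
    flip-north = sym (mirrorH p (2 + j) (trans (+-comm (2 + j) i) ji))
    flip-south : Framed.Frame.south flipF ≡ north
    flip-south = sym (mirrorH p j ij)
    flip-east : Framed.Frame.east flipF ≡ west
    flip-east = sym (mirrorH q (2 + i) (trans (+-comm (2 + i) j) ij))
    flip-west : Framed.Frame.west flipF ≡ east
    flip-west = sym (mirrorH q i ji)

   module Corner (L : Landscape h _⟶_ m) {v : V} (F : Framed.Frame L v)
                (i≡ : Framed.Frame.i F ≡ 1) (e : Framed.Frame.east F < h v) where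
    open Landscape L
    open Framed L
    open Frame F

    w₁ : V
    w₁ = Pol q (2 + j)
    F₁ : Frame w₁
    F₁ = cornerF F i≡
    j≡ : suc j ≡ m
    j≡ = trans (cong (_+ j) (sym i≡)) i+j
    v-corner : h v ≡ H (nx p) 1
    v-corner = trans hp (trans (cong (λ k → H p (suc k)) i≡) (cong h (shift p)))
    south-corner : south ≡ H (nx p) m
    south-corner = trans (cong (H p) i≡) (trans (cornerH p) (cong h (shift′ p)))
    south₁ : h w₁ < Frame.south F₁
    south₁ = <R v-corner e
    w-corner : h w₁ ≡ H q 1
    w-corner = trans (cong (H q) (cong suc j≡)) (sym (cornerH q))
    q≡nx : q ≡ nx (nx p)
    q≡nx = trans q≡ (cong (λ k → p ⊕ suc k) i≡)
    east-corner : Frame.east F₁ ≡ H q 2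
    east-corner = trans (cong (H (nx q)) (cong suc j≡)) (trans (sym (cornerH (nx q))) (cong h (sym (shift q))))
    sink : h w₁ < Frame.east F₁ → Above q (h w₁)
    sink l a b = ≤L (sym w-corner) (pit₁ (subst₂ _<_ w-corner east-corner l)
        (subst₂ _<_ w-corner (trans hq (cong (H q) j≡)) e) a b)

   -- No polygon containing v has v as its source.
   Sourceless : Landscape h _⟶_ m → ℕ → Set
   Sourceless L t = ∀ y → (∀ {j} → 1 ≤ j → j ≤ Landscape.K L → Landscape.H L y j ≤ t) → ⊥

   sourceless-flip : ∀ L {t} → Sourceless L t → Sourceless (Flipped.flip L) t
   sourceless-flip L f y g = f y (Framed.unmirror L {R = _≤ _} g)

   -- The polygons just outside the box [p − W , p + E] × [q − S , q + N] lie above the height t.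
   record Box (L : Landscape h _⟶_ m) (p q : Landscape.Poly L) (t W E S N : ℕ) : Set where
    open Landscape L
    field
      deadW : ∃[ r ] (r ⊕ suc W ≡ p × Above r t)
      deadE : ∃[ r ] (p ⊕ suc E ≡ r × Above r t)
      deadS : ∃[ r ] (r ⊕ suc S ≡ q × Above r t)
      deadN : ∃[ r ] (q ⊕ suc N ≡ r × Above r t)

   -- Names give the directions in which the walk may leave. Exchange and reversal carry south-west
   -- to north-east and north-west to south-east, so two constructors cover all pairs of adjacent
   -- directions.
   data State (v : V) : ℕ → Set₁ where
    NE : (L : Landscape h _⟶_ m) (F : Framed.Frame L v) → let open Framed.Frame F in
         Sourceless L (h v) → h v < west → h v < south →
         ∀ {W E S N} → Box L p q (h v) W E S N → State v (φ W S E N)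
    SE : (L : Landscape h _⟶_ m) (F : Framed.Frame L v) → let open Framed.Frame F in
         Sourceless L (h v) → h v < west → h v < north →
         ∀ {W E S N} → Box L p q (h v) W E S N → State v (φ W N E S)

   -- The state after a step to w from a vertex of height t and bound T with distances b and c to
   -- the sides behind, where u is the height of the other neighbour ahead: the bound drops by 4
   -- unless the step goes away from the nearer side.
   record Outcome (w : V) (T b c t u : ℕ) : Set₁ where
    constructor outcome
    field
     {Φ}    : ℕ
     state  : State w Φ
     weak   : Φ ≤ T
     nearer : b < c → Φ + 4 ≤ T
     ended  : t < u → Φ + 4 ≤ T
     level  : b ≡ c → Φ + 1 ≤ T

   module East (L : Landscape h _⟶_ m) {v : V} (F : Framed.Frame L v) where
    open Landscape L
    open Framed L
    open Frame F
    open Ports L F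

    w₁ : V
    w₁ = Pol q (2 + j)

    onE : ∃[ k ] (1 ≤ k × k ≤ K × w₁ ≡ Pol (nx p) k)
    onE with i ≟ 1
    ... | yes x = 2 , s≤s z≤n , s≤s (≤-trans (s≤s z≤n) 3≤m) , Frame.v≡ (cornerF F x)
    ... | no x = go 1≤i x refl
      where
      go : ∀ {k} → 1 ≤ k → k ≢ 1 → i ≡ k → ∃[ k ] (1 ≤ k × k ≤ K × w₁ ≡ Pol (nx p) k)
      go {suc zero} a b c = ⊥-elim (b refl)
      go {suc (suc k)} a b c = suc (suc k) , s≤s z≤n , <⇒≤ (Frame.si<K (eastF F c (s≤s z≤n))) , Frame.v≡ (eastF F c (s≤s z≤n))

    module _ (born : Sourceless L (h v)) (e : east < h v) where
     private
      lower : ∀ {r} → Above r (h v) → Above r (h w₁)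
      lower f a b = ≤-trans (<⇒≤ e) (f a b)

      born₁ : Sourceless L (h w₁)
      born₁ y f = born y λ a b → ≤-trans (f a b) (<⇒≤ e)

      strict : ∀ {r} → (∀ {k} → 1 ≤ k → k ≤ K → h w₁ < H r k) → Above r (h w₁)
      strict f a b = <⇒≤ (f a b)

      pit-p : h v < north → h v < south → Above p (h w₁)
      pit-p n s {k} a b = ≤-trans (<⇒≤ e) (≤L (sym hp) (pit 1≤i si<K (<L hp s) (<L hp n) a b))

      -- If w₁ had both polygon edges outgoing it would be a source.
      inward : ∀ {w} (G : Frame w) → h w ≤ h w₁ → Frame.south G < h w → Frame.north G < h w → ⊥
      inward G le s n = born₁ (Frame.p G) λ a b →
        ≤-trans (peak (Frame.1≤i G) (Frame.si<K G) (<R (Frame.hp G) s) (<R (Frame.hp G) n) a b) (≤L (Frame.hp G) le)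

      inward′ : ∀ {w} (G : Frame w) → h w ≤ h w₁ → Frame.west G < h w → Frame.east G < h w → ⊥
      inward′ G le s n = inward (swapF G) le s n

     module _ {W E S N : ℕ} (box : Box L p q (h v) W (suc E) S N) where
      open Box box

      aheadE : ∃[ r ] (nx p ⊕ suc E ≡ r × Above r (h w₁))
      aheadE = let r , a , b = deadE in r , trans (nx-⊕ p (suc E)) a , lower b
      behindW : ∃[ r ] (r ⊕ suc (suc W) ≡ nx p × Above r (h w₁))
      behindW = let r , a , b = deadW in r , cong nx a , lower b
      sameS : ∃[ r ] (r ⊕ suc S ≡ q × Above r (h w₁))
      sameS = let r , a , b = deadS in r , a , lower b
      sameN : ∃[ r ] (q ⊕ suc N ≡ r × Above r (h w₁))
      sameN = let r , a , b = deadN in r , a , lower b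
      behindS : ∃[ r ] (r ⊕ suc (suc S) ≡ nx q × Above r (h w₁))
      behindS = let r , a , b = deadS in r , cong nx a , lower b
      adjacent : ∀ {r} → Above r (h w₁) → ∃[ s ] (s ⊕ 1 ≡ nx r × Above s (h w₁))
      adjacent {r} d = r , refl , d

      pureBox : Box L (nx p) q (h w₁) (suc W) E S N
      pureBox = record { deadW = behindW ; deadE = aheadE ; deadS = sameS ; deadN = sameN }
      deadBox : Above p (h w₁) → Box L (nx p) q (h w₁) 0 E S N
      deadBox d = record { deadW = adjacent d ; deadE = aheadE ; deadS = sameS ; deadN = sameN }

      module _ (wi : h v < west) (si : h v < south) where
       -- If the south edge stays incoming, so does the state. Otherwise the wedge event applies;
       -- `nx p` cannot lie below v because a side of the box lies above, hence p lies above the new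
       -- vertex, becomes the western side, and the walk turns south.
       pureNE : ∀ {i′} → i ≡ suc i′ → 1 ≤ i′ →
                (∃[ b ] (b + 4 ≤ φ W S (suc E) N × State w₁ b)) ⊎ (h v < north → ⊥) × State w₁ (φ (suc W) S E N)
       pureNE i≡ c = go (≢⇒<⊎> (λ x → Ports.s≢ L F₁ (sym x)))
         where
         F₁ = eastF F i≡ c
         open EastPure F i≡ c e
         turned : Above p (h w₁) → Frame.south F₁ < h w₁ → ∃[ b ] (b + 4 ≤ φ W S (suc E) N × State w₁ b)
         turned d s with ≢⇒<⊎> (λ x → Ports.n≢ L F₁ (sym x))
         ... | inj₂ n = ⊥-elim (inward F₁ ≤-refl s n)
         ... | inj₁ n = φ 0 N E S , φ-turn W S E N , SE L F₁ born₁ west₁ n (deadBox d)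
         go : h w₁ < Frame.south F₁ ⊎ Frame.south F₁ < h w₁ → _
         go (inj₁ s) with ≢⇒<⊎> (λ x → n≢ (sym x))
         ... | inj₁ n = inj₁ (φ 0 S E N , φ-dead W S E N , NE L F₁ born₁ west₁ s (deadBox (pit-p n si)))
         ... | inj₂ n = inj₂ ((λ l → <-asym l n) , NE L F₁ born₁ west₁ s pureBox)
         go (inj₂ s) with turn↓ (inj₂ (si , s))
         ... | inj₁ below = ⊥-elim (above-below (proj₂ (proj₂ deadW)) below)
         ... | inj₂ dead = inj₁ (turned (strict dead) s)

      module _ (wi : h v < west) (ni : h v < north) where
       pureSE : ∀ {i′} → i ≡ suc i′ → 1 ≤ i′ →
                (∃[ b ] (b + 4 ≤ φ W N (suc E) S × State w₁ b)) ⊎ (h v < south → ⊥) × State w₁ (φ (suc W) N E S)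
       pureSE i≡ c = go (≢⇒<⊎> (λ x → Ports.n≢ L F₁ (sym x)))
         where
         F₁ = eastF F i≡ c
         open EastPure F i≡ c e
         turned : Above p (h w₁) → Frame.north F₁ < h w₁ → ∃[ b ] (b + 4 ≤ φ W N (suc E) S × State w₁ b)
         turned d n with ≢⇒<⊎> (λ x → Ports.s≢ L F₁ (sym x))
         ... | inj₂ s = ⊥-elim (inward F₁ ≤-refl s n)
         ... | inj₁ s = φ 0 S E N , φ-turn W N E S , NE L F₁ born₁ west₁ s (deadBox d)
         go : h w₁ < Frame.north F₁ ⊎ Frame.north F₁ < h w₁ → _
         go (inj₁ n) with ≢⇒<⊎> (λ x → s≢ (sym x))
         ... | inj₁ s = inj₁ (φ 0 N E S , φ-dead W N E S , SE L F₁ born₁ west₁ n (deadBox (pit-p ni s)))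
         ... | inj₂ s = inj₂ ((λ l → <-asym l s) , SE L F₁ born₁ west₁ n pureBox)
         go (inj₂ n) with turn↑ (inj₂ (ni , n))
         ... | inj₁ below = ⊥-elim (above-below (proj₂ (proj₂ deadW)) below)
         ... | inj₂ dead = inj₁ (turned (strict dead) n)

      module _ (i≡ : i ≡ 1) {N′} (N≡ : N ≡ suc N′) where
       private
        open Corner L F i≡ e hiding (w₁)
        aheadN : ∃[ r ] (nx q ⊕ suc N′ ≡ r × Above r (h w₁))
        aheadN = let r , a , b = deadN in r , trans (nx-⊕ q (suc N′)) (trans (cong (λ k → q ⊕ suc k) (sym N≡)) a) , lower b
        east₁ : Frame.west F₁ < h w₁ → h w₁ < Frame.east F₁
        east₁ w with ≢⇒<⊎> (λ x → Ports.e≢ L F₁ (sym x))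
        ... | inj₁ l = l
        ... | inj₂ l = ⊥-elim (inward′ F₁ ≤-refl w l)
        module _ where
         open Flipped L
         back : ∀ {r s} k → r ⊕ k ≡ s → iter pv k s ≡ r
         back {r} k refl = iter-inverse {f = nx} {pv} pv-nx k r
         flipBox : ∀ W′ → ∃[ r ] (r ⊕ suc W′ ≡ nx p × Above r (h w₁)) → Above q (h w₁) →
                   Box flip (nx p) (nx q) (h w₁) 0 W′ N′ 0
         flipBox W′ (r , x , d) s = record
           { deadW = q , trans (cong pv q≡nx) (pv-nx (nx p)) , aboveF {q} s
           ; deadE = r , back (suc W′) x , aboveF {r} d
           ; deadS = (let t , y , f = aheadN in t , back (suc N′) y , aboveF {t} f)
           ; deadN = q , pv-nx q , aboveF {q} s }
         north-west : ∀ W′ → ∃[ r ] (r ⊕ suc W′ ≡ nx p × Above r (h w₁)) → Frame.west F₁ < h w₁ →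
                      State w₁ (φ 0 0 W′ N′)
         north-west W′ b w = SE flip P₁.flipF (sourceless-flip L born₁) (<R (sym P₁.flip-west) (east₁ w))
                            (<R (sym P₁.flip-north) south₁) {0} {W′} {N′} {0} (flipBox W′ b (sink (east₁ w)))
           where module P₁ = Ports L F₁

       -- If west is outgoing at the new vertex, east must be incoming, as the vertex is no source.
       -- It is then the sink of q, which becomes both the eastern and the southern side, and the
       -- walk goes on north-west in the reversed landscape.
       cornerNE : ∃[ b ] (b + 4 ≤ φ W S (suc E) N × State w₁ b)
       cornerNE rewrite N≡ with ≢⇒<⊎> (λ x → Ports.w≢ L F₁ (sym x))
       ... | inj₁ w = _ , φ-corner W S E N′ , NE L F₁ born₁ w south₁ {suc W} {E} {suc S} {N′} (record
             { deadW = behindW ; deadE = aheadE ; deadS = behindS ; deadN = aheadN })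
       ... | inj₂ w = _ , φ-corner-sink W S E N′ , north-west (suc W) behindW w

       cornerSE : h v < north → ∃[ b ] (b + 4 ≤ φ W N (suc E) S × State w₁ b)
       cornerSE ni rewrite N≡ with ≢⇒<⊎> (λ x → s≢ (sym x))
       -- The east and south edges at v are the two edges of `nx p` there, so v would be the source
       -- of `nx p`.
       ... | inj₂ s = ⊥-elim (born (nx p) λ a b → ≤R (sym v-corner) (peak₁ (subst₂ _<_ (Frame.hp F₁) v-corner e)
               (subst₂ _<_ south-corner v-corner s) a b))
       ... | inj₁ s with ≢⇒<⊎> (λ x → Ports.w≢ L F₁ (sym x))
       ...   | inj₁ w = _ , φ-corner-turn W N′ E S , NE L F₁ born₁ w south₁ {0} {E} {suc S} {N′} (record
               { deadW = adjacent (pit-p ni s) ; deadE = aheadE ; deadS = behindS ; deadN = aheadN })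
       ...   | inj₂ w = _ , φ-corner-turn-sink W N′ E S , north-west 0 (adjacent (pit-p ni s)) w

    module _ (born : Sourceless L (h v)) (e : east < h v) where
     private
      drop4 : ∀ {b c a d t u} → (∃[ x ] (x + 4 ≤ φ b c a d × State w₁ x)) → Outcome w₁ (φ b c a d) b c t u
      drop4 {b} {c} {a} {d} (x , le , s) = outcome s (≤-trans (m≤m+n x 4) le) (λ _ → le) (λ _ → le)
        (λ _ → ≤-trans (+-monoʳ-≤ x (s≤s z≤n)) le)
      drop0 : ∀ {b c a d t u} → (t < u → ⊥) × State w₁ (φ (suc b) c a d) → Outcome w₁ (φ b c (suc a) d) b c t u
      drop0 {b} {c} {a} {d} (x , s) = outcome s (φ-step b c a d) (φ-below a d) (λ l → ⊥-elim (x l)) λ { refl → φ-diag b a d }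
      off : ∀ {r} → Above r (h v) → ∀ {k} → 1 ≤ k → k ≤ K → w₁ ≡ Pol r k → ⊥
      off d a b c = <-irrefl refl (<-≤-trans e (≤-trans (d a b) (≤-reflexive (cong h (sym c)))))
      -- The step lands on `nx p` below the height of v, so `nx p` is not a side of the box.
      notE : ∀ {E} → ∃[ r ] (p ⊕ suc E ≡ r × Above r (h v)) → ∃[ E′ ] E ≡ suc E′
      notE {zero} (r , refl , d) = let k , x , y , z = onE in ⊥-elim (off d x y z)
      notE {suc E} _ = E , refl
      notN : ∀ {N} → i ≡ 1 → ∃[ r ] (q ⊕ suc N ≡ r × Above r (h v)) → ∃[ N′ ] N ≡ suc N′
      notN {zero} i≡ (r , refl , d) = ⊥-elim (off d (s≤s z≤n) (<⇒≤ (Frame.sj<K (cornerF F i≡))) (Frame.v≡′ (cornerF F i≡)))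
      notN {suc N} _ _ = N , refl
      small : ∀ {A : Set₁} → (i ≡ 1 → A) → (∀ {i′} → i ≡ suc i′ → 1 ≤ i′ → A) → A
      small f g = go 1≤i refl
        where
        go : ∀ {k} → 1 ≤ k → i ≡ k → _
        go {suc zero} _ x = f x
        go {suc (suc k)} _ x = g x (s≤s z≤n)

     eastNE : ∀ {W E S N} → Box L p q (h v) W E S N → h v < west → h v < south → Outcome w₁ (φ W S E N) W S (h v) north
     eastNE {W} {E} {S} {N} box wi si with notE {E} (Box.deadE box)
     ... | E′ , refl = small
         (λ i≡ → let N′ , N≡ = notN i≡ (Box.deadN box) in drop4 (cornerNE born e box i≡ N≡))
         (λ i≡ c → [ drop4 , drop0 ]′ (pureNE born e box wi si i≡ c))

     eastSE : ∀ {W E S N} → Box L p q (h v) W E S N → h v < west → h v < north → Outcome w₁ (φ W N E S) W N (h v) south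
     eastSE {W} {E} {S} {N} box wi ni with notE {E} (Box.deadE box)
     ... | E′ , refl = small
         (λ i≡ → let N′ , N≡ = notN i≡ (Box.deadN box) in drop4 (cornerSE born e box i≡ N≡ ni))
         (λ i≡ c → [ drop4 , drop0 ]′ (pureSE born e box wi ni i≡ c))

   module Descent (bounds : Bounds _⟶_) where
    open Bounds bounds

    module _ {k v T b c} (IH : ∀ {w x} → State w x → B k w (suc x))
             {x₁ x₂ x₃ x₄ : V} (cover : ∀ w → v ⟶ w → (w ≡ x₁ ⊎ w ≡ x₂) ⊎ (w ≡ x₃ ⊎ w ≡ x₄))
             {w₁ w₂ : V} {u₁ u₂ : ℕ} (≢₁ : u₁ ≢ h v) (≢₂ : u₂ ≢ h v)
             (to₁ : u₁ < h v → v ⟶ w₁) (to₂ : u₂ < h v → v ⟶ w₂)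
             (outs : ∀ w → v ⟶ w → (w ≡ w₁ × u₁ < h v) ⊎ (w ≡ w₂ × u₂ < h v))
             (o₁ : u₁ < h v → Outcome w₁ T b c (h v) u₂) (o₂ : u₂ < h v → Outcome w₂ T c b (h v) u₁) where
     open Outcome
     private
      every : (∀ l → Φ (o₁ l) + 1 ≤ T) → (∀ l → Φ (o₂ l) + 1 ≤ T) → B (suc k) v (suc T)
      every f g = all λ w a → [ (λ { (refl , l) → mono (≤L (+-comm (Φ (o₁ l)) 1) (f l)) (IH (state (o₁ l))) })
                              , (λ { (refl , l) → mono (≤L (+-comm (Φ (o₂ l)) 1) (g l)) (IH (state (o₂ l))) }) ]′ (outs w a)
      1≤4 : ∀ {x} → x + 4 ≤ T → x + 1 ≤ T
      1≤4 {x} le = ≤-trans (+-monoʳ-≤ x (s≤s z≤n)) le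
      some : ∀ {w x} → v ⟶ w → State w x → x + 4 ≤ T → B (suc k) v (suc T)
      some {x = x} a s l with m≤n⇒∃[o]m+o≡n l
      ... | o , e = subst (B (suc k) v) (sym eq) (one cover (λ w z → subst (B k w) eq (others w z)) a (mono (m≤m+n (suc x) o) (IH s)))
        where
        eq : suc T ≡ 4 + (suc x + o)
        eq = cong suc (trans (sym e) (cong (_+ o) (+-comm x 4)))
        others : ∀ w → v ⟶ w → B k w (suc T)
        others w z = [ (λ { (refl , l) → mono (s≤s (weak (o₁ l))) (IH (state (o₁ l))) })
                     , (λ { (refl , l) → mono (s≤s (weak (o₂ l))) (IH (state (o₂ l))) }) ]′ (outs w z)

     -- At equal distances behind, every arc gains 1. Otherwise the arc away from the nearer side
     -- gains 4 if it is outgoing; if it is incoming, v is the sink of a polygon, and the only other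
     -- possible arc gains 4.
     conclude : B (suc k) v (suc T)
     conclude with <-cmp b c
     ... | tri≈ _ e _ = every (λ l → level (o₁ l) e) (λ l → level (o₂ l) (sym e))
     ... | tri< l _ _ with ≢⇒<⊎> ≢₁
     ...   | inj₁ x = some (to₁ x) (state (o₁ x)) (nearer (o₁ x) l)
     ...   | inj₂ x = every (λ y → ⊥-elim (<-asym x y)) (λ y → 1≤4 (ended (o₂ y) x))
     conclude | tri> _ _ l with ≢⇒<⊎> ≢₂
     ...   | inj₁ x = some (to₂ x) (state (o₂ x)) (nearer (o₂ x) l)
     ...   | inj₂ x = every (λ y → 1≤4 (ended (o₁ y) x)) (λ y → ⊥-elim (<-asym x y))

    -- The extra unit covers a vertex of potential 0, since `all` always charges one step.
    phase3 : ∀ k {v a} → State v a → B k v (suc a)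
    phase3 zero s = base
    phase3 (suc k) {v} (NE L F born wi si {W} {E} {S} {N} box) = conclude (phase3 k) ways e≢ n≢ toE toN outs
        (λ e → eastNE born e {W} {E} {S} {N} box wi si)
        (λ n → subst (λ T → Outcome (Pol p (2 + i)) T S W (h v) (Framed.Frame.east F)) (φ-comm S W N E)
                 (East.eastNE L (swapF F) born n {S} {N} {W} {E} (record { deadW = deadS ; deadE = deadN ; deadS = deadW ; deadN = deadE }) si wi))
      where
      open Landscape L
      open Framed L
      open Frame F
      open Ports L F
      open East L F
      open Box box
      outs : ∀ w → v ⟶ w → (w ≡ Pol q (2 + j) × east < h v) ⊎ (w ≡ Pol p (2 + i) × north < h v)
      outs w a with ways w a
      ... | inj₁ (inj₁ refl) = inj₂ (refl , descends a)
      ... | inj₁ (inj₂ refl) = ⊥-elim (<-asym si (descends a))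
      ... | inj₂ (inj₁ refl) = inj₁ (refl , descends a)
      ... | inj₂ (inj₂ refl) = ⊥-elim (<-asym wi (descends a))
    phase3 (suc k) {v} (SE L F born wi ni {W} {E} {S} {N} box) = conclude (phase3 k) ways e≢ s≢ toE toS outs
        (λ e → eastSE born e {W} {E} {S} {N} box wi ni)
        southward
      where
      open Landscape L
      open Framed L
      open Frame F
      open Ports L F
      open East L F
      open Box box
      open Flipped L
      module S = Ports L (swapF F)
      G : Framed.Frame flip v
      G = S.flipF
      toS : south < h v → v ⟶ Pol p i
      toS l = subst (_⟶ _) (sym v≡) (down 1≤i (≤-trans (n≤1+n _) si<K) (<R hp l))
      outs : ∀ w → v ⟶ w → (w ≡ Pol q (2 + j) × east < h v) ⊎ (w ≡ Pol p i × south < h v)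
      outs w a with ways w a
      ... | inj₁ (inj₁ refl) = ⊥-elim (<-asym ni (descends a))
      ... | inj₁ (inj₂ refl) = inj₂ (refl , descends a)
      ... | inj₂ (inj₁ refl) = inj₁ (refl , descends a)
      ... | inj₂ (inj₂ refl) = ⊥-elim (<-asym wi (descends a))
      away : ∀ {r s} e → r ⊕ e ≡ s → iter pv e s ≡ r
      away {r} e refl = iter-inverse {f = nx} {pv} pv-nx e r
      box′ : Box flip q p (h v) N S E W
      box′ = record
        { deadW = (let r , x , d = deadN in r , away (suc N) x , aboveF {r} d)
        ; deadE = (let r , x , d = deadS in r , away (suc S) x , aboveF {r} d)
        ; deadS = (let r , x , d = deadE in r , away (suc E) x , aboveF {r} d)
        ; deadN = (let r , x , d = deadW in r , away (suc W) x , aboveF {r} d) }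
      -- Exchanging the polygons turns south into west, and reversal turns west into east.
      southward : south < h v → Outcome (Pol p i) (φ W N E S) N W (h v) east
      southward l = subst₂ (λ w T → Outcome w T N W (h v) east) w≡ (φ-comm N W S E)
          (subst (Outcome _ _ N W (h v)) S.flip-south
            (East.eastSE flip G (sourceless-flip L born) (<L (sym S.flip-east) l) {N} {S} {E} {W} box′
               (<R (sym S.flip-west) ni) (<R (sym S.flip-north) wi)))
        where
        w≡ : Pol′ p (2 + j) ≡ Pol p i
        w≡ = mirror p (2 + j) (trans (cong suc (sym (+-suc j i))) (trans (cong suc (+-comm j (suc i))) (trans (sym (+-suc (suc i) j)) sum)))

-- Entering phase 3.

module Enter where
  open import Relation.Unary using (Decidable)
  open Wedges
  open Landscapes
  open Flip
  open Frames
  open Potential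
  open Phase3

  positions? : ∀ {P : ℕ → Set} → Decidable P → ∀ K → Dec (∀ {j} → 1 ≤ j → j ≤ K → P j)
  positions? {P} P? K = map′ (λ f {j} a b → lower a b (λ {i} → f {i})) (λ f {j} l → f (s≤s z≤n) l) (allUpTo? (λ j → P? (suc j)) K)
    where
    lower : ∀ {j} → 1 ≤ j → j ≤ K → (∀ {i} → i < K → P (suc i)) → P j
    lower {suc j} a b f = f b

  module _ {V : Set} {h : V → ℕ} {_⟶_ : V → V → Set} {m : ℕ} where

   module Local (L : Landscape h _⟶_ m) where
    open Landscape L
    open Framed L
    open Flipped L

    above? : ∀ t → Dec (∃ λ y → Above y t)
    above? t = any? (λ y → Above y t) (λ y → positions? (λ j → t ≤? H y j) K)

    successor : ∀ {v w} → Frame v → v ⟶ w → Frame w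
    successor F a with Ports.ways L F _ a
    ... | inj₁ (inj₁ refl) = atVertex (Frame.p F) (s≤s z≤n) (Frame.si<K F)
    ... | inj₁ (inj₂ refl) = atVertex (Frame.p F) (Frame.1≤i F) (≤-trans (n≤1+n _) (<⇒≤ (Frame.si<K F)))
    ... | inj₂ (inj₁ refl) = atVertex (Frame.q F) (s≤s z≤n) (Frame.sj<K F)
    ... | inj₂ (inj₂ refl) = atVertex (Frame.q F) (Frame.1≤j F) (≤-trans (n≤1+n _) (<⇒≤ (Frame.sj<K F)))

    sourceless : ∀ {y v w} → Above y (h v) → h w < h v → Sourceless L (h w)
    sourceless d l y f = above-below d λ a b → ≤-<-trans (f a b) l

    no-peak : ∀ {v} (F : Frame v) → Sourceless L (h v) → Frame.south F < h v → Frame.north F < h v → ⊥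
    no-peak F born s n = born (Frame.p F) λ a b → ≤R (sym (Frame.hp F))
      (peak (Frame.1≤i F) (Frame.si<K F) (<R (Frame.hp F) s) (<R (Frame.hp F) n) a b)

    below-pit : ∀ {v} (F : Frame v) → h v < Frame.south F → h v < Frame.north F → Above (Frame.p F) (h v)
    below-pit F s n a b = ≤L (sym (Frame.hp F))
      (pit (Frame.1≤i F) (Frame.si<K F) (<L (Frame.hp F) s) (<L (Frame.hp F) n) a b)

    -- The box of all polygons other than y.
    sides : ∀ {y t v} (F : Frame v) → Above y t → h v < t → ∀ r {k} → 1 ≤ k → k ≤ K → v ≡ Pol r k →
            ∃[ a ] ∃[ b ] (a + b ≤ m × (∃[ s ] (s ⊕ suc a ≡ r × Above s (h v))) × (∃[ s ] (r ⊕ suc b ≡ s × Above s (h v))))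
    sides {y} {t} {v} F d l r {k} k₁ k₂ v≡ with connected r y
    ... | zero , _ , refl = ⊥-elim (<-irrefl refl (<-≤-trans l (≤R (cong h (sym v≡)) (d k₁ k₂))))
    ... | suc e , le , eq = m ∸ e , e , ≤-reflexive (m∸n+n≡m (≤-pred le)) ,
          (y , trans (cong (_⊕ suc (m ∸ e)) (sym eq)) (⊕-back r {suc e} {suc (m ∸ e)} (cong suc (trans (+-suc e (m ∸ e)) (cong suc (m+[n∸m]≡n (≤-pred le)))))) , d′) ,
          (y , eq , d′)
      where
      d′ : Above y (h v)
      d′ a b = ≤-trans (<⇒≤ l) (d a b)

    box : ∀ {y t v} (F : Frame v) → Above y t → h v < t →
          ∃[ W ] ∃[ E ] ∃[ S ] ∃[ N ] (W + E ≤ m × S + N ≤ m × Box L (Frame.p F) (Frame.q F) (h v) W E S N)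
    box F d l with sides F d l (Frame.p F) (s≤s z≤n) (<⇒≤ (Frame.si<K F)) (Frame.v≡ F)
                 | sides F d l (Frame.q F) (s≤s z≤n) (<⇒≤ (Frame.sj<K F)) (Frame.v≡′ F)
    ... | W , E , le , w , e | S , N , le′ , s , n = W , E , S , N , le , le′ , record { deadW = w ; deadE = e ; deadS = s ; deadN = n }

    bound₃ : ℕ
    bound₃ = 12 * m + 1

    enterW : ∀ {y t v} (F : Frame v) → Above y t → h v < t → Sourceless L (h v) → h v < Frame.west F →
             ∃[ a ] (a ≤ bound₃ × State {h = h} {_⟶_} v a)
    enterW F d l born wi with box F d l | ≢⇒<⊎> (λ x → Ports.s≢ L F (sym x))
    ... | W , E , S , N , x , y , b | inj₁ si = _ , φ-bound W S E N x y , NE L F born wi si {W} {E} {S} {N} b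
    ... | W , E , S , N , x , y , b | inj₂ so with ≢⇒<⊎> (λ x → Ports.n≢ L F (sym x))
    ...   | inj₁ ni = _ , φ-bound W N E S x (≤L (+-comm S N) y) , SE L F born wi ni {W} {E} {S} {N} b
    ...   | inj₂ nout = ⊥-elim (no-peak F born so nout)

   module _ (L : Landscape h _⟶_ m) where
    open Landscape L
    open Framed L
    open Local L
    open Flipped L

    -- One of the west and east edges is incoming, since otherwise v would be a source; by reversal
    -- it may be taken to be the west one.
    enter : ∀ {y t v} (F : Frame v) → Above y t → h v < t → Sourceless L (h v) →
            ∃[ a ] (a ≤ bound₃ × State {h = h} {_⟶_} v a)
    enter {y} F d l born with ≢⇒<⊎> (λ x → Ports.w≢ L F (sym x))
    ... | inj₁ wi = enterW F d l born wi
    ... | inj₂ wo with ≢⇒<⊎> (λ x → Ports.e≢ L F (sym x))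
    ...   | inj₁ ei = Local.enterW flip (Ports.flipF L F) (aboveF {y} d) l (sourceless-flip L born) (<R (sym (Ports.flip-west L F)) ei)
    ...   | inj₂ eo = ⊥-elim (no-peak (swapF F) born wo eo)

    module _ (bounds : Bounds _⟶_) where
     open Bounds bounds

     -- One step is spent first: `Sourceless` and the box follow from y only at heights strictly
     -- below that at which y lies above.
     above-bound : ∀ k {y v} → Frame v → Above y (h v) → B k v (2 + suc bound₃)
     above-bound zero F d = base
     above-bound (suc k) {y} F d = mono (s≤s (n≤1+n _)) (all λ w a →
       let l = descends a
           x , le , s = enter (successor F a) d l (sourceless {y} d l)
       in mono (s≤s le) (Descent.phase3 bounds k s))

-- Phase 2: steady directions, and polygons moving towards each other.

module Phase2 where
  open Wedges
  open Landscapes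
  open Flip
  open Frames
  open Potential
  open Phase3
  open Enter

  small : ∀ {ℓ} {A : Set ℓ} {i} → 1 ≤ i → (i ≡ 1 → A) → (∀ {i′} → i ≡ suc i′ → 1 ≤ i′ → A) → A
  small {i = suc zero} _ f g = f refl
  small {i = suc (suc k)} _ f g = g refl (s≤s z≤n)

  module _ {V : Set} {h : V → ℕ} {_⟶_ : V → V → Set} {m : ℕ} where

   Sinkless : Landscape h _⟶_ m → ℕ → Set
   Sinkless L t = ∀ y → Landscape.Above L y t → ⊥

   sinkless-flip : ∀ L {t} → Sinkless L t → Sinkless (Flipped.flip L) t
   sinkless-flip L f y g = f y (Framed.unmirror L {R = _ ≤_} g)

   -- While no polygon is above or below the walk, directions do not change.
   module Steady (L : Landscape h _⟶_ m) {v : V} (F : Framed.Frame L v) where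
    open Landscape L
    open Framed L
    open Frame F
    open Ports L F
    open Local L
    open Flipped L
    private
     w₁ = Pol q (2 + j)

    module _ (born : Sourceless L (h v)) (sl : Sinkless L (h v)) (e : east < h v) (sl₁ : Sinkless L (h w₁)) where
     born₁ : Sourceless L (h w₁)
     born₁ y f = born y λ a b → ≤-trans (f a b) (<⇒≤ e)

     no-turn : Turn p (nx p) (h v) (h w₁) → ⊥
     no-turn (inj₁ below) = born (nx p) λ a b → <⇒≤ (below a b)
     no-turn (inj₂ above) = sl₁ p λ a b → <⇒≤ (above a b)

     module _ {i′} (i≡ : i ≡ suc i′) (c : 1 ≤ i′) where
      private
       F₁ = eastF F i≡ c
       module P₁ = Ports L F₁
      open EastPure F i≡ c e

      south-in : h v < south → h w₁ < Frame.south F₁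
      south-in l with ≢⇒<⊎> (λ x → P₁.s≢ (sym x))
      ... | inj₁ x = x
      ... | inj₂ x = ⊥-elim (no-turn (turn↓ (inj₂ (l , x))))
      north-in : h v < north → h w₁ < Frame.north F₁
      north-in l with ≢⇒<⊎> (λ x → P₁.n≢ (sym x))
      ... | inj₁ x = x
      ... | inj₂ x = ⊥-elim (no-turn (turn↑ (inj₂ (l , x))))

     -- v would be the source of the polygon nx p
     module _ (i≡ : i ≡ 1) where
      open Corner L F i≡ e using (F₁; v-corner; south-corner; sink; south₁)
      corner-in : h v < south
      corner-in with ≢⇒<⊎> (λ x → s≢ (sym x))
      ... | inj₁ x = x
      ... | inj₂ x = ⊥-elim (born (nx p) λ a b → ≤R (sym v-corner)
              (peak₁ (subst₂ _<_ (Frame.hp F₁) v-corner e) (subst₂ _<_ south-corner v-corner x) a b))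
      west-in : h w₁ < Frame.west F₁
      west-in with ≢⇒<⊎> (λ x → Ports.w≢ L F₁ (sym x)) | ≢⇒<⊎> (λ x → Ports.e≢ L F₁ (sym x))
      ... | inj₁ x | _ = x
      ... | inj₂ x | inj₁ y = ⊥-elim (sl₁ q (sink y))
      ... | inj₂ x | inj₂ y = ⊥-elim (no-peak (swapF F₁) born₁ x y)

   -- The walk can leave only to the east or south. Either step shortens the gap from p to q, so its
   -- length bounds the number of steps in this state.
   data Narrowing (v : V) (x : ℕ) : Set₁ where
    narrowing : (L : Landscape h _⟶_ m) (F : Framed.Frame L v) → let open Framed.Frame F in
                Sourceless L (h v) → Sinkless L (h v) → h v < west → h v < north → i ≡ x → Narrowing v x

   -- At the shortest gap an east step forces the south edge to be incoming; with north incoming as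
   -- well, v would be the sink of p.
   narrow-east : ∀ (L : Landscape h _⟶_ m) {v} (F : Framed.Frame L v) → let open Framed.Frame F in
                 Sourceless L (h v) → Sinkless L (h v) → h v < west → h v < north →
                 east < h v → Sinkless L (h (Landscape.Pol L q (2 + j))) → ∃[ x ] (i ≡ suc x × Narrowing (Landscape.Pol L q (2 + j)) x)
   narrow-east L F born sl wi ni e sl₁ = small (Framed.Frame.1≤i F)
     (λ i≡ → ⊥-elim (sl _ (below-pit F (Steady.corner-in L F born sl e sl₁ i≡) ni)))
     (λ {i′} i≡ c → i′ , i≡ , narrowing L (eastF F i≡ c) (Steady.born₁ L F born sl e sl₁) sl₁
          (EastPure.west₁ F i≡ c e) (Steady.north-in L F born sl e sl₁ i≡ c ni) refl)
     where
     open Local L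
     open Framed L

   module Quiet (bounds : Bounds _⟶_) where
    open Bounds bounds

    -- The bound is that of phase 3, which applies as soon as some polygon lies above the new
    -- vertex.
    ended : ∀ (L : Landscape h _⟶_ m) k {v w} → Framed.Frame L v → v ⟶ w →
            B k w (4 + 12 * m) ⊎ Sinkless L (h w)
    ended L k {w = w} F a with Local.above? L (h w)
    ... | yes (y , d) = inj₁ (mono (≤-reflexive (cong (3 +_) (+-comm (12 * m) 1)))
                         (above-bound L bounds k (Local.successor L F a) (λ {j} → d {j})))
    ... | no n = inj₂ λ y d → n (y , λ {j} → d {j})

    narrow : ∀ k {v x} → Narrowing v x → B k v (suc x + (4 + 12 * m))
    narrow zero n = base
    narrow (suc k) {v} {x} (narrowing L F born sl wi ni refl) = all go
      where
      open Landscape L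
      open Framed L
      open Frame F
      open Ports L F
      open Flipped L
      module S = Ports L (swapF F)
      C = 4 + 12 * m
      next : ∀ {w} → (∃[ y ] (i ≡ suc y × Narrowing w y)) → B k w (i + C)
      next (y , e , n) = subst (λ z → B k _ (z + C)) (sym e) (narrow k n)
      w≡ : Pol′ p (2 + j) ≡ Pol p i
      w≡ = mirror p (2 + j) (trans (cong suc (sym (+-suc j i))) (trans (cong suc (+-comm j (suc i))) (trans (sym (+-suc (suc i) j)) sum)))
      go : ∀ w → v ⟶ w → B k w (i + C)
      go w a with ended L k F a
      ... | inj₁ b = mono (m≤n+m C i) b
      ... | inj₂ sl₁ with ways w a
      ...   | inj₁ (inj₁ refl) = ⊥-elim (<-asym ni (descends a))
      ...   | inj₂ (inj₂ refl) = ⊥-elim (<-asym wi (descends a))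
      ...   | inj₂ (inj₁ refl) = next (narrow-east L F born sl wi ni (descends a) sl₁)
      ...   | inj₁ (inj₂ refl) = next (subst (λ w → ∃[ y ] (i ≡ suc y × Narrowing w y)) w≡
               (narrow-east flip S.flipF (sourceless-flip L born) (sinkless-flip L sl) (<R (sym S.flip-west) ni)
                 (<R (sym S.flip-north) wi) (<L (sym S.flip-east) (descends a)) (subst (λ w → Sinkless flip (h w)) (sym w≡) (sinkless-flip L sl₁))))

-- Phase 2: both polygons moving the same way around the cycle.

module Wide where
  open Wedges
  open Landscapes
  open Flip
  open Frames
  open Potential
  open Phase3
  open Enter
  open Phase2

  module _ {V : Set} {h : V → ℕ} {_⟶_ : V → V → Set} {m : ℕ} where

   module Rows (L : Landscape h _⟶_ m) where
    open Landscape L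

    falling : ∀ (f : ℕ → ℕ) {a b} → (∀ {e} → a ≤ e → e < b → f (suc e) < f e) → ∀ {e} → a ≤ e → e ≤ b → f e ≤ f a
    falling f {a} {b} s {e} x y = subst (λ k → f k ≤ f a) (m∸n+n≡m x) (go (e ∸ a) (≤L (sym (m∸n+n≡m x)) y))
      where
      go : ∀ d → d + a ≤ b → f (d + a) ≤ f a
      go zero _ = ≤-refl
      go (suc d) l = ≤-trans (<⇒≤ (s (m≤n+m a d) l)) (go d (<⇒≤ l))

    -- If the row nx q falls to the east from a to c and the rung at c leads from q to nx q,
    -- then the row q falls as well: otherwise q would have a sink above the height t or
    -- the rungs would lead to a source below the height s.
    module _ {q t s a c} (2≤a : 2 ≤ a) (c<m : c < m)
             (sink : Above q t → ⊥) (source : (∀ {j} → 1 ≤ j → j ≤ K → H q j ≤ s) → ⊥)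
             (fall : ∀ {f} → a ≤ f → f < c → H (nx q) (suc f) < H (nx q) f)
             (end : H (nx q) c < H q (suc c)) (t≤ : t ≤ H (nx q) c) (≤s : H (nx q) a ≤ s) where
     private
      rung⊎ : ∀ {f} → a ≤ f → f ≤ c → H q (suc f) < H (nx q) f ⊎ H (nx q) f < H q (suc f)
      rung⊎ x y = ≢⇒<⊎> (rung≢ (≤-trans 2≤a x) (≤-<-trans y c<m))

      -- The rise of q and the direction of the rungs persist together: a rung pointing back would
      -- give a quadrilateral two minima, and a peak of q would put all of q at or below s. At c
      -- this contradicts `end`.
      scan : ∀ d f → d + f ≡ c → a ≤ f → H q (suc f) < H (nx q) f → H q (suc f) < H q (2 + f) → ⊥
      scan zero f refl x r y = <-asym r end
      scan (suc d) f e x r y = go (rung⊎ x′ f<c)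
        where
        f<c : f < c
        f<c = ≤R e (s≤s (m≤n+m f d))
        x′ : a ≤ suc f
        x′ = ≤-trans x (n≤1+n f)
        2+f<K : 2 + f < K
        2+f<K = s≤s (≤-<-trans f<c c<m)
        go : _ → ⊥
        go (inj₂ r′) = quad₂ (≤-trans 2≤a x) 2+f<K y r r′ (fall x f<c)
        go (inj₁ r′) with ≢⇒<⊎> (edge {q} {2 + f} (s≤s z≤n) 2+f<K)
        ... | inj₁ l = scan d (suc f) (trans (+-suc d f) e) x′ r′ l
        ... | inj₂ l = source λ u w → ≤-trans (peak (s≤s z≤n) 2+f<K y l u w)
                         (≤-trans (<⇒≤ r′) (≤-trans (falling (H (nx q)) fall x′ f<c) ≤s))

      fallsAt : ∀ {f} → a ≤ suc f → suc f < c → H q (2 + f) < H q (suc f) → H q (3 + f) < H q (2 + f)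
      fallsAt {f} x y z with ≢⇒<⊎> (edge {q} {2 + f} (s≤s z≤n) (s≤s (<-trans y c<m)))
      ... | inj₂ l = l
      ... | inj₁ l with rung⊎ x (<⇒≤ y)
      ...   | inj₁ r = ⊥-elim (scan (c ∸ suc f) (suc f) (m∸n+n≡m (<⇒≤ y)) x r l)
      ...   | inj₂ r = ⊥-elim (sink λ u w → ≤-trans (≤-trans t≤ (≤-trans (subst (H (nx q) c ≤_) refl (falling′ x (<⇒≤ y))) (<⇒≤ r)))
                           (pit (s≤s z≤n) (s≤s (<-trans y c<m)) z l u w))
        where
        falling′ : ∀ {f} → a ≤ f → f ≤ c → H (nx q) c ≤ H (nx q) f
        falling′ x y = falling (H (nx q)) (λ u w → fall (≤-trans x u) w) y ≤-refl

     falls : ∀ {a′} → a ≡ suc a′ → H q (suc a) < H q a → ∀ {f} → a ≤ f → f < c → H q (2 + f) < H q (suc f)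
     falls {a′} refl z {f} x y = subst (λ k → H q (2 + k) < H q (suc k)) (m∸n+n≡m x) (go (f ∸ a) (≤L (cong suc (sym (m∸n+n≡m x))) y))
       where
       go : ∀ d → d + a < c → H q (2 + (d + a)) < H q (suc (d + a))
       go zero l = fallsAt ≤-refl l z
       go (suc d) l = fallsAt (m≤n+m a (suc d)) l (go d (<-trans (n<1+n _) l))

   module Widening (L : Landscape h _⟶_ m) where
    open Landscape L
    open Framed L
    open Frame
    open Local L
    open Rows L

    record Spread {v} (F : Frame v) : Set where
     constructor spread
     field
      born : Sourceless L (h v)
      sl   : Sinkless L (h v)
      wi   : h v < west F
      si   : h v < south F
     eo : east F < h v
     eo with ≢⇒<⊎> (Ports.e≢ L F)
     ... | inj₁ l = l
     ... | inj₂ l = ⊥-elim (sl (q F) (below-pit (swapF F) wi l))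
     no′ : north F < h v
     no′ with ≢⇒<⊎> (Ports.n≢ L F)
     ... | inj₁ l = l
     ... | inj₂ l = ⊥-elim (sl (p F) (below-pit F si l))
    open Spread

    swapS : ∀ {v} {F : Frame v} → Spread F → Spread (swapF F)
    swapS (spread a b c d) = spread a b d c

    moveE : ∀ {v} {F : Frame v} → Spread F → Sinkless L (h (Pol (q F) (2 + j F))) → ∀ {i′} (i≡ : i F ≡ suc i′) (c : 1 ≤ i′) →
            Spread (eastF F i≡ c)
    moveE {F = F} S s i≡ c = spread (Steady.born₁ L F (born S) (sl S) (eo S) s) s (EastPure.west₁ F i≡ c (eo S))
      (Steady.south-in L F (born S) (sl S) (eo S) s i≡ c (si S))

    cornerE : ∀ {v} {F : Frame v} → Spread F → Sinkless L (h (Pol (q F) (2 + j F))) → (i≡ : i F ≡ 1) → Spread (cornerF F i≡)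
    cornerE {F = F} S s i≡ = spread (Steady.born₁ L F (born S) (sl S) (eo S) s) s (Steady.west-in L F (born S) (sl S) (eo S) s i≡)
      (Corner.south₁ L F i≡ (eo S))

    -- The walk has r steps to the east left before it meets the polygon b₀, at the position d of b₀.
    -- A walk from here to b₀ would force all rows it has crossed to fall to the east.
    record Inv {v} (F : Frame v) (b₀ : Poly) (r d t : ℕ) : Set where
     constructor inv
     field
      row    : ∀ {e} → suc (j F) ≤ e → e < suc (j F) + r → H (q F) (suc e) < H (q F) e
      column : H b₀ (suc d) < H b₀ d
      above  : t ≤ H b₀ d

    -- The history of the walk is kept as a refutation: `impossible` is composed at each step with a
    -- proof that `Inv` at the new vertex implies `Inv` at the old one.
    record Closing {v} (F : Frame v) (r : ℕ) : Set where
     constructor closing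
     field
      b₀  : Poly
      d   : ℕ
      b₀≡ : p F ⊕ r ≡ b₀
      d≡  : d + r ≡ suc (i F)
      2≤d : 2 ≤ d
      impossible : ∀ {t} → Sinkless L t → t ≤ h v → Inv F b₀ r d t → ⊥

    column≡ : ∀ {v} (F : Frame v) {r b₀ d} → p F ⊕ r ≡ b₀ → d + r ≡ suc (i F) → 2 ≤ d → Pol (q F) (suc (j F) + r) ≡ Pol b₀ d
    column≡ F {r} {b₀} {d} e f g = trans (swap (s≤s (≤-trans (1≤j F) (m≤m+n (j F) r))) g
        (trans (+-comm (suc (j F) + r) d) (trans (cong (d +_) (+-comm (suc (j F)) r)) (trans (sym (+-assoc d r _)) (trans (cong (_+ suc (j F)) f) (sum F))))))
      (cong (λ x → Pol x d) (trans (sym (⊕-+ (q F) (suc (j F)) r)) (trans (cong (_⊕ r) (sym (q≡ (swapF F)))) e)))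

    -- With no step left the row is empty and the column is the outgoing north arc, so the invariant
    -- holds and is refuted: the walk never meets `b₀`.
    closed : ∀ {v} (F : Frame v) → Spread F → Closing F 0 → ⊥
    closed F S (closing b₀ d refl d≡ _ k) = k (sl S) ≤-refl (inv
       (λ a b → ⊥-elim (<-irrefl refl (<-≤-trans b (≤L (sym (+-identityʳ _)) a))))
       (subst (λ x → H (p F) (suc x) < H (p F) x) (sym e) (<R (hp F) (no′ S))) (≤-reflexive (trans (hp F) (cong (H (p F)) (sym e)))))
      where
      e : d ≡ suc (i F)
      e = trans (sym (+-identityʳ d)) d≡

    closeE : ∀ {v} (F : Frame v) {r i′} → Spread F → (i≡ : i F ≡ suc i′) (c : 1 ≤ i′) → Closing F (suc r) → Closing (eastF F i≡ c) r
    closeE F {r} S i≡ c (closing b₀ d b₀≡ d≡ 2≤d k) = closing b₀ d (trans (nx-⊕ (p F) r) b₀≡)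
       (suc-injective (trans (sym (+-suc d r)) (trans d≡ (cong suc i≡)))) 2≤d
       λ sl′ t≤ I → k sl′ (≤-trans t≤ (<⇒≤ (eo S))) (inv (row I) (Inv.column I) (Inv.above I))
      where
      row : ∀ {t} → Inv (eastF F i≡ c) b₀ r d t → ∀ {e} → suc (j F) ≤ e → e < suc (j F) + suc r → H (q F) (suc e) < H (q F) e
      row I {e} x y with suc (j F) ≟ e
      ... | yes refl = <R (hq F) (eo S)
      ... | no n = Inv.row I (≤∧≢⇒< x n) (≤R (+-suc (suc (j F)) r) y)

    module _ {v} (F : Frame v) (S : Spread F) {b₀ : Poly} {r d t a a′ c : ℕ} (sl′ : Sinkless L t)
             (2≤a : 2 ≤ a) (a≡ : a ≡ suc a′) (c≡ : j F + r ≡ c) (c<m : c < m) (1≤d : 1 ≤ d) (d<K : suc d < K)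
             (here : Pol (q F) (suc c) ≡ Pol b₀ d) (there : Pol (nx (q F)) c ≡ Pol b₀ (suc d))
             (a≤c : a ≤ c) (le : H (nx (q F)) a ≤ h v) (base : H (q F) (suc a) < H (q F) a)
             (start : ∀ {e} → suc (j F) ≤ e → e ≤ a → H (q F) (suc e) < H (q F) e)
             (fall : ∀ {f} → a ≤ f → f < c → H (nx (q F)) (suc f) < H (nx (q F)) f)
             (column : H b₀ (2 + d) < H b₀ (suc d)) (t≤ : t ≤ H b₀ (suc d)) where

     private
      le′ : H b₀ (suc d) ≤ h v
      le′ = ≤-trans (≤-trans (≤-reflexive (cong h (sym there))) (falling (H (nx (q F))) fall a≤c ≤-refl)) le
      column′ : H b₀ (suc d) < H b₀ d
      column′ with ≢⇒<⊎> (edge {b₀} {d} 1≤d (<-trans (n<1+n d) d<K))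
      ... | inj₂ l = l
      ... | inj₁ l = ⊥-elim (born S b₀ λ x y → ≤-trans (peak 1≤d d<K l column x y) le′)
      rows : ∀ {f} → a ≤ f → f < c → H (q F) (2 + f) < H (q F) (suc f)
      rows = falls {q F} {t} {h v} 2≤a c<m (sl′ (q F)) (born S (q F)) fall
        (subst₂ _<_ (cong h (sym there)) (cong h (sym here)) column′) (≤R (cong h (sym there)) t≤) le a≡ base
      row : ∀ {e} → suc (j F) ≤ e → e < suc (j F) + r → H (q F) (suc e) < H (q F) e
      row {e} x y with e ≤? a
      ... | yes z = start x z
      row {suc e} x y | no z = rows (≤-pred (≰⇒> z)) (≤-trans (≤-pred y) (≤-reflexive c≡))
      row {zero} () y | no z

     -- Carries the fall of the row of `nx q` back to that of q. The column must fall too, for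
     -- otherwise `b₀` would have its maximum at position `suc d`, not above v.
     retreat : Inv F b₀ r d t
     retreat = inv row column′ (≤-trans t≤ (<⇒≤ column′))

    private
      c<m′ : ∀ {v} (F : Frame v) {r d} → d + r ≡ suc (i F) → 2 ≤ d → j F + r < m
      c<m′ F {r} {d} e l = +-cancelˡ-≤ 1 _ _ (≤-trans (+-monoˡ-≤ (j F + r) l) (≤-reflexive (trans (cong (d +_) (+-comm (j F) r))
         (trans (sym (+-assoc d r (j F))) (trans (cong (_+ j F) e) (cong suc (i+j F)))))))
      d<K′ : ∀ {v} (F : Frame v) {r d} → d + r ≡ suc (i F) → d < K
      d<K′ F {r} {d} e = ≤-<-trans (m≤m+n d r) (<L (sym e) (si<K F))

    closeN : ∀ {v} (F : Frame v) {r j′} → Spread F → (j≡ : j F ≡ suc j′) (c : 1 ≤ j′) → Closing F r →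
             Closing (swapF (eastF (swapF F) j≡ c)) r
    closeN F {r} {j′} S j≡ c (closing b₀ d b₀≡ d≡ 2≤d k) = closing b₀ (suc d) b₀≡ d≡₁ (≤-trans 2≤d (n≤1+n d))
       λ sl′ t≤ I → k sl′ (≤-trans t≤ (<⇒≤ (no′ S))) (retreat F S sl′ (s≤s c) refl (cong (_+ r) j≡)
          (≤L (cong (λ x → suc (x + r)) j≡) (c<m′ F d≡ 2≤d)) (≤-trans (n≤1+n 1) 2≤d) (d<K′ F₁ d≡₁)
          (subst (λ x → Pol (q F) (suc x + r) ≡ Pol b₀ d) j≡ (column≡ F b₀≡ d≡ 2≤d))
          (column≡ F₁ b₀≡ d≡₁ (≤-trans 2≤d (n≤1+n d)))
          (m≤m+n (suc j′) r) (≤-trans (≤-reflexive (sym (hq F₁))) (<⇒≤ (no′ S)))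
          (subst (λ x → H (q F) (suc x) < H (q F) x) j≡ (<L (hq F) (wi S)))
          (λ {e} x y → ⊥-elim (<-irrefl refl (≤-trans x (≤-trans y (≤-reflexive (sym j≡))))))
          (Inv.row I) (Inv.column I) (Inv.above I))
      where
      F₁ = swapF (eastF (swapF F) j≡ c)
      d≡₁ : suc d + r ≡ suc (i F₁)
      d≡₁ = cong suc d≡

    closeC : ∀ {v} (F : Frame v) {r} → Spread F → (j≡ : j F ≡ 1) → Closing F (suc r) →
             Closing (swapF (cornerF (swapF F) j≡)) r
    closeC F {r} S j≡ (closing b₀ d b₀≡ d≡ 2≤d k) = closing b₀ (suc d) b₀≡₁ d≡₁ (≤-trans 2≤d (n≤1+n d))
       λ sl′ t≤ I → k sl′ (≤-trans t≤ (<⇒≤ (no′ S))) (retreat F S sl′ ≤-refl refl (cong (_+ suc r) j≡)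
          (≤L (cong (λ x → suc (x + suc r)) j≡) (c<m′ F d≡ 2≤d)) (≤-trans (n≤1+n 1) 2≤d) (d<K′ F₁ d≡₁)
          (subst (λ x → Pol (q F) (suc x + suc r) ≡ Pol b₀ d) j≡ (column≡ F b₀≡ d≡ 2≤d))
          (column≡ F₁ b₀≡₁ d≡₁ (≤-trans 2≤d (n≤1+n d)))
          (m≤m+n 2 r) (≤-trans (≤-reflexive (sym (hq F₁))) (<⇒≤ (no′ S)))
          east₂
          (λ {e} x y → subst (λ z → H (q F) (suc z) < H (q F) z) (≤-antisym (≤-trans (≤-reflexive (cong suc (sym j≡))) x) y) east₂)
          (Inv.row I) (Inv.column I) (Inv.above I))
      where
      F₁ = swapF (cornerF (swapF F) j≡)
      b₀≡₁ = trans (nx-⊕ (p F) r) b₀≡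
      d≡₁ : suc d + r ≡ suc (i F₁)
      d≡₁ = trans (sym (+-suc d r)) d≡
      east₂ : H (q F) 3 < H (q F) 2
      east₂ = subst (λ x → H (q F) (2 + x) < H (q F) (suc x)) j≡ (<R (hq F) (eo S))

    -- A walk that started at the crossing of p₀ and q₀ = p₀ ⊕ g, with rE steps to the east left
    -- before its first polygon becomes q₀ and rN steps to the north before its second becomes p₀.
    record Open {v} (F : Frame v) (rE rN : ℕ) : Set where
     field
      p₀ q₀ : Poly
      g d : ℕ
      2≤g : 2 ≤ g
      2≤d : 2 ≤ d
      whole : g + d ≡ suc K
      q₀≡ : p₀ ⊕ g ≡ q₀
      toq₀ : p F ⊕ rE ≡ q₀
      top₀ : q F ⊕ rN ≡ p₀
      relI : suc (i F) + rN ≡ d + rE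
      relJ : suc (j F) + rE ≡ g + rN
      start≥ : h v ≤ H p₀ g

    swapO : ∀ {v} {F : Frame v} {rE rN} → Open F rE rN → Open (swapF F) rN rE
    swapO O = record { p₀ = q₀ ; q₀ = p₀ ; g = d ; d = g ; 2≤g = 2≤d ; 2≤d = 2≤g ; whole = trans (+-comm d g) whole
      ; q₀≡ = trans (cong (_⊕ d) (sym q₀≡)) (⊕-back p₀ {g} {d} whole) ; toq₀ = top₀ ; top₀ = toq₀ ; relI = relJ ; relJ = relI
      ; start≥ = ≤-trans start≥ (≤-reflexive (cong h (trans (swap 2≤g 2≤d whole) (cong (λ r → Pol r d) q₀≡)))) }
      where open Open O

    -- The second polygon is back at `p₀`. If the row fell all the way to `q₀`, the starting vertex
    -- would be no higher than v.
    closeO : ∀ {v} {F : Frame v} {rE} (O : Open F rE 0) → h v < H (Open.p₀ O) (Open.g O) → Closing F rE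
    closeO {v} {F} {rE} O l = closing q₀ d toq₀ (trans (sym relI) (+-identityʳ _)) 2≤d λ _ _ I →
      <-irrefl refl (<-≤-trans l (≤-trans (≤-reflexive (cong₂ H (sym top₀) (sym e)))
        (≤-trans (falling (H (q F)) (Inv.row I) (m≤m+n (suc (j F)) rE) ≤-refl) (≤-reflexive (sym (hq F))))))
      where
      open Open O
      e : suc (j F) + rE ≡ g
      e = trans relJ (+-identityʳ g)

    pureO : ∀ {v} {F : Frame v} {rE rN i′} (i≡ : i F ≡ suc i′) (c : 1 ≤ i′) → east F < h v → Open F (suc rE) rN → Open (eastF F i≡ c) rE rN
    pureO {F = F} {rE} {rN} {i′} i≡ c e O = record { p₀ = p₀ ; q₀ = q₀ ; g = g ; d = d ; 2≤g = 2≤g ; 2≤d = 2≤d ; whole = whole ; q₀≡ = q₀≡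
      ; toq₀ = trans (nx-⊕ (p F) rE) toq₀ ; top₀ = top₀
      ; relI = suc-injective (trans (cong (λ x → suc x + rN) (sym i≡)) (trans relI (+-suc d rE)))
      ; relJ = trans (sym (+-suc (suc (j F)) rE)) relJ
      ; start≥ = ≤-trans (<⇒≤ e) start≥ }
      where open Open O

    cornerO : ∀ {v} {F : Frame v} {rE rN} (i≡ : i F ≡ 1) → east F < h v → Open F (suc rE) (suc rN) → Open (cornerF F i≡) rE rN
    cornerO {F = F} {rE} {rN} i≡ e O = record { p₀ = p₀ ; q₀ = q₀ ; g = g ; d = d ; 2≤g = 2≤g ; 2≤d = 2≤d ; whole = whole ; q₀≡ = q₀≡
      ; toq₀ = trans (nx-⊕ (p F) rE) toq₀ ; top₀ = trans (nx-⊕ (q F) rN) top₀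
      ; relI = suc-injective (trans (cong (λ x → suc (suc x + rN)) (sym i≡)) (trans (sym (+-suc (suc (i F)) rN)) (trans relI (+-suc d rE))))
      ; relJ = suc-injective (trans (sym (+-suc (suc (j F)) rE)) (trans relJ (+-suc g rN)))
      ; start≥ = ≤-trans (<⇒≤ e) start≥ }
      where open Open O

    module _ (bounds : Bounds _⟶_) where
     open Bounds bounds
     open Quiet {h = h} {m = m} bounds using (ended)
     private
      C = 4 + 12 * m
      four : ∀ r → 4 + (4 * r + C) ≡ 4 * suc r + C
      four r = cong (_+ C) (sym (*-suc 4 r))
      forward : ∀ {v} {F : Frame v} → Spread F → ∀ {w} → v ⟶ w → w ≡ Pol (p F) (2 + i F) ⊎ w ≡ Pol (q F) (2 + j F)
      forward {F = F} S {w} a with Ports.ways L F w a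
      ... | inj₁ (inj₁ e) = inj₁ e
      ... | inj₁ (inj₂ refl) = ⊥-elim (<-asym (si S) (descends a))
      ... | inj₂ (inj₁ e) = inj₂ e
      ... | inj₂ (inj₂ refl) = ⊥-elim (<-asym (wi S) (descends a))

     -- An east step lowers r and a north step does not raise it; r = 0 is impossible, so the walk
     -- has entered phase 3 or stopped before.
     closing-bound : ∀ k {v} (F : Frame v) → Spread F → ∀ r → Closing F r → B k v (4 * r + C)
     closing-bound zero F S r c = base
     closing-bound (suc k) F S zero c = ⊥-elim (closed F S c)
     closing-bound (suc k) {v} F S (suc r) cl = subst (B (suc k) v) (four r) (one (Ports.ways L F) others (Ports.toE L F (eo S)) eastern)
      where
      step : ∀ {x y} → 4 * x + C ≤ y → ∀ {w} → v ⟶ w → (Sinkless L (h w) → B k w (4 * x + C)) → B k w y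
      step {x} le a f with ended L k F a
      ... | inj₁ b = mono (≤-trans (m≤n+m C (4 * x)) le) b
      ... | inj₂ s = mono le (f s)
      eastern : B k (Pol (q F) (2 + j F)) (4 * r + C)
      eastern = step {r} ≤-refl (Ports.toE L F (eo S)) λ s → small (1≤i F)
         (λ i≡ → ⊥-elim (<-irrefl refl (≤-trans (+-mono-≤ (Closing.2≤d cl) (s≤s (z≤n {r}))) (≤-reflexive (trans (Closing.d≡ cl) (cong suc i≡))))))
         (λ i≡ c → closing-bound k (eastF F i≡ c) (moveE S s i≡ c) r (closeE F S i≡ c cl))
      others : ∀ w → v ⟶ w → B k w (4 + (4 * r + C))
      others w a with forward S a
      ... | inj₂ refl = mono (m≤n+m _ 4) eastern
      ... | inj₁ refl = subst (B k w) (sym (four r)) (step {suc r} ≤-refl a λ s → small (1≤j F)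
         (λ j≡ → mono (+-monoˡ-≤ C (*-monoʳ-≤ 4 (n≤1+n r))) (closing-bound k (swapF (cornerF (swapF F) j≡)) (swapS (cornerE (swapS S) s j≡)) r (closeC F S j≡ cl)))
         (λ j≡ c → closing-bound k (swapF (eastF (swapF F) j≡ c)) (swapS (moveE (swapS S) s j≡ c)) (suc r) (closeN F S j≡ c cl)))

     -- Every step lowers the total of `rE` and `rN`. The first of them to vanish opens the closing
     -- stage with the other as its remaining distance.
     open-bound : ∀ k {v} (F : Frame v) → Spread F → ∀ rE rN → Open F (suc rE) (suc rN) → B k v (4 * (suc rE + suc rN) + C)
     resume : ∀ k {v} (F : Frame v) → Spread F → ∀ rE rN → (O : Open F rE rN) → h v < H (Open.p₀ O) (Open.g O) → B k v (4 * (rE + rN) + C)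
     resume k F S zero rN O l = closing-bound k (swapF F) (swapS S) rN (closeO (swapO O)
       (<-≤-trans l (≤-reflexive (cong h (trans (swap (Open.2≤g O) (Open.2≤d O) (Open.whole O)) (cong (λ r → Pol r (Open.d O)) (Open.q₀≡ O)))))))
     resume k {v} F S (suc rE) zero O l = subst (λ x → B k v (4 * x + C)) (sym (+-identityʳ (suc rE))) (closing-bound k F S (suc rE) (closeO O l))
     resume k F S (suc rE) (suc rN) O l = open-bound k F S rE rN O

     open-bound zero F S rE rN O = base
     open-bound (suc k) {v} F S rE rN O = subst (B (suc k) v) (four (rE + suc rN))
        (one (Ports.ways L F) others (Ports.toE L F (eo S)) (eastern F S rE rN O (Ports.toE L F (eo S))))
      where
      eastern : ∀ {v} (F : Frame v) (S : Spread F) rE rN → Open F (suc rE) (suc rN) → v ⟶ Pol (q F) (2 + j F) →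
                B k (Pol (q F) (2 + j F)) (4 * (rE + suc rN) + C)
      eastern F S rE rN O a with ended L k F a
      ... | inj₁ b = mono (m≤n+m C (4 * (rE + suc rN))) b
      ... | inj₂ s = small (1≤i F)
         (λ i≡ → mono (+-monoˡ-≤ C (*-monoʳ-≤ 4 (+-monoʳ-≤ rE (n≤1+n rN))))
            (resume k (cornerF F i≡) (cornerE S s i≡) rE rN (cornerO i≡ (eo S) O) (<-≤-trans (eo S) (Open.start≥ O))))
         (λ i≡ c → resume k (eastF F i≡ c) (moveE S s i≡ c) rE (suc rN) (pureO i≡ c (eo S) O) (<-≤-trans (eo S) (Open.start≥ O)))
      others : ∀ w → v ⟶ w → B k w (4 + (4 * (rE + suc rN) + C))
      others w a with forward S a
      ... | inj₂ refl = mono (m≤n+m _ 4) (eastern F S rE rN O a)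
      ... | inj₁ refl = mono (≤-trans (m≤n+m _ 4) (≤-reflexive (cong (λ x → 4 + (4 * x + C)) (trans (+-suc rN rE) (trans (+-comm (suc rN) rE) refl)))))
                          (eastern (swapF F) (swapS S) rN rE (swapO O) a)

     spread-bound : ∀ k {v} (F : Frame v) → Spread F → B k v (4 * suc K + C)
     spread-bound k {v} F S = subst (λ x → B k v (4 * x + C)) (sum F) (open-bound k F S (i F) (j F) (record
       { p₀ = p F ; q₀ = q F ; g = suc (i F) ; d = suc (j F) ; 2≤g = s≤s (1≤i F) ; 2≤d = s≤s (1≤j F) ; whole = sum F
       ; q₀≡ = sym (q≡ F) ; toq₀ = sym (q≡ F) ; top₀ = sym (q≡ (swapF F))
       ; relI = +-comm (suc (i F)) (suc (j F)) ; relJ = +-comm (suc (j F)) (suc (i F)) ; start≥ = ≤-reflexive (hp F) }))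

-- Phase 1: visiting new polygons.

module Phase1 where
  open Wedges
  open Landscapes
  open Flip
  open Frames
  open Potential
  open Phase3
  open Enter
  open Phase2
  open Wide

  module _ {V : Set} {h : V → ℕ} {_⟶_ : V → V → Set} {m : ℕ} where

   module Settled (bounds : Bounds _⟶_) where
    open Bounds bounds
    open Quiet {h = h} {m = m} bounds using (ended; narrow)
    private
     C = 4 + 12 * m

    -- An incoming south edge means that both polygons advance together; otherwise north is
    -- incoming, as v is no source, and they approach each other.
    quietW : ∀ (L : Landscape h _⟶_ m) k {v} (F : Framed.Frame L v) → Sourceless L (h v) → Sinkless L (h v) → h v < Framed.Frame.west F →
             B k v (4 * suc (suc m) + C)
    quietW L k F born sl wi with ≢⇒<⊎> (λ x → Ports.s≢ L F (sym x))
    ... | inj₁ si = Widening.spread-bound L bounds k F (Widening.spread born sl wi si)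
    ... | inj₂ so with ≢⇒<⊎> (λ x → Ports.n≢ L F (sym x))
    ...   | inj₂ nout = ⊥-elim (Local.no-peak L F born so nout)
    ...   | inj₁ ni = mono (+-monoˡ-≤ C (≤-trans (≤-trans (Framed.Frame.i<m F) (≤-trans (n≤1+n m) (n≤1+n (suc m)))) (m≤n*m (suc (suc m)) 4)))
                        (narrow k (narrowing L F born sl wi ni refl))

    -- The first step turns the absence of polygons strictly below v into the absence of polygons at
    -- or below the new height.
    settled : ∀ (L : Landscape h _⟶_ m) k {v} (F : Framed.Frame L v) → (∀ y → Landscape.Below L y (h v) → ⊥) →
              B k v (suc (4 * suc (suc m) + C))
    settled L zero F nb = base
    settled L (suc k) {v} F nb = all λ w a → [ mono (m≤n+m C (4 * suc (suc m))) , quiet w a (Local.successor L F a) ]′ (ended L k F a)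
      where
      open Framed L
      quiet : ∀ w → v ⟶ w → Frame w → Sinkless L (h w) → B k w (4 * suc (suc m) + C)
      quiet w a G sl with ≢⇒<⊎> (λ x → Ports.w≢ L G (sym x))
      ... | inj₁ wi = quietW L k G born sl wi
        where
        born : Sourceless L (h w)
        born y f = nb y λ {j} x z → ≤-<-trans (f {j} x z) (Landscape.descends L a)
      ... | inj₂ wo with ≢⇒<⊎> (λ x → Ports.e≢ L G (sym x))
      ...   | inj₁ ei = quietW (Flipped.flip L) k (Ports.flipF L G) (sourceless-flip L born) (sinkless-flip L sl) (<R (sym (Ports.flip-west L G)) ei)
        where
        born : Sourceless L (h w)
        born y f = nb y λ {j} x z → ≤-<-trans (f {j} x z) (Landscape.descends L a)
      ...   | inj₂ eo = ⊥-elim (nb (Frame.q G) λ {j} x z → ≤-<-trans (peak (Frame.1≤j G) (Frame.sj<K G) (<R (Frame.hq G) wo) (<R (Frame.hq G) eo) x z)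
                                   (≤-<-trans (≤-reflexive (sym (Frame.hq G))) (descends a)))
        where open Landscape L

   module Late (L : Landscape h _⟶_ m) where
    open Landscape L
    open Framed L
    open Local L
    open Frame

    -- Its negation stands in for having been visited: a polygon met earlier by the descending walk
    -- has a vertex higher than the walk.
    Early : Poly → ℕ → Set
    Early y t = ∀ {j} → 1 ≤ j → j ≤ K → H y j ≤ t

    -- The polygons at distance 1 to e from p have been visited; k is r + 1 steps further on.
    record Side (f : Poly → Poly) (p k : Poly) (t e r : ℕ) : Set where
     constructor side
     field
      visited : ∀ {i} → 1 ≤ i → i ≤ e → Early (iter f i p) t → ⊥
      end     : iter f (suc (e + r)) p ≡ k

    stay : ∀ {f p k t t′ e r} → t′ ≤ t → Side f p k t e r → Side f p k t′ e r
    stay le (side v x) = side (λ a b f → v a b λ c d → ≤-trans (f c d) le) x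

    behind : ∀ {f g : Poly → Poly} {p k t t′ e r} → f (g p) ≡ p → t′ ≤ t → (Early p t′ → ⊥) → Side f p k t e r → Side f (g p) k t′ (suc e) r
    behind {f} {g} {p} {k} {t} {t′} {e} {r} fg le late (side v x) = side go (trans (shifted (suc (e + r))) x)
      where
      shifted : ∀ i → iter f (suc i) (g p) ≡ iter f i p
      shifted i = trans (sym (iter-comm f i (g p))) (cong (iter f i) fg)
      go : ∀ {i} → 1 ≤ i → i ≤ suc e → Early (iter f i (g p)) t′ → ⊥
      go {suc zero} a b z = late (subst (λ y → Early y t′) fg z)
      go {suc (suc i)} a (s≤s b) z = v (s≤s z≤n) b λ c d → ≤-trans (subst (λ y → Early y t′) (shifted (suc i)) z c d) le

    -- The step uses up a visited polygon if there is one ahead, and one of the remaining ones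
    -- otherwise. It never lands on k.
    ahead : ∀ {f p k t t′ e r} → t′ ≤ t → (f p ≡ k → ⊥) → Side f p k t e r →
            ∃[ e′ ] ∃[ r′ ] (Side f (f p) k t′ e′ r′ × r′ ≤ r × (e ≡ 0 → e′ ≡ 0 × suc r′ ≡ r))
    ahead {e = zero} {zero} le ne (side v x) = ⊥-elim (ne x)
    ahead {f} {p} {e = zero} {suc r} le ne (side v x) = 0 , r , side (λ { (s≤s a) () }) (trans (iter-comm f (suc r) p) x) , n≤1+n r , λ _ → refl , refl
    ahead {f} {p} {t′ = t′} {e = suc e} {r} le ne (side v x) = e , r ,
      side (λ {i} a b z → v {suc i} (s≤s z≤n) (s≤s b) λ c d → ≤-trans (subst (λ y → Early y t′) (iter-comm f i p) z c d) le)
           (trans (iter-comm f (suc (e + r)) p) x) , ≤-refl , λ ()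

    fresh : ∀ {f p k t e r} → Side f p k t e r → Early (f p) t → e ≡ 0
    fresh {e = zero} s z = refl
    fresh {e = suc e} (side v x) z = ⊥-elim (v {1} ≤-refl (s≤s z≤n) z)

    record Sides {v} (F : Frame v) (k : Poly) (eW rW eE rE eS rS eN rN : ℕ) : Set where
     constructor sides₄
     field
      W : Side pv (p F) k (h v) eW rW
      E : Side nx (p F) k (h v) eE rE
      S : Side pv (q F) k (h v) eS rS
      N : Side nx (q F) k (h v) eN rN

    -- Such a k is the last polygon to be reached: while any polygon lies below the walk, so does k.
    Best : Poly → Set
    Best k = ∀ {t} → (Below k t → ⊥) → ∀ y → Below y t → ⊥

   open Late using (Side; side; sides₄; Sides)

   -- A walk about to visit new polygons to the north: k has not been visited, the second polygon
   -- of v is the northernmost visited one and the first polygon passes v to the north.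
   data Front (v : V) (R : ℕ) : Set₁ where
    front : (L : Landscape h _⟶_ m) (F : Framed.Frame L v) (k : Landscape.Poly L) → let open Framed.Frame F in
            Late.Best L k → Landscape.Below L k (h v) → h v < south → north < h v →
            ∀ {eW rW eE rE eS rS rN} → Sides L F k eW rW eE rE eS rS 0 rN → rW + rE + (rS + rN) ≤ R → Front v R

   module _ (L : Landscape h _⟶_ m) where
    open Landscape L
    open Flipped L
    open Late L using (Early; Best)

    belowF : ∀ {k t} → Below k t → Landscape.Below flip k t
    belowF f {j} a b = f (m<n⇒0<n∸m (s≤s b)) (∸-monoʳ-≤ (suc K) a)

    bestF : ∀ {k} → Best k → Late.Best flip k
    bestF b n y f = b (λ g → n (belowF (λ {j} → g {j}))) y (Framed.unmirror L {R = _< _} f)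

    sideF : ∀ {f p k t e r} → Side L f p k t e r → Side flip f p k t e r
    sideF (side v x) = side (λ a b f → v a b (Framed.unmirror L {R = _≤ _} f)) x

    swapSides : ∀ {v} {F : Framed.Frame L v} {k eW rW eE rE eS rS eN rN} → Sides L F k eW rW eE rE eS rS eN rN →
                Sides L (Framed.swapF L F) k eS rS eN rN eW rW eE rE
    swapSides (sides₄ w e s n) = sides₄ s n w e

    flipSides : ∀ {v} {F : Framed.Frame L v} {k eW rW eE rE eS rS eN rN} → Sides L F k eW rW eE rE eS rS eN rN →
                Sides flip (Ports.flipF L F) k eE rE eW rW eN rN eS rS
    flipSides (sides₄ w e s n) = sides₄ (sideF e) (sideF w) (sideF n) (sideF s)

   module Move (L : Landscape h _⟶_ m) {v} (F : Framed.Frame L v) (k : Landscape.Poly L) (best : Late.Best L k)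
               (e : Framed.Frame.east F < h v) (bw : Landscape.Below L k (h (Landscape.Pol L (Framed.Frame.q F) (2 + Framed.Frame.j F))))
               {eW rW eE rE eS rS eN rN : ℕ} (sd : Sides L F k eW rW eE rE eS rS eN rN) where
    open Landscape L
    open Framed L
    open Frame F
    open Ports L F using (s≢; n≢)
    open Late L using (Early; stay; behind; ahead; fresh)
    open Local L using (below-pit)
    private
     w₁ = Pol q (2 + j)
     total = rW + rE + (rS + rN)

     sl : Sinkless L (h w₁)
     sl y a = above-below (λ {j} → a {j}) (λ {j} → bw {j})

     away : ∀ {r} → ∃[ x ] (1 ≤ x × x ≤ K × w₁ ≡ Pol r x) → r ≡ k → ⊥
     away (x , a , b , z) refl = <-irrefl (cong h (sym z)) (bw a b)

     late-p : Early p (h w₁) → ⊥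
     late-p f = <-irrefl refl (<-≤-trans e (≤L (sym hp) (f (s≤s z≤n) (<⇒≤ si<K))))
     late-q : Early q (h w₁) → ⊥
     late-q f = <-irrefl refl (<-≤-trans e (≤L (sym hq) (f (s≤s z≤n) (<⇒≤ sj<K))))

     open Sides sd

     inEast inNorth : Set
     inEast = ∃[ e′ ] ∃[ r′ ] (Side L nx (nx p) k (h w₁) e′ r′ × r′ ≤ rE × (eE ≡ 0 → e′ ≡ 0 × suc r′ ≡ rE))
     inNorth = ∃[ e′ ] ∃[ r′ ] (Side L nx (nx q) k (h w₁) e′ r′ × r′ ≤ rN × (eN ≡ 0 → e′ ≡ 0 × suc r′ ≡ rN))

     E₁ : inEast
     E₁ = ahead (<⇒≤ e) (away (East.onE L F)) E
     W₁ : Side L pv (nx p) k (h w₁) (suc eW) rW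
     W₁ = behind {g = nx} (pv-nx p) (<⇒≤ e) late-p W
     N₁ : i ≡ 1 → inNorth
     N₁ i≡ = ahead (<⇒≤ e) (away (suc j , s≤s z≤n , <⇒≤ (Frame.sj<K (cornerF F i≡)) , Frame.v≡′ (cornerF F i≡))) N
     S₁ : Side L pv (nx q) k (h w₁) (suc eS) rS
     S₁ = behind {g = nx} (pv-nx q) (<⇒≤ e) late-q S

     in? : ∀ {a} → a ≢ h w₁ → h w₁ < a ⊎ a < h w₁
     in? n = ≢⇒<⊎> (λ x → n (sym x))

     -- w₁ is not a sink of any polygon, so it passes each polygon that has an edge into it.
     out-E : (G : Frame w₁) → h w₁ < Frame.west G → Frame.east G < h w₁
     out-E G wi with in? (Ports.e≢ L G)
     ... | inj₂ x = x
     ... | inj₁ x = ⊥-elim (sl (Frame.q G) (below-pit (swapF G) wi x))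
     out-N : (G : Frame w₁) → h w₁ < Frame.south G → Frame.north G < h w₁
     out-N G si with in? (Ports.n≢ L G)
     ... | inj₂ x = x
     ... | inj₁ x = ⊥-elim (sl (Frame.p G) (below-pit G si x))
     out-S : (G : Frame w₁) → h w₁ < Frame.north G → Frame.south G < h w₁
     out-S G ni with in? (Ports.s≢ L G)
     ... | inj₂ x = x
     ... | inj₁ x = ⊥-elim (sl (Frame.p G) (below-pit G x ni))

     early-p : (G : Frame w₁) → Frame.south G < h w₁ → Frame.north G < h w₁ → Early (Frame.p G) (h w₁)
     early-p G s n a b = ≤R (sym (Frame.hp G)) (peak (Frame.1≤i G) (Frame.si<K G) (<R (Frame.hp G) s) (<R (Frame.hp G) n) a b)

     later : ∀ {r} → Early r (h w₁) → Early r (h v)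
     later f a b = ≤-trans (f a b) (<⇒≤ e)

     modeN : (G : Frame w₁) → h w₁ < Frame.south G → ∀ {eW rW eE rE eS rS rN R} → Sides L G k eW rW eE rE eS rS 0 rN →
             rW + rE + (rS + rN) ≤ R → Front w₁ R
     modeN G si = front L G k best bw si (out-N G si)

     modeE : (G : Frame w₁) → h w₁ < Frame.west G → ∀ {eW rW rE eS rS eN rN R} → Sides L G k eW rW 0 rE eS rS eN rN →
             rW + rE + (rS + rN) ≤ R → Front w₁ R
     modeE G wi {rW = rW} {rE} {rS = rS} {rN = rN} s le =
       front L (swapF G) k best bw wi (out-E G wi) (swapSides L s) (≤-trans (≤-reflexive (+-comm (rS + rN) (rW + rE))) le)

     modeS : (G : Frame w₁) → h w₁ < Frame.north G → ∀ {eW rW eE rE rS eN rN R} → Sides L G k eW rW eE rE 0 rS eN rN →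
             rW + rE + (rS + rN) ≤ R → Front w₁ R
     modeS G ni {rW = rW} {rE = rE} {rS = rS} {rN = rN} s le =
       front (Flipped.flip L) (Ports.flipF L G) k (bestF L best) (belowF L bw)
         (<R (sym (Ports.flip-south L G)) ni) (<L (sym (Ports.flip-north L G)) (out-S G ni)) (flipSides L s)
         (≤-trans (≤-reflexive (cong₂ _+_ (+-comm rE rW) (+-comm rN rS))) le)

     module Pure {i′} (i≡ : i ≡ suc i′) (c : 1 ≤ i′) where
      G = eastF F i≡ c
      open EastPure F i≡ c e

      moved : ∀ {e′ r′} → Side L nx (nx p) k (h w₁) e′ r′ → Sides L G k (suc eW) rW e′ r′ eS rS eN rN
      moved s = sides₄ W₁ s (stay (<⇒≤ e) S) (stay (<⇒≤ e) N)

      -- As k is still below the walk, p cannot lie above it. So `nx p` lies below v and has not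
      -- been visited.
      turned : Turn p (nx p) (h v) (h w₁) → eE ≡ 0
      turned (inj₁ below) = fresh E λ a b → <⇒≤ (below a b)
      turned (inj₂ above) = ⊥-elim (sl p λ a b → <⇒≤ (above a b))

      new : eE ≡ 0 → ∃[ R ] (suc R ≤ total × Front w₁ R)
      new z with E₁
      ... | e′ , r′ , s , _ , f with f z
      ...   | refl , refl = rW + r′ + (rS + rN) , ≤-reflexive (cong (_+ (rS + rN)) (sym (+-suc rW r′))) , modeE G west₁ (moved s) ≤-refl

      keepN : eN ≡ 0 → h v < south → ∃[ R ] (R ≤ total × Front w₁ R)
      keepN refl si with in? (Ports.s≢ L G) | E₁
      ... | inj₂ x | _ = let R , le , f = new (turned (turn↓ (inj₂ (si , x)))) in R , <⇒≤ le , f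
      ... | inj₁ x | e′ , r′ , s , le , _ = rW + r′ + (rS + rN) , +-monoˡ-≤ (rS + rN) (+-monoʳ-≤ rW le) , modeN G x (moved s) ≤-refl

      keepS : eS ≡ 0 → h v < north → ∃[ R ] (R ≤ total × Front w₁ R)
      keepS refl ni with in? (Ports.n≢ L G) | E₁
      ... | inj₂ x | _ = let R , le , f = new (turned (turn↑ (inj₂ (ni , x)))) in R , <⇒≤ le , f
      ... | inj₁ x | e′ , r′ , s , le , _ = rW + r′ + (rS + rN) , +-monoˡ-≤ (rS + rN) (+-monoʳ-≤ rW le) , modeS G x (moved s) ≤-refl

     module Diagonal (i≡ : i ≡ 1) where
      open Corner L F i≡ e using (south₁; sink; v-corner; south-corner; j≡)
      G = cornerF F i≡

      moved : ∀ {e′ r′ e″ r″} → Side L nx (nx p) k (h w₁) e′ r′ → Side L nx (nx q) k (h w₁) e″ r″ →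
              Sides L G k (suc eW) rW e′ r′ (suc eS) rS e″ r″
      moved s t = sides₄ W₁ s S₁ t

      out-E′ : Frame.east G < h w₁
      out-E′ with in? (Ports.e≢ L G)
      ... | inj₂ x = x
      ... | inj₁ x = ⊥-elim (sl q (sink x))

      new : eE ≡ 0 → ∃[ R ] (suc R ≤ total × Front w₁ R)
      new z with E₁ | N₁ i≡
      ... | e′ , r′ , s , _ , f | e″ , r″ , t , le , g with f z
      ...   | refl , refl with in? (Ports.w≢ L G)
      ...     | inj₁ x = rW + r′ + (rS + r″) ,
                  ≤-trans (s≤s (+-monoʳ-≤ (rW + r′) (+-monoʳ-≤ rS le))) (≤-reflexive (cong (_+ (rS + rN)) (sym (+-suc rW r′)))) ,
                  modeE G x (moved s t) ≤-refl
      ...     | inj₂ x with g (fresh N (later (early-p (swapF G) x out-E′)))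
      ...       | refl , refl = rW + r′ + (rS + r″) ,
                  ≤-trans (s≤s (+-monoʳ-≤ (rW + r′) (+-monoʳ-≤ rS le))) (≤-reflexive (cong (_+ (rS + rN)) (sym (+-suc rW r′)))) ,
                  modeN G south₁ (moved s t) ≤-refl

      keepN : eN ≡ 0 → h v < south → ∃[ R ] (R ≤ total × Front w₁ R)
      keepN z _ with E₁ | N₁ i≡
      ... | e′ , r′ , s , le , _ | e″ , r″ , t , le′ , g with g z
      ...   | refl , refl = rW + r′ + (rS + r″) , +-mono-≤ (+-monoʳ-≤ rW le) (+-monoʳ-≤ rS le′) , modeN G south₁ (moved s t) ≤-refl

      -- v is the source of the polygon nx p
      keepS : south < h v → h v < north → ∃[ R ] (R ≤ total × Front w₁ R)
      keepS so ni with E₁ | N₁ i≡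
      ... | e′ , r′ , s , le , f | e″ , r″ , t , le′ , _
        with f (fresh E λ a b → ≤R (sym v-corner) (peak₁ (subst₂ _<_ (Frame.hp G) v-corner e) (subst₂ _<_ south-corner v-corner so) a b))
      ...   | refl , _ = rW + r′ + (rS + r″) , +-mono-≤ (+-monoʳ-≤ rW le) (+-monoʳ-≤ rS le′) ,
                  modeE G (<R north≡ (<-trans e ni)) (moved s t) ≤-refl
        where
        2≤j : 2 ≤ j
        2≤j = ≤-pred (≤R (sym j≡) 3≤m)
        north≡ : north ≡ Frame.west G
        north≡ = trans (cong (λ x → H p (2 + x)) i≡) (cong h (trans (swap (s≤s (s≤s z≤n)) 2≤j (cong (2 +_) j≡))
                   (cong (λ r → Pol r j) (cong nx (trans (cong (λ x → p ⊕ suc x) (sym i≡)) (sym q≡))))))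

    -- The new polygon is taken from the remaining ones, and the walk is again at a front: the next
    -- polygon to the east is unvisited too, or, after a corner, the new vertex may be the source of
    -- `nx q` and the front lies to the north.
    freshE : eE ≡ 0 → ∃[ R ] (suc R ≤ total × Front w₁ R)
    freshE z = small 1≤i (λ i≡ → Diagonal.new i≡ z) (λ i≡ c → Pure.new i≡ c z)

    -- A sideways step preserves the front unless the arcs at its two ends disagree. In that case
    -- the polygon entered was unvisited and the front moves to the east.
    keepN : eN ≡ 0 → h v < south → ∃[ R ] (R ≤ total × Front w₁ R)
    keepN z si = small 1≤i (λ i≡ → Diagonal.keepN i≡ z si) (λ i≡ c → Pure.keepN i≡ c z si)

    keepS : eS ≡ 0 → south < h v → h v < north → ∃[ R ] (R ≤ total × Front w₁ R)
    keepS z so ni = small 1≤i (λ i≡ → Diagonal.keepS i≡ so ni) (λ i≡ c → Pure.keepS i≡ c z ni)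

   module Exploring (bounds : Bounds _⟶_) where
    open Bounds bounds
    open Settled bounds using (settled)
    private
     C = suc (4 * suc (suc m) + (4 + 12 * m))

    new-or-settled : ∀ (L : Landscape h _⟶_ m) k {w} κ → Framed.Frame L w → Late.Best L κ →
                     B k w C ⊎ Landscape.Below L κ (h w)
    new-or-settled L k {w} κ G best with positions? (λ j → Landscape.H L κ j <? h w) (Landscape.K L)
    ... | yes f = inj₂ f
    ... | no n = inj₁ (settled L k G λ y → best n y)

    -- The north arc enters a new polygon and gains 4; the south edge is incoming, and east and west
    -- steps keep some front without raising R.
    front-bound : ∀ k {v R} → Front v R → B k v (4 * R + (4 + C))
    front-bound zero f = base
    front-bound (suc k) {v} {R} (front L F κ best bκ si nᵒ {rW = rW} {rE = rE} {rS = rS} {rN = rN} sd le) =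
      subst (B (suc k) v) e₄ (one (Ports.ways L F) others (Ports.toN L F nᵒ) northern)
      where
      open Landscape L
      open Framed L
      open Frame F
      open Flipped L
      module P = Ports L F
      e₄ : 4 + (4 * R + C) ≡ 4 * R + (4 + C)
      e₄ = trans (cong (4 +_) (+-comm (4 * R) C)) (+-comm (4 + C) (4 * R))
      drop : ∀ {w} → (∃[ R′ ] (suc R′ ≤ R × Front w R′)) → B k w (4 * R + C)
      drop (R′ , l , f) = mono (≤-trans (≤-reflexive (trans (sym (+-assoc (4 * R′) 4 C)) (cong (_+ C) (trans (+-comm (4 * R′) 4) (sym (*-suc 4 R′)))))) (+-monoˡ-≤ C (*-monoʳ-≤ 4 l))) (front-bound k f)
      keep : ∀ {w} → (∃[ R′ ] (R′ ≤ R × Front w R′)) → B k w (4 * R + (4 + C))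
      keep (R′ , l , f) = mono (+-monoˡ-≤ (4 + C) (*-monoʳ-≤ 4 l)) (front-bound k f)
      late : ∀ {w} → B k w C → B k w (4 * R + (4 + C))
      late b = mono (≤-trans (m≤n+m C 4) (m≤n+m (4 + C) (4 * R))) b
      northern : B k (Pol p (2 + i)) (4 * R + C)
      northern with new-or-settled L k κ (Local.successor L F (P.toN nᵒ)) best
      ... | inj₁ b = mono (m≤n+m C (4 * R)) b
      ... | inj₂ bw = let R′ , l , f = Move.freshE L (swapF F) κ best nᵒ bw (swapSides L sd) refl
                      in drop (R′ , ≤-trans l (≤-trans (≤-reflexive (+-comm (rS + rN) (rW + rE))) le) , f)
      w≡ : Pol′ q (2 + i) ≡ Pol q j
      w≡ = mirror q (2 + i) (trans (cong suc (sym (+-suc i j))) sum)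
      others : ∀ w → v ⟶ w → B k w (4 + (4 * R + C))
      others w a = subst (B k w) (sym e₄) (go (P.ways w a))
        where
        go : _ → B k w (4 * R + (4 + C))
        go (inj₁ (inj₁ refl)) = subst (B k w) e₄ (mono (m≤n+m _ 4) northern)
        go (inj₁ (inj₂ refl)) = ⊥-elim (<-asym si (descends a))
        go (inj₂ (inj₁ refl)) with new-or-settled L k κ (Local.successor L F a) best
        ... | inj₁ b = late b
        ... | inj₂ bw = let R′ , l , f = Move.keepN L F κ best (descends a) bw sd refl si in keep (R′ , ≤-trans l le , f)
        go (inj₂ (inj₂ refl)) with new-or-settled L k κ (Local.successor L F a) best
        ... | inj₁ b = late b
        ... | inj₂ bw = let R′ , l , f = Move.keepS flip P.flipF κ (bestF L best) (<L (sym P.flip-east) (descends a))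
                                (subst (λ x → Landscape.Below flip κ (h x)) (sym w≡) (belowF L bw)) (flipSides L sd) refl
                                (<L (sym P.flip-south) nᵒ) (<R (sym P.flip-north) si)
                        in keep (R′ , ≤-trans l (≤-trans (≤-reflexive (cong₂ _+_ (+-comm rE rW) (+-comm rN rS))) le) , subst (λ x → Front x R′) w≡ f)

    -- Nothing has been visited at the start, so whichever arc is taken leads to a front. Each of
    -- the four sides has at most K polygons left before k.
    start-bound : ∀ (L : Landscape h _⟶_ m) k {v} κ → Framed.Frame L v → Late.Best L κ → Landscape.Below L κ (h v) →
                  B k v (suc (4 * (4 * suc m) + (4 + C)))
    start-bound L zero κ F best bκ = base
    start-bound L (suc k) {v} κ F best bκ = all go
      where
      open Landscape L
      open Framed L
      open Frame F
      open Flipped L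
      module P = Ports L F
      module S = Ports L (swapF F)
      sideTo : ∀ {f r} → (∃[ e ] (e ≤ K × iter f e r ≡ κ)) → (∃[ x ] (1 ≤ x × x ≤ K × v ≡ Pol r x)) →
               ∃[ s ] (s ≤ K × Side L f r κ (h v) 0 s)
      sideTo (zero , _ , refl) (x , a , b , z) = ⊥-elim (<-irrefl (cong h (sym z)) (bκ a b))
      sideTo (suc s , l , e) _ = s , ≤-trans (n≤1+n s) l , side (λ { (s≤s a) () }) e
      on-p : ∃[ x ] (1 ≤ x × x ≤ K × v ≡ Pol p x)
      on-p = suc i , s≤s z≤n , <⇒≤ si<K , v≡
      on-q : ∃[ x ] (1 ≤ x × x ≤ K × v ≡ Pol q x)
      on-q = suc j , s≤s z≤n , <⇒≤ sj<K , v≡′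
      go : ∀ w → v ⟶ w → B k w (4 * (4 * suc m) + (4 + C))
      go w a with new-or-settled L k κ (Local.successor L F a) best
                | sideTo (Landscape.connected flip p κ) on-p | sideTo (connected p κ) on-p
                | sideTo (Landscape.connected flip q κ) on-q | sideTo (connected q κ) on-q
      ... | inj₁ b | _ | _ | _ | _ = mono (≤-trans (m≤n+m C 4) (m≤n+m (4 + C) (4 * (4 * suc m)))) b
      ... | inj₂ bw | rW , lW , sW | rE , lE , sE | rS , lS , sS | rN , lN , sN = dispatch (P.ways w a)
        where
        sd : Sides L F κ 0 rW 0 rE 0 rS 0 rN
        sd = sides₄ sW sE sS sN
        four : ∀ {a b c d} → a ≤ K → b ≤ K → c ≤ K → d ≤ K → a + b + (c + d) ≤ 4 * suc m
        four x y z u = ≤-trans (+-mono-≤ (+-mono-≤ x y) (+-mono-≤ z u))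
          (≤-reflexive (trans (+-assoc K K (K + K)) (cong (λ t → K + (K + (K + t))) (sym (+-identityʳ K)))))
        run : ∀ {x T} → T ≤ 4 * suc m → x ≡ w → (∃[ R ] (suc R ≤ T × Front x R)) → B k w (4 * (4 * suc m) + (4 + C))
        run l refl (R , le , f) = mono (+-monoˡ-≤ (4 + C) (*-monoʳ-≤ 4 (≤-trans (<⇒≤ le) l))) (front-bound k f)
        dispatch : _ → B k w (4 * (4 * suc m) + (4 + C))
        dispatch (inj₁ (inj₁ refl)) = run (four lS lN lW lE) refl (Move.freshE L (swapF F) κ best (descends a) bw (swapSides L sd) refl)
        dispatch (inj₂ (inj₁ refl)) = run (four lW lE lS lN) refl (Move.freshE L F κ best (descends a) bw sd refl)
        dispatch (inj₂ (inj₂ refl)) = run (four lE lW lN lS) w≡ (Move.freshE flip P.flipF κ (bestF L best) (<L (sym P.flip-east) (descends a))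
               (subst (λ x → Landscape.Below flip κ (h x)) (sym w≡) (belowF L bw)) (flipSides L sd) refl)
          where
          w≡ : Pol′ q (2 + i) ≡ Pol q j
          w≡ = mirror q (2 + i) (trans (cong suc (sym (+-suc i j))) sum)
        dispatch (inj₁ (inj₂ refl)) = run (four lN lS lE lW) w≡ (Move.freshE flip S.flipF κ (bestF L best) (<L (sym S.flip-east) (descends a))
               (subst (λ x → Landscape.Below flip κ (h x)) (sym w≡) (belowF L bw)) (flipSides L (swapSides L sd)) refl)
          where
          w≡ : Pol′ p (2 + j) ≡ Pol p i
          w≡ = mirror p (2 + j) (trans (cong suc (sym (+-suc j i))) (trans (cong suc (+-comm j (suc i))) (trans (sym (+-suc (suc i) j)) sum)))

    everywhere : ∀ (L : Landscape h _⟶_ m) k {v} κ → Framed.Frame L v → Late.Best L κ → B k v (suc (4 * (4 * suc m) + (4 + C)))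
    everywhere L k κ F best with new-or-settled L k κ F best
    ... | inj₁ b = mono (≤-trans (m≤n+m C 5) (≤-trans (m≤n+m (5 + C) (4 * (4 * suc m))) (≤-reflexive (+-suc (4 * (4 * suc m)) (4 + C))))) b
    ... | inj₂ bκ = start-bound L k κ F best bκ

-- Rational expectations as an instance of the abstract bounds.

module Expect where
  open import Defs
  open import Data.Nat.Solver using (module +-*-Solver)
  open +-*-Solver using (solve; con; _:+_; _:*_; _:=_)
  open import Data.Bool using (Bool; true; false; T)
  import Data.Bool
  open import Data.Bool.Properties using (T-≡)
  open import Data.Integer as ℤ using (+_)
  import Data.Integer.Properties as ℤ
  open import Data.Rational as ℚ using (ℚ; 1ℚ; _/_; toℚᵘ)
  import Data.Rational.Properties as ℚ
  import Data.Rational.Unnormalised as ℚᵘ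
  import Data.Rational.Unnormalised.Properties as ℚᵘ
  open import Data.Fin.Subset using (Subset; inside; outside)
  open import Data.Vec using () renaming (_∷_ to _∷ᵛ_; [] to []ᵛ)
  open import Data.List as List using (List; []; _∷_; length; filter)
  open import Data.List.Membership.Propositional using () renaming (_∈_ to _∈ˡ_)
  open import Data.List.Membership.Propositional.Properties using (∈-filter⁺; ∈-filter⁻; ∈-map⁺; ∈-map⁻; ∈-++⁺ˡ; ∈-++⁺ʳ)
  open import Data.List.Relation.Unary.Any using (here; there)
  open import Data.List.Relation.Unary.All as All using (All; []; _∷_)
  open import Data.List.Relation.Unary.AllPairs using ([]; _∷_)
  open import Data.List.Relation.Unary.Unique.Propositional using (Unique)
  import Data.List.Relation.Unary.Unique.Propositional.Properties as Unique
  open import Function.Bundles using (Equivalence)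
  open Phase3 using (Bounds)

  ι : ℕ → ℚ
  ι a = + a / 1

  private
    toι : ∀ a → toℚᵘ (ι a) ℚᵘ.≃ ℚᵘ.mkℚᵘ (+ a) 0
    toι a = ℚ.toℚᵘ-fromℚᵘ (ℚᵘ.mkℚᵘ (+ a) 0)

  ι-mono : ∀ {a b} → a ≤ b → ι a ℚ.≤ ι b
  ι-mono {a} {b} le = ℚ.toℚᵘ-cancel-≤ (ℚᵘ.≤-trans (ℚᵘ.≤-reflexive (toι a)) (ℚᵘ.≤-trans
     (ℚᵘ.*≤* (ℤ.*-monoʳ-≤-nonNeg (+ 1) (ℤ.+≤+ le))) (ℚᵘ.≤-reflexive (ℚᵘ.≃-sym (toι b)))))

  ι-+ : ∀ a b → ι a ℚ.+ ι b ≡ ι (a + b)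
  ι-+ a b = ℚ.toℚᵘ-injective (ℚᵘ.≃-trans (ℚ.toℚᵘ-homo-+ (ι a) (ι b)) (ℚᵘ.≃-trans (ℚᵘ.+-cong (toι a) (toι b))
     (ℚᵘ.≃-trans (ℚᵘ.*≡* (cong (ℤ._* + 1) (trans (cong₂ ℤ._+_ (ℤ.*-identityʳ (+ a)) (ℤ.*-identityʳ (+ b))) refl))) (ℚᵘ.≃-sym (toι (a + b))))))

  ι-average : ∀ l b → ι (suc l * b) ℚ.* (+ 1 / suc l) ≡ ι b
  ι-average l b = ℚ.toℚᵘ-injective (ℚᵘ.≃-trans (ℚ.toℚᵘ-homo-* (ι (suc l * b)) (+ 1 / suc l))
     (ℚᵘ.≃-trans (ℚᵘ.*-cong (toι (suc l * b)) (ℚ.toℚᵘ-fromℚᵘ (ℚᵘ.mkℚᵘ (+ 1) l)))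
     (ℚᵘ.≃-trans (ℚᵘ.*≡* eq) (ℚᵘ.≃-sym (toι b)))))
    where
    eq : (+ (suc l * b) ℤ.* + 1) ℤ.* + 1 ≡ + b ℤ.* + (1 * suc l)
    eq = trans (ℤ.*-identityʳ _) (trans (ℤ.*-identityʳ _) (trans (cong +_ (trans (*-comm (suc l) b) (cong (b *_) (sym (*-identityˡ (suc l)))))) (ℤ.pos-* b (1 * suc l))))

  average : ∀ l b {s} → s ℚ.≤ ι (suc l * b) → 1ℚ ℚ.+ s ℚ.* (+ 1 / suc l) ℚ.≤ ι (suc b)
  average l b {s} le = ℚ.≤-trans (ℚ.+-monoʳ-≤ 1ℚ (ℚ.*-monoʳ-≤-nonNeg (+ 1 / suc l) {{ℚ.normalize-nonNeg 1 (suc l)}} le))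
     (ℚ.≤-reflexive (trans (cong (1ℚ ℚ.+_) (ι-average l b)) (ι-+ 1 b)))

  module _ {A : Set} where
    _∖_ : ∀ {x : A} ys → x ∈ˡ ys → List A
    (y ∷ ys) ∖ here _  = ys
    (y ∷ ys) ∖ there p = y ∷ (ys ∖ p)

    ∖-length : ∀ {x : A} {ys} (p : x ∈ˡ ys) → suc (length (ys ∖ p)) ≡ length ys
    ∖-length (here _)  = refl
    ∖-length (there p) = cong suc (∖-length p)

    ∖-∈ : ∀ {x z : A} {ys} (p : x ∈ˡ ys) → z ∈ˡ ys → x ≢ z → z ∈ˡ (ys ∖ p)
    ∖-∈ (here refl) (here refl) n = ⊥-elim (n refl)
    ∖-∈ (here _)    (there q)   n = q
    ∖-∈ (there p)   (here e)    n = here e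
    ∖-∈ (there p)   (there q)   n = there (∖-∈ p q n)

    -- Pigeonhole principle; it turns a cover of the outgoing arcs by four vertices into out-degree
    -- at most 4.
    unique-length : ∀ {xs ys : List A} → Unique xs → (∀ {x} → x ∈ˡ xs → x ∈ˡ ys) → length xs ≤ length ys
    unique-length [] f = z≤n
    unique-length {x ∷ xs} {ys} (n ∷ u) f = ≤-trans (s≤s (unique-length u λ q → ∖-∈ (f (here refl)) (f (there q)) (All.lookup n q)))
                                              (≤-reflexive (∖-length (f (here refl))))

    sum-all : ∀ (f : A → ℚ) {b} xs → (∀ {x} → x ∈ˡ xs → f x ℚ.≤ ι b) → sumℚ (List.map f xs) ℚ.≤ ι (length xs * b)
    sum-all f [] g = ℚ.≤-refl
    sum-all f {b} (x ∷ xs) g = ℚ.≤-trans (ℚ.+-mono-≤ (g (here refl)) (sum-all f xs (λ p → g (there p)))) (ℚ.≤-reflexive (ι-+ b (length xs * b)))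

    sum-one : ∀ (f : A → ℚ) {b} xs {y} → y ∈ˡ xs → (∀ {x} → x ∈ˡ xs → f x ℚ.≤ ι (4 + b)) → f y ℚ.≤ ι b →
              ∃[ s ] (sumℚ (List.map f xs) ℚ.≤ ι s × s + 4 ≡ length xs * (4 + b))
    sum-one f {b} (x ∷ xs) (here refl) g h = b + length xs * (4 + b) ,
        ℚ.≤-trans (ℚ.+-mono-≤ h (sum-all f xs (λ p → g (there p)))) (ℚ.≤-reflexive (ι-+ b _)) ,
        trans (+-comm (b + length xs * (4 + b)) 4) refl
    sum-one f {b} (x ∷ xs) (there p) g h with sum-one f xs p (λ q → g (there q)) h
    ... | s , le , e = 4 + b + s , ℚ.≤-trans (ℚ.+-mono-≤ (g (here refl)) le) (ℚ.≤-reflexive (ι-+ (4 + b) s)) ,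
        trans (+-assoc (4 + b) s 4) (cong (λ z → 4 + b + z) e)

  allSubsets-complete : ∀ n (s : Subset n) → s ∈ˡ allSubsets n
  allSubsets-complete zero []ᵛ = here refl
  allSubsets-complete (suc n) (true ∷ᵛ s) = ∈-++⁺ˡ (∈-map⁺ (inside ∷ᵛ_) (allSubsets-complete n s))
  allSubsets-complete (suc n) (false ∷ᵛ s) = ∈-++⁺ʳ _ (∈-map⁺ (outside ∷ᵛ_) (allSubsets-complete n s))

  allSubsets-unique : ∀ n → Unique (allSubsets n)
  allSubsets-unique zero = [] ∷ []
  allSubsets-unique (suc n) = Unique.++⁺ (Unique.map⁺ (λ { refl → refl }) (allSubsets-unique n)) (Unique.map⁺ (λ { refl → refl }) (allSubsets-unique n))
    λ { (a , b) → disjoint (∈-map⁻ (inside ∷ᵛ_) a) (∈-map⁻ (outside ∷ᵛ_) b) }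
    where
    disjoint : ∀ {s : Subset (suc n)} → (∃[ x ] (x ∈ˡ allSubsets n × s ≡ inside ∷ᵛ x)) → (∃[ x ] (x ∈ˡ allSubsets n × s ≡ outside ∷ᵛ x)) → ⊥
    disjoint (_ , _ , refl) (_ , _ , ())

  module _ (n : ℕ) (D : Subset n → Subset n → Bool) where
    outs : Subset n → List (Subset n)
    outs v = filter (λ w → D v w Data.Bool.≟ true) (allSubsets n)

    outs⁺ : ∀ {v w} → T (D v w) → w ∈ˡ outs v
    outs⁺ {v} {w} a = ∈-filter⁺ (λ w → D v w Data.Bool.≟ true) (allSubsets-complete n w) (Equivalence.to T-≡ a)

    outs⁻ : ∀ {v w} → w ∈ˡ outs v → T (D v w)
    outs⁻ {v} p = Equivalence.from T-≡ (proj₂ (∈-filter⁻ (λ w → D v w Data.Bool.≟ true) {xs = allSubsets n} p))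

    stepBounds : Bounds (λ v w → T (D v w))
    stepBounds = record
      { B = λ k v a → expSteps n D k v ℚ.≤ ι a
      ; base = λ {v} {a} → ι-mono {0} {a} z≤n
      ; mono = λ {k} {v} {a} {b} le x → ℚ.≤-trans x (ι-mono {a} {b} le)
      ; all = λ {k} {v} {a} → allBound {k} {v} {a}
      ; one = λ {k} {v} {a} → oneBound {k} {v} {a} }
      where
      allBound : ∀ {k v a} → (∀ w → T (D v w) → expSteps n D k w ℚ.≤ ι a) → expSteps n D (suc k) v ℚ.≤ ι (suc a)
      allBound {k} {v} {a} f with outs v | (λ {w} → outs⁻ {v} {w})
      ... | [] | _ = ι-mono {0} {suc a} z≤n
      ... | x ∷ xs | g = average (length xs) a (sum-all (expSteps n D k) {a} (x ∷ xs) (λ p → f _ (g p)))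
      -- With l arcs the successors sum to at most l (4 + a) - 4, which is at most l (3 + a) because
      -- l is at most 4; the step itself restores the missing 1.
      oneBound : ∀ {k v a} {x₁ x₂ x₃ x₄ : Subset n} →
             (∀ w → T (D v w) → (w ≡ x₁ ⊎ w ≡ x₂) ⊎ (w ≡ x₃ ⊎ w ≡ x₄)) →
             (∀ w → T (D v w) → expSteps n D k w ℚ.≤ ι (4 + a)) → ∀ {w₀} → T (D v w₀) → expSteps n D k w₀ ℚ.≤ ι a →
             expSteps n D (suc k) v ℚ.≤ ι (4 + a)
      oneBound {k} {v} {a} {x₁} {x₂} {x₃} {x₄} cover f {w₀} a₀ b₀
        with outs v | (λ {w} → outs⁻ {v} {w}) | outs⁺ a₀ | Unique.filter⁺ (λ w → D v w Data.Bool.≟ true) (allSubsets-unique n)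
      ... | x ∷ xs | g | p | u with sum-one (expSteps n D k) {a} (x ∷ xs) p (λ q → f _ (g q)) b₀
      ...   | s , le , e = average (length xs) (3 + a) (ℚ.≤-trans le (ι-mono {s} {suc (length xs) * (3 + a)} (+-cancelʳ-≤ 4 s (suc (length xs) * (3 + a)) (≤-trans (≤-reflexive e)
                (≤-trans (≤-reflexive (eq (suc (length xs)) a)) (+-monoʳ-≤ (suc (length xs) * (3 + a)) len))))))
        where
        len : length (x ∷ xs) ≤ 4
        len = unique-length {ys = x₁ ∷ x₂ ∷ x₃ ∷ x₄ ∷ []} u λ {w} q →
          [ [ (λ e → here e) , (λ e → there (here e)) ]′ , [ (λ e → there (there (here e))) , (λ e → there (there (there (here e)))) ]′ ]′ (cover w (g q))
        eq : ∀ l a → l * (4 + a) ≡ l * (3 + a) + l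
        eq = solve 2 (λ l a → l :* (con 4 :+ a) := l :* (con 3 :+ a) :+ l) refl

-- A height function from acyclicity.

module Reachability where
  open import Data.Bool using (Bool; true; false; T; _∨_; _∧_; if_then_else_)
  open import Data.Bool.Properties using (T-∨; T-∧)
  open import Data.Unit using (tt)
  open import Data.List using (List; []; _∷_)
  open import Data.List.Membership.Propositional using () renaming (_∈_ to _∈ˡ_)
  open import Data.List.Relation.Unary.Any using (here; there)
  open import Function.Bundles using (Equivalence)

  module Closure {A : Set} (D : A → A → Bool) where
    -- paths whose intermediate vertices belong to the list
    reach : List A → A → A → Bool
    reach []       u v = D u v
    reach (x ∷ xs) u v = reach xs u v ∨ (reach xs u x ∧ reach xs x v)

    module _ {x : A} {xs : List A} {u v : A} where
      split : T (reach (x ∷ xs) u v) → T (reach xs u v) ⊎ (T (reach xs u x) × T (reach xs x v))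
      split r with Equivalence.to (T-∨ {reach xs u v}) r
      ... | inj₁ a = inj₁ a
      ... | inj₂ b = inj₂ (Equivalence.to (T-∧ {reach xs u x}) b)
      direct : T (reach xs u v) → T (reach (x ∷ xs) u v)
      direct a = Equivalence.from (T-∨ {reach xs u v}) (inj₁ a)
      via : T (reach xs u x) → T (reach xs x v) → T (reach (x ∷ xs) u v)
      via a b = Equivalence.from (T-∨ {reach xs u v}) (inj₂ (Equivalence.from (T-∧ {reach xs u x}) (a , b)))

    edge : ∀ xs {u v} → T (D u v) → T (reach xs u v)
    edge []       a = a
    edge (x ∷ xs) {u} {v} a = direct {x} {xs} {u} {v} (edge xs a)

    -- If both halves pass through the head of the list, the detour from it to x and back is cut
    -- out.
    join : ∀ {xs x u v} → x ∈ˡ xs → T (reach xs u x) → T (reach xs x v) → T (reach xs u v)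
    join {y ∷ ys} {.y} {u} {v} (here refl) a b = via {y} {ys} {u} {v}
      ([ (λ z → z) , (λ (z , _) → z) ]′ (split {y} {ys} {u} {y} a)) ([ (λ z → z) , (λ (_ , z) → z) ]′ (split {y} {ys} {y} {v} b))
    join {y ∷ ys} {x} {u} {v} (there p) a b with split {y} {ys} {u} {x} a | split {y} {ys} {x} {v} b
    ... | inj₁ ux        | inj₁ xv        = direct {y} {ys} {u} {v} (join p ux xv)
    ... | inj₁ ux        | inj₂ (xy , yv) = via {y} {ys} {u} {v} (join p ux xy) yv
    ... | inj₂ (uy , yx) | inj₁ xv        = via {y} {ys} {u} {v} uy (join p yx xv)
    ... | inj₂ (uy , _)  | inj₂ (_ , yv)  = via {y} {ys} {u} {v} uy yv

    sound : ∀ {R : A → A → Set} → (∀ {u v} → T (D u v) → R u v) → (∀ {u v w} → R u v → R v w → R u w) →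
            ∀ xs {u v} → T (reach xs u v) → R u v
    sound e t [] a = e a
    sound e t (x ∷ xs) {u} {v} a = [ sound e t xs , (λ (b , c) → t (sound e t xs b) (sound e t xs c)) ]′ (split {x} {xs} {u} {v} a)

    count : (A → Bool) → List A → ℕ
    count P []       = 0
    count P (x ∷ xs) = (if P x then 1 else 0) + count P xs

    private
      one : ∀ b c → (T b → T c) → (if b then 1 else 0) ≤ (if c then 1 else 0)
      one false c f = z≤n
      one true true f = ≤-refl
      one true false f = ⊥-elim (f tt)
      less : ∀ b c → ¬ T b → T c → (if b then 1 else 0) < (if c then 1 else 0)
      less false true f g = ≤-refl
      less true c f g = ⊥-elim (f tt)

    count-≤ : ∀ {P Q} xs → (∀ {x} → T (P x) → T (Q x)) → count P xs ≤ count Q xs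
    count-≤ [] f = z≤n
    count-≤ {P} {Q} (x ∷ xs) f = +-mono-≤ (one (P x) (Q x) f) (count-≤ xs f)

    count-< : ∀ {P Q} {x xs} → x ∈ˡ xs → (∀ {x} → T (P x) → T (Q x)) → ¬ T (P x) → T (Q x) → count P xs < count Q xs
    count-< {P} {Q} {x} {_ ∷ xs} (here refl) f a b = +-mono-<-≤ (less (P x) (Q x) a b) (count-≤ xs f)
    count-< {P} {Q} {x} {y ∷ xs} (there p) f a b = +-mono-≤-< (one (P y) (Q y) f) (count-< p f a b)

    rank : List A → A → ℕ
    rank xs v = count (reach xs v) xs

    -- Whatever w reaches is also reached by v, and w itself is reached by v but, by acyclicity, not
    -- by w.
    rank-< : ∀ {xs} → (∀ x → x ∈ˡ xs) → (∀ v → ¬ T (reach xs v v)) → ∀ {v w} → T (D v w) → rank xs w < rank xs v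
    rank-< {xs} complete acyclic {v} {w} a = count-< (complete w) (λ r → join (complete w) (edge xs a) r) (acyclic w) (edge xs a)

-- Closed sequences with a single local minimum.

module CycleSeq where
  open Wedges using (≢⇒<⊎>)

  argmin : ∀ (f : ℕ → ℕ) n → ∃[ k ] (1 ≤ k × k ≤ suc n × (∀ {j} → 1 ≤ j → j ≤ suc n → f k ≤ f j))
  argmin f zero = 1 , ≤-refl , ≤-refl , λ { {suc zero} a b → ≤-refl ; {suc (suc j)} a (s≤s ()) }
  argmin f (suc n) with argmin f n
  ... | k , a , b , g with f (suc (suc n)) <? f k
  ...   | yes l = suc (suc n) , s≤s z≤n , ≤-refl , λ {j} c d → [ (λ x → ≤-trans (<⇒≤ l) (g c (≤-pred x))) , (λ { refl → ≤-refl }) ]′ (m≤n⇒m<n∨m≡n d)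
  ...   | no l = k , a , ≤-trans b (n≤1+n _) , λ {j} c d → [ (λ x → g c (≤-pred x)) , (λ { refl → ≮⇒≥ l }) ]′ (m≤n⇒m<n∨m≡n d)

  -- A closed sequence f 1 , … , f m , f (m + 1) = f 1 with distinct neighbours and one local minimum.
  module Unimodal {m : ℕ} (3≤m : 3 ≤ m) (f : ℕ → ℕ) (closed : f 1 ≡ f (suc m))
                  (edge : ∀ {i} → 1 ≤ i → i < suc m → f i ≢ f (suc i)) where
    K : ℕ
    K = suc m

    -- Position `suc m` repeats position 1, whose neighbours are therefore 2 and m.
    data MinAt : ℕ → Set where
      first : f 1 < f 2 → f 1 < f m → MinAt 1
      inner : ∀ {c} → 1 ≤ c → suc c < K → f (suc c) < f c → f (suc c) < f (2 + c) → MinAt (suc c)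

    module _ (unique : ∀ {c d} → MinAt c → MinAt d → c ≡ d) where
      private
        2≤m = ≤-trans (n≤1+n 2) 3≤m

        least : ∃[ s ] (1 ≤ s × s ≤ m × (∀ {j} → 1 ≤ j → j ≤ K → f s ≤ f j))
        least = go 3≤m closed
          where
          go : ∀ {m} → 3 ≤ m → f 1 ≡ f (suc m) → ∃[ s ] (1 ≤ s × s ≤ m × (∀ {j} → 1 ≤ j → j ≤ suc m → f s ≤ f j))
          go {suc m′} _ cl with argmin f m′
          ... | s , a , b , g = s , a , b , λ {j} c d →
                [ (λ x → g c (≤-pred x)) , (λ { refl → ≤-trans (g ≤-refl (s≤s z≤n)) (≤-reflexive cl) }) ]′ (m≤n⇒m<n∨m≡n d)

        s = proj₁ least
        1≤s = proj₁ (proj₂ least)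
        s≤m = proj₁ (proj₂ (proj₂ least))
        s≤ : ∀ {j} → 1 ≤ j → j ≤ K → f s ≤ f j
        s≤ = proj₂ (proj₂ (proj₂ least))

        min-s : MinAt s
        min-s = go s s≤ 1≤s s≤m
          where
          go : ∀ c → (∀ {j} → 1 ≤ j → j ≤ K → f c ≤ f j) → 1 ≤ c → c ≤ m → MinAt c
          go (suc zero) le a b = first (≤∧≢⇒< (le (s≤s z≤n) (≤-trans 2≤m (n≤1+n m))) (edge ≤-refl (s≤s (≤-trans (s≤s z≤n) 3≤m))))
            (≤∧≢⇒< (le (≤-trans (s≤s z≤n) 3≤m) (n≤1+n m)) (λ e → edge {m} (≤-trans (s≤s z≤n) 3≤m) ≤-refl (trans (sym e) closed)))
          go (suc (suc c)) le a b = inner (s≤s z≤n) (s≤s b) (≤∧≢⇒< (le (s≤s z≤n) (≤-trans (n≤1+n _) (≤-trans b (n≤1+n m)))) (λ e → edge {suc c} (s≤s z≤n) (≤-trans b (n≤1+n m)) (sym e)))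
            (≤∧≢⇒< (le (s≤s z≤n) (s≤s b)) (edge (s≤s z≤n) (s≤s b)))

      pit : ∀ {i} → 1 ≤ i → suc i < K → f (suc i) < f i → f (suc i) < f (2 + i) → ∀ {k} → 1 ≤ k → k ≤ K → f (suc i) ≤ f k
      pit a b c d {k} u v = subst (λ z → f z ≤ f k) (unique min-s (inner a b c d)) (s≤ u v)

      pit₁ : f 1 < f 2 → f 1 < f m → ∀ {k} → 1 ≤ k → k ≤ K → f 1 ≤ f k
      pit₁ c d {k} u v = subst (λ z → f z ≤ f k) (unique min-s (first c d)) (s≤ u v)

      private
        lower : ∀ {a b} → (∀ {z} → a ≤ z → z < b → f (suc z) < f z) → ∀ {z} → a ≤ z → z ≤ b → f z ≤ f a
        lower {a} {b} g {z} x y = subst (λ k → f k ≤ f a) (m∸n+n≡m x) (go (z ∸ a) (≤-trans (≤-reflexive (m∸n+n≡m x)) y))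
          where
          go : ∀ d → d + a ≤ b → f (d + a) ≤ f a
          go zero _ = ≤-refl
          go (suc d) l = ≤-trans (<⇒≤ (g (m≤n+m a d) l)) (go d (<⇒≤ l))

        higher : ∀ {a b} → (∀ {z} → a ≤ z → z < b → f z < f (suc z)) → ∀ d {z} → a ≤ z → d + z ≡ b → f z ≤ f b
        higher g zero x refl = ≤-refl
        higher g (suc d) {z} x refl = ≤-trans (<⇒≤ (g x (s≤s (m≤n+m z d)))) (higher g d (≤-trans x (n≤1+n z)) (+-suc d z))

        -- A turn away from the position s of the least value would be a second local minimum, so a
        -- fall continues.
        falls : ∀ {x y} → 1 ≤ x → y ≤ K → (∀ {c} → x < c → c < y → s ≢ c) → f (suc x) < f x →
                ∀ {z} → x ≤ z → z < y → f (suc z) < f z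
        falls {x} {y} 1≤x y≤K n l {z} p q = subst (λ k → f (suc k) < f k) (m∸n+n≡m p) (go (z ∸ x) (≤-trans (≤-reflexive (cong suc (m∸n+n≡m p))) q))
          where
          go : ∀ d → d + x < y → f (suc (d + x)) < f (d + x)
          go zero _ = l
          go (suc d) b with ≢⇒<⊎> (edge {suc (d + x)} (s≤s z≤n) (<-≤-trans b y≤K))
          ... | inj₂ g = g
          ... | inj₁ g = ⊥-elim (n (s≤s (m≤n+m x d)) b (unique min-s (inner (≤-trans 1≤x (m≤n+m x d)) (<-≤-trans b y≤K) (go d (<-trans ≤-refl b)) g)))

        rises : ∀ {x y} → 1 ≤ x → suc y ≤ K → (∀ {c} → x < c → c < suc y → s ≢ c) → f y < f (suc y) →
                ∀ d {z} → x ≤ z → d + z ≡ y → f z < f (suc z)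
        rises 1≤x y<K n l zero p refl = l
        rises {x} 1≤x y<K n l (suc d) {z} p refl with ≢⇒<⊎> (edge {z} (≤-trans 1≤x p) (<-≤-trans (s≤s (m≤n+m z (suc d))) y<K))
        ... | inj₁ g = g
        ... | inj₂ g = ⊥-elim (n (s≤s p) (s≤s (s≤s (m≤n+m z d))) (unique min-s (inner (≤-trans 1≤x p) (≤-trans (s≤s (s≤s (m≤n+m z d))) y<K) g
                         (rises 1≤x y<K n l d (≤-trans p (n≤1+n z)) (+-suc d z)))))

        reach : ∀ {x y} → 1 ≤ x → suc y ≤ K → (∀ {c} → x < c → c < suc y → s ≢ c) → f y < f (suc y) →
                ∀ {z} → x ≤ z → z ≤ suc y → f z ≤ f (suc y)
        reach {x} {y} 1≤x y<K n l {z} p q = higher {x} {suc y} (λ {w} u v → rises 1≤x y<K n l (y ∸ w) u (m∸n+n≡m (≤-pred v))) (suc y ∸ z) p (m∸n+n≡m q)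

        1≤m = ≤-trans (s≤s z≤n) 3≤m
        s≤K = ≤-trans s≤m (n≤1+n m)

      peak₁ : f 2 < f 1 → f m < f 1 → ∀ {k} → 1 ≤ k → k ≤ K → f k ≤ f 1
      peak₁ l r {k} a b with k ≤? s
      ... | yes c = lower (falls ≤-refl s≤K (λ u v e → <-irrefl (sym e) v) l) a c
      ... | no c = ≤-trans (reach 1≤s ≤-refl (λ u v e → <-irrefl e u) (<-≤-trans r (≤-reflexive closed)) (<⇒≤ (≰⇒> c)) b) (≤-reflexive (sym closed))

      -- From a peak the sequence falls both ways around to s. The cases only say where k and the
      -- seam between `suc m` and 1 lie on this way.
      peak : ∀ {i} → 1 ≤ i → suc i < K → f i < f (suc i) → f (2 + i) < f (suc i) → ∀ {k} → 1 ≤ k → k ≤ K → f k ≤ f (suc i)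
      peak {i} 1≤i t<K l r {k} a b with <-cmp s (suc i)
      ... | tri≈ _ e _ = ⊥-elim (<⇒≱ l (subst (λ z → f z ≤ f i) e (s≤ 1≤i (≤-trans (n≤1+n i) (<⇒≤ t<K)))))
      ... | tri< s<t _ _ = go (k ≤? suc i) (s ≤? k)
        where
        t = suc i
        steps : ∀ {z} → t ≤ z → z < K → f (suc z) < f z
        steps = falls (s≤s z≤n) ≤-refl (λ u v e → <-asym s<t (<-≤-trans u (≤-reflexive (sym e)))) r
        go : Dec (k ≤ t) → Dec (s ≤ k) → f k ≤ f t
        go (yes c) (yes d) = reach 1≤s (<⇒≤ t<K) (λ u v e → <-irrefl e u) l d c
        go (no c) _ = lower steps (<⇒≤ (≰⇒> c)) b
        go (yes c) (no d) = ≤-trans (lower (falls ≤-refl s≤K (λ u v e → <-irrefl (sym e) v) start) a (<⇒≤ (≰⇒> d)))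
                              (≤-trans (≤-reflexive closed) (lower steps (<⇒≤ t<K) ≤-refl))
          where
          start : f 2 < f 1
          start with ≢⇒<⊎> (edge {1} ≤-refl (s≤s 1≤m))
          ... | inj₂ g = g
          ... | inj₁ g = ⊥-elim (<-irrefl (sym (unique min-s (first g (subst (_< f m) (sym closed) (steps (≤-pred t<K) ≤-refl))))) (≤-<-trans a (≰⇒> d)))
      ... | tri> _ _ t<s = go (k ≤? suc i) (k ≤? s)
        where
        t = suc i
        steps : ∀ {z} → 1 ≤ z → z ≤ i → f z < f (suc z)
        steps {z} u v = rises ≤-refl (<⇒≤ t<K) (λ x y e → <-asym t<s (≤-<-trans (≤-reflexive e) y)) l (i ∸ z) u (m∸n+n≡m v)
        go : Dec (k ≤ t) → Dec (k ≤ s) → f k ≤ f t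
        go (yes c) _ = reach ≤-refl (<⇒≤ t<K) (λ x y e → <-asym t<s (≤-<-trans (≤-reflexive e) y)) l a c
        go (no c) (yes d) = lower (falls (s≤s z≤n) s≤K (λ u v e → <-irrefl (sym e) v) r) (<⇒≤ (≰⇒> c)) d
        go (no c) (no d) = ≤-trans (reach 1≤s ≤-refl (λ u v e → <-irrefl e u) start (<⇒≤ (≰⇒> d)) b)
                             (≤-trans (≤-reflexive (sym closed)) (reach ≤-refl (<⇒≤ t<K) (λ x y e → <-asym t<s (≤-<-trans (≤-reflexive e) y)) l ≤-refl (s≤s z≤n)))
          where
          start : f m < f K
          start with ≢⇒<⊎> (edge {m} 1≤m ≤-refl)
          ... | inj₁ g = g
          ... | inj₂ g = ⊥-elim (<-irrefl (unique (first (steps ≤-refl 1≤i) (subst (_< f m) (sym closed) g)) min-s) (≤-<-trans (s≤s z≤n) t<s))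

-- Cyclic indices and four-element sets.

module CyclicSets where
  open import Data.Nat.DivMod using (_%_; m%n<n; [m+n]%n≡m%n; m<n⇒m%n≡m; %-distribˡ-+; m%n%n≡m%n)
  open import Data.Vec using ([]; _∷_)
  open import Data.Bool using (true; false)
  open import Data.Fin using (Fin; toℕ; fromℕ<)
  open import Data.Fin.Properties using (toℕ-fromℕ<; toℕ<n; toℕ-injective)
  open import Data.Fin.Subset using (Subset; _∈_; _∉_; _∩_; _∪_; ⁅_⁆; ∣_∣) renaming (_-_ to _∖∖_)
  open import Data.Fin.Subset.Properties
  open Landscapes using (iter)
  open GaleEvenness using (quad)

  OneOf : ∀ {A : Set} → A → A → A → A → A → Set
  OneOf x a b c d = x ≡ a ⊎ x ≡ b ⊎ x ≡ c ⊎ x ≡ d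

  quad⁻ : ∀ {n} {x : Fin n} a b c d → x ∈ quad a b c d → OneOf x a b c d
  quad⁻ a b c d p with x∈p∪q⁻ ⁅ a ⁆ _ p
  ... | inj₁ u = inj₁ (x∈⁅y⁆⇒x≡y a u)
  ... | inj₂ p with x∈p∪q⁻ ⁅ b ⁆ _ p
  ...   | inj₁ u = inj₂ (inj₁ (x∈⁅y⁆⇒x≡y b u))
  ...   | inj₂ p with x∈p∪q⁻ ⁅ c ⁆ _ p
  ...     | inj₁ u = inj₂ (inj₂ (inj₁ (x∈⁅y⁆⇒x≡y c u)))
  ...     | inj₂ u = inj₂ (inj₂ (inj₂ (x∈⁅y⁆⇒x≡y d u)))

  quad⁺ : ∀ {n} {x : Fin n} a b c d → OneOf x a b c d → x ∈ quad a b c d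
  quad⁺ a b c d (inj₁ refl) = x∈p∪q⁺ (inj₁ (x∈⁅x⁆ a))
  quad⁺ a b c d (inj₂ (inj₁ refl)) = x∈p∪q⁺ {p = ⁅ a ⁆} (inj₂ (x∈p∪q⁺ (inj₁ (x∈⁅x⁆ b))))
  quad⁺ a b c d (inj₂ (inj₂ (inj₁ refl))) = x∈p∪q⁺ {p = ⁅ a ⁆} (inj₂ (x∈p∪q⁺ {p = ⁅ b ⁆} (inj₂ (x∈p∪q⁺ (inj₁ (x∈⁅x⁆ c))))))
  quad⁺ a b c d (inj₂ (inj₂ (inj₂ refl))) = x∈p∪q⁺ {p = ⁅ a ⁆} (inj₂ (x∈p∪q⁺ {p = ⁅ b ⁆} (inj₂ (x∈p∪q⁺ {p = ⁅ c ⁆} (inj₂ (x∈⁅x⁆ d))))))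

  quad-rotate : ∀ {n} (a b c d : Fin n) → quad a b c d ≡ quad d a b c
  quad-rotate a b c d = ⊆-antisym
    (λ p → quad⁺ d a b c (to (quad⁻ a b c d p))) (λ p → quad⁺ a b c d (from (quad⁻ d a b c p)))
    where
    to : ∀ {x} → OneOf x a b c d → OneOf x d a b c
    to (inj₁ e) = inj₂ (inj₁ e)
    to (inj₂ (inj₁ e)) = inj₂ (inj₂ (inj₁ e))
    to (inj₂ (inj₂ (inj₁ e))) = inj₂ (inj₂ (inj₂ e))
    to (inj₂ (inj₂ (inj₂ e))) = inj₁ e
    from : ∀ {x} → OneOf x d a b c → OneOf x a b c d
    from (inj₁ e) = inj₂ (inj₂ (inj₂ e))
    from (inj₂ (inj₁ e)) = inj₁ e
    from (inj₂ (inj₂ (inj₁ e))) = inj₂ (inj₁ e)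
    from (inj₂ (inj₂ (inj₂ e))) = inj₂ (inj₂ (inj₁ e))

  ∣p∪q∣≤ : ∀ {n} (p q : Subset n) → ∣ p ∪ q ∣ ≤ ∣ p ∣ + ∣ q ∣
  ∣p∪q∣≤ [] [] = z≤n
  ∣p∪q∣≤ (true ∷ p) (true ∷ q) = s≤s (≤-trans (∣p∪q∣≤ p q) (+-monoʳ-≤ ∣ p ∣ (n≤1+n ∣ q ∣)))
  ∣p∪q∣≤ (true ∷ p) (false ∷ q) = s≤s (∣p∪q∣≤ p q)
  ∣p∪q∣≤ (false ∷ p) (true ∷ q) = ≤-trans (s≤s (∣p∪q∣≤ p q)) (≤-reflexive (sym (+-suc ∣ p ∣ ∣ q ∣)))
  ∣p∪q∣≤ (false ∷ p) (false ∷ q) = ∣p∪q∣≤ p q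

  ∣quad∣≤4 : ∀ {n} (a b c d : Fin n) → ∣ quad a b c d ∣ ≤ 4
  ∣quad∣≤4 a b c d = ≤-trans (∣p∪q∣≤ ⁅ a ⁆ _) (+-mono-≤ (≤-reflexive (∣⁅x⁆∣≡1 a)) (≤-trans (∣p∪q∣≤ ⁅ b ⁆ _) (+-mono-≤ (≤-reflexive (∣⁅x⁆∣≡1 b))
    (≤-trans (∣p∪q∣≤ ⁅ c ⁆ ⁅ d ⁆) (+-mono-≤ (≤-reflexive (∣⁅x⁆∣≡1 c)) (≤-reflexive (∣⁅x⁆∣≡1 d)))))))

  module _ {n} {v w : Subset n} (∣v∣≤4 : ∣ v ∣ ≤ 4) where
    missing-one : ∀ {x} → x ∈ v → x ∉ w → ∣ v ∩ w ∣ ≤ 3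
    missing-one {x} p q = ≤-pred (≤-trans (≤-<-trans (p⊆q⇒∣p∣≤∣q∣ {p = v ∩ w} {v ∖∖ x}
        (λ z → let a , b = x∈p∩q⁻ v w z in x∈p∧x≢y⇒x∈p-y a λ { refl → q b })) (x∈p⇒∣p-x∣<∣p∣ p)) ∣v∣≤4)

    missing-two : ∀ {x y} → x ∈ v → x ∉ w → y ∈ v → y ∉ w → x ≢ y → ∣ v ∩ w ∣ ≡ 3 → ⊥
    missing-two {x} {y} p q r s n e = <-irrefl e (≤-<-trans (p⊆q⇒∣p∣≤∣q∣ {p = v ∩ w} {(v ∖∖ x) ∖∖ y}
        (λ z → let a , b = x∈p∩q⁻ v w z in x∈p∧x≢y⇒x∈p-y (x∈p∧x≢y⇒x∈p-y a λ { refl → q b }) λ { refl → s b }))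
        (<-≤-trans (x∈p⇒∣p-x∣<∣p∣ (x∈p∧x≢y⇒x∈p-y r (λ z → n (sym z)))) (≤-pred (≤-trans (x∈p⇒∣p-x∣<∣p∣ p) ∣v∣≤4))))

    meet-in-three : ∀ {x a b c} → x ∈ v → x ∉ w → a ∈ v → a ∈ w → b ∈ v → b ∈ w → c ∈ v → c ∈ w →
                    a ≢ b → a ≢ c → b ≢ c → ∣ v ∩ w ∣ ≡ 3
    meet-in-three {a = a} {b} {c} p q av aw bv bw cv cw ab ac bc = ≤-antisym (missing-one p q)
      (≤-trans (s≤s (≤-trans (s≤s (≤-trans (s≤s z≤n) (x∈p⇒∣p-x∣<∣p∣ c∈)))  (x∈p⇒∣p-x∣<∣p∣ b∈))) (x∈p⇒∣p-x∣<∣p∣ a∈))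
      where
      a∈ : a ∈ v ∩ w
      a∈ = x∈p∩q⁺ (av , aw)
      b∈ : b ∈ (v ∩ w) ∖∖ a
      b∈ = x∈p∧x≢y⇒x∈p-y (x∈p∩q⁺ (bv , bw)) (λ z → ab (sym z))
      c∈ : c ∈ ((v ∩ w) ∖∖ a) ∖∖ b
      c∈ = x∈p∧x≢y⇒x∈p-y (x∈p∧x≢y⇒x∈p-y (x∈p∩q⁺ (cv , cw)) (λ z → ac (sym z))) (λ z → bc (sym z))

  module Cyclic (m : ℕ) (3≤m : 3 ≤ m) where
    N K : ℕ
    N = suc (suc m)
    K = suc m

    e : ℕ → Fin N
    e a = fromℕ< (m%n<n a N)

    toℕ-e : ∀ a → toℕ (e a) ≡ a % N
    toℕ-e a = toℕ-fromℕ< (m%n<n a N)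

    e-cong : ∀ {a b} → a % N ≡ b % N → e a ≡ e b
    e-cong {a} {b} x = toℕ-injective (trans (toℕ-e a) (trans x (sym (toℕ-e b))))

    e-toℕ : ∀ p → e (toℕ p) ≡ p
    e-toℕ p = toℕ-injective (trans (toℕ-e (toℕ p)) (m<n⇒m%n≡m (toℕ<n p)))

    toℕ-e-< : ∀ {a} → a < N → toℕ (e a) ≡ a
    toℕ-e-< {a} l = trans (toℕ-e a) (m<n⇒m%n≡m l)

    e-period : ∀ a → e (a + N) ≡ e a
    e-period a = e-cong {a + N} {a} ([m+n]%n≡m%n a N)

    e-% : ∀ a k → e (a % N + k) ≡ e (a + k)
    e-% a k = e-cong {a % N + k} {a + k} (trans (%-distribˡ-+ (a % N) k N) (trans (cong (λ z → (z + k % N) % N) (m%n%n≡m%n a N)) (sym (%-distribˡ-+ a k N))))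

    nx pv : Fin N → Fin N
    nx p = e (toℕ p + 1)
    pv p = e (toℕ p + K)

    nx-e : ∀ a → nx (e a) ≡ e (suc a)
    nx-e a = trans (cong (λ z → e (z + 1)) (toℕ-e a)) (trans (e-% a 1) (cong e (+-comm a 1)))

    nx-pv : ∀ p → nx (pv p) ≡ p
    nx-pv p = trans (nx-e (toℕ p + K)) (trans (cong e (sym (+-suc (toℕ p) K))) (trans (e-period (toℕ p)) (e-toℕ p)))

    pv-nx : ∀ p → pv (nx p) ≡ p
    pv-nx p = trans (cong (λ z → e (z + K)) (toℕ-e (toℕ p + 1))) (trans (e-% (toℕ p + 1) K) (trans (cong e (+-assoc (toℕ p) 1 K)) (trans (e-period (toℕ p)) (e-toℕ p))))

    infixl 6 _⊕_
    _⊕_ : Fin N → ℕ → Fin N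
    p ⊕ i = iter nx i p

    e-⊕ : ∀ a i → e a ⊕ i ≡ e (a + i)
    e-⊕ a zero = cong e (sym (+-identityʳ a))
    e-⊕ a (suc i) = trans (cong nx (e-⊕ a i)) (trans (nx-e (a + i)) (cong e (sym (+-suc a i))))

    ⊕-e : ∀ p i → p ⊕ i ≡ e (toℕ p + i)
    ⊕-e p i = trans (cong (_⊕ i) (sym (e-toℕ p))) (e-⊕ (toℕ p) i)

    cycle : ∀ p → p ⊕ N ≡ p
    cycle p = trans (⊕-e p N) (trans (e-period (toℕ p)) (e-toℕ p))

    -- Advancing by N - p takes `p ⊕ i` to the residue of i itself.
    ⊕-injective : ∀ p {i j} → i < N → j < N → p ⊕ i ≡ p ⊕ j → i ≡ j
    ⊕-injective p {i} {j} a b x = trans (sym (toℕ-e-< a)) (trans (cong toℕ (trans (sym (undo i)) (trans (cong (_⊕ (N ∸ toℕ p)) x) (undo j)))) (toℕ-e-< b))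
      where
      undo : ∀ i → p ⊕ i ⊕ (N ∸ toℕ p) ≡ e i
      undo i = trans (cong (_⊕ (N ∸ toℕ p)) (⊕-e p i)) (trans (e-⊕ (toℕ p + i) (N ∸ toℕ p))
        (trans (cong e (trans (cong (_+ (N ∸ toℕ p)) (+-comm (toℕ p) i)) (trans (+-assoc i (toℕ p) _) (cong (i +_) (m+[n∸m]≡n (<⇒≤ (toℕ<n p))))))) (e-period i)))

    connected : ∀ p k → ∃[ i ] (i ≤ K × p ⊕ i ≡ k)
    connected p k = A % N , ≤-pred (m%n<n A N) ,
      trans (⊕-e p (A % N)) (trans (cong e (+-comm (toℕ p) (A % N))) (trans (e-% A (toℕ p))
        (trans (cong e (trans (+-assoc (toℕ k) (N ∸ toℕ p) (toℕ p)) (cong (toℕ k +_) (m∸n+n≡m (<⇒≤ (toℕ<n p)))))) (trans (e-period (toℕ k)) (e-toℕ k)))))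
      where
      A = toℕ k + (N ∸ toℕ p)

    ⊕-+ : ∀ p i j → p ⊕ i ⊕ j ≡ p ⊕ (i + j)
    ⊕-+ p i zero    = cong (p ⊕_) (sym (+-identityʳ i))
    ⊕-+ p i (suc j) = trans (cong nx (⊕-+ p i j)) (cong (p ⊕_) (sym (+-suc i j)))

    ⊕-back : ∀ p {i j} → i + j ≡ N → p ⊕ i ⊕ j ≡ p
    ⊕-back p {i} {j} x = trans (⊕-+ p i j) (trans (cong (p ⊕_) x) (cycle p))

    -- the vertices of the polar, as facets of the cyclic polytope
    cross : Fin N → Fin N → Subset N
    cross p q = quad p (nx p) q (nx q)

    cross-comm : ∀ p q → cross p q ≡ cross q p
    cross-comm p q = trans (quad-rotate p (nx p) q (nx q)) (quad-rotate (nx q) p (nx p) q)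

    at : Fin N → ℕ → ℕ → ℕ → ℕ → Subset N
    at p a b c d = quad (p ⊕ a) (p ⊕ b) (p ⊕ c) (p ⊕ d)

    at⁻ : ∀ p {x a b c d} → x < N → a < N → b < N → c < N → d < N → p ⊕ x ∈ at p a b c d → OneOf x a b c d
    at⁻ p {x} {a} {b} {c} {d} x< a< b< c< d< z with quad⁻ (p ⊕ a) (p ⊕ b) (p ⊕ c) (p ⊕ d) z
    ... | inj₁ u = inj₁ (⊕-injective p x< a< u)
    ... | inj₂ (inj₁ u) = inj₂ (inj₁ (⊕-injective p x< b< u))
    ... | inj₂ (inj₂ (inj₁ u)) = inj₂ (inj₂ (inj₁ (⊕-injective p x< c< u)))
    ... | inj₂ (inj₂ (inj₂ u)) = inj₂ (inj₂ (inj₂ (⊕-injective p x< d< u)))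

-- Facets as crossings of two cyclic pairs.

module Facets where
  open import Data.Fin using (toℕ)
  open import Data.Fin.Properties using (toℕ<n)
  open CyclicSets
  open GaleEvenness using (quad; Facet; facet)

  module Evenness (m : ℕ) (3≤m : 3 ≤ m) where
    open Cyclic m 3≤m

    private
      -- For y = K the second pair wraps around to {K, 0}; sorting the four indices then gives the
      -- second shape of evenness. The last hypothesis keeps this pair disjoint from {x, x + 1}.
      ordered : ∀ x y → 2 + x ≤ y → y < N → (x ≡ 0 → y ≡ K → ⊥) → Facet N (cross (e x) (e y))
      ordered x y x<y y<N ne with y ≟ K
      ... | no y≢K = subst (Facet N) (sym (cong₂ (λ s t → quad (e x) s (e y) t) (nx-e x) (nx-e y)))
            (facet {a = e x} {e (suc x)} {e y} {e (suc y)} lt₁ lt₂ lt₃ refl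
              (inj₁ (trans (toℕ-e-< sx<N) (cong suc (sym (toℕ-e-< x<N))) , trans (toℕ-e-< sy<N) (cong suc (sym (toℕ-e-< y<N))))))
        where
        x<N = ≤-<-trans (≤-trans (≤-trans (n≤1+n x) (n≤1+n _)) x<y) y<N
        sx<N = ≤-<-trans (≤-trans (n≤1+n _) x<y) y<N
        sy<N : suc y < N
        sy<N = s≤s (≤∧≢⇒< (≤-pred y<N) y≢K)
        lt₁ = subst₂ _<_ (sym (toℕ-e-< x<N)) (sym (toℕ-e-< sx<N)) ≤-refl
        lt₂ = subst₂ _<_ (sym (toℕ-e-< sx<N)) (sym (toℕ-e-< y<N)) x<y
        lt₃ = subst₂ _<_ (sym (toℕ-e-< y<N)) (sym (toℕ-e-< sy<N)) ≤-refl
      ... | yes refl = subst (Facet N)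
            (sym (trans (cong₂ (λ s t → quad (e x) s (e K) t) (nx-e x) (trans (nx-e K) (e-period 0))) (quad-rotate (e x) (e (suc x)) (e K) (e 0))))
            (facet {a = e 0} {e x} {e (suc x)} {e K} lt₁ lt₂ lt₃ refl
              (inj₂ (toℕ-e-< {0} (s≤s z≤n) , trans (toℕ-e-< sx<N) (cong suc (sym (toℕ-e-< x<N))) , cong suc (toℕ-e-< y<N))))
        where
        x<N = ≤-<-trans (≤-trans (≤-trans (n≤1+n x) (n≤1+n _)) x<y) y<N
        sx<N = ≤-<-trans (≤-trans (n≤1+n _) x<y) y<N
        0<x : ∀ {x} → (x ≡ 0 → K ≡ K → ⊥) → 0 < x
        0<x {zero} f = ⊥-elim (f refl refl)
        0<x {suc x} f = s≤s z≤n
        lt₁ = subst (0 <_) (sym (toℕ-e-< x<N)) (0<x ne)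
        lt₂ = subst₂ _<_ (sym (toℕ-e-< x<N)) (sym (toℕ-e-< sx<N)) ≤-refl
        lt₃ = subst₂ _<_ (sym (toℕ-e-< sx<N)) (sym (toℕ-e-< y<N)) x<y

    cross-facet : ∀ p {i} → 2 ≤ i → i ≤ m → Facet N (cross p (p ⊕ i))
    cross-facet p {i} 2≤i i≤m with toℕ p + i <? N
    ... | yes l = subst (Facet N) (cong₂ cross (e-toℕ p) (sym (⊕-e p i)))
          (ordered (toℕ p) (toℕ p + i) (≤-trans (≤-reflexive (+-comm 2 (toℕ p))) (+-monoʳ-≤ (toℕ p) 2≤i)) l
            λ a b → <-irrefl (trans (cong (_+ i) (sym a)) b) (s≤s i≤m))
    ... | no g = subst (Facet N) (trans (cong₂ cross (trans (sym x≡) (sym (⊕-e p i))) (e-toℕ p)) (cross-comm (p ⊕ i) p))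
          (ordered x (toℕ p) (+-cancelʳ-≤ m (2 + x) (toℕ p) (≤-trans (≤-reflexive (trans (sym eqN) x+N)) (+-monoʳ-≤ (toℕ p) i≤m)))
            (toℕ<n p) λ a b → <-irrefl (trans (cong (_+ N) (sym a)) (trans x+N (cong (_+ i) b))) (≤-trans (≤-reflexive (+-comm 2 K)) (+-monoʳ-≤ K 2≤i)))
      where
      x = toℕ p + i ∸ N
      x+N : x + N ≡ toℕ p + i
      x+N = m∸n+n≡m (≮⇒≥ g)
      eqN : x + N ≡ 2 + x + m
      eqN = trans (+-suc x (suc m)) (cong suc (+-suc x m))
      x≡ : e (toℕ p + i) ≡ e x
      x≡ = trans (cong e (sym x+N)) (e-period x)

    facet-cross : ∀ {F} → Facet N F → ∃[ p ] ∃[ i ] (2 ≤ i × i ≤ m × F ≡ cross p (p ⊕ i))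
    facet-cross (facet {a} {b} {c} {d} a<b b<c c<d refl (inj₁ (between₁ , between₃))) =
        a , toℕ c ∸ toℕ a , 2≤ , ≤m , trans (cong₂ (λ s t → quad a s c t) b≡ d≡) (cong (cross a) (sym c≡))
      where
      b≡ : b ≡ nx a
      b≡ = trans (sym (e-toℕ b)) (cong e (trans between₁ (+-comm 1 (toℕ a))))
      d≡ : d ≡ nx c
      d≡ = trans (sym (e-toℕ d)) (cong e (trans between₃ (+-comm 1 (toℕ c))))
      a≤c = <⇒≤ (<-trans a<b b<c)
      c≡ : a ⊕ (toℕ c ∸ toℕ a) ≡ c
      c≡ = trans (⊕-e a _) (trans (cong e (m+[n∸m]≡n a≤c)) (e-toℕ c))
      2≤ : 2 ≤ toℕ c ∸ toℕ a
      2≤ = +-cancelʳ-≤ (toℕ a) 2 _ (≤-trans (≤-trans (≤-reflexive (cong suc (sym between₁))) b<c) (≤-reflexive (sym (m∸n+n≡m a≤c))))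
      ≤m : toℕ c ∸ toℕ a ≤ m
      ≤m = ≤-trans (m∸n≤m (toℕ c) (toℕ a)) (≤-pred (≤-pred (≤-trans (s≤s (≤-reflexive (sym between₃))) (toℕ<n d))))
    facet-cross (facet {a} {b} {c} {d} a<b b<c c<d refl (inj₂ (a≡0 , between₂ , last))) =
        d , suc (toℕ b) , s≤s (≤-trans (s≤s z≤n) a<b) , ≤-pred (≤-trans (≤-trans (≤-reflexive (cong suc (sym between₂))) c<d) (≤-pred (toℕ<n d))) ,
        trans (quad-rotate a b c d) (trans (cong₂ (λ s t → quad d s b t) a≡ c≡) (cong (cross d) (sym b≡)))
      where
      d≡K : toℕ d ≡ K
      d≡K = suc-injective last
      a≡ : a ≡ nx d
      a≡ = trans (sym (e-toℕ a)) (trans (cong e a≡0) (trans (sym (e-period 0)) (cong e (trans (+-comm 1 K) (cong (_+ 1) (sym d≡K))))))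
      c≡ : c ≡ nx b
      c≡ = trans (sym (e-toℕ c)) (cong e (trans between₂ (+-comm 1 (toℕ b))))
      b≡ : d ⊕ suc (toℕ b) ≡ b
      b≡ = trans (⊕-e d (suc (toℕ b))) (trans (cong e (trans (cong (_+ suc (toℕ b)) d≡K) (trans (+-suc K (toℕ b)) (+-comm N (toℕ b))))) (trans (e-period (toℕ b)) (e-toℕ b)))

-- The vertices of a polygon in cyclic order.

module Polygons where
  open import Data.Fin using (Fin)
  open import Data.Fin.Subset using (Subset; _∈_; _∩_; ∣_∣)
  open Reachability
  open CycleSeq
  open GaleEvenness using (quad; Facet)
  open CyclicSets
  open Facets

  module Polar (m : ℕ) (3≤m : 3 ≤ m) where
    open Cyclic m 3≤m
    open Evenness m 3≤m

    V : Set
    V = Subset N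

    private
      1≤m = ≤-trans (s≤s z≤n) 3≤m
      2≤m = ≤-trans (n≤1+n 2) 3≤m
      0<N : 0 < N
      0<N = s≤s z≤n
      1<N : 1 < N
      1<N = s≤s (s≤s z≤n)
      2<N : 2 < N
      2<N = s≤s (s≤s 1≤m)
      K<N : K < N
      K<N = ≤-refl

    corner : Fin N → V
    corner p = cross (pv p) (nx p)

    -- At offsets 1 and K the two pairs overlap and their union has only three elements; the corner
    -- is put in both places.
    pol : Fin N → ℕ → V
    pol p i with i ≟ 1 | i ≟ K
    ... | yes _ | _     = corner p
    ... | no _  | yes _ = corner p
    ... | no _  | no _  = cross p (p ⊕ i)

    pol-K : ∀ p → pol p K ≡ corner p
    pol-K p with K ≟ 1 | K ≟ K
    ... | yes _ | _ = refl
    ... | no _ | yes _ = refl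
    ... | no _ | no ne = ⊥-elim (ne refl)

    pol-mid : ∀ p {i} → 2 ≤ i → i ≤ m → pol p i ≡ cross p (p ⊕ i)
    pol-mid p {i} a b with i ≟ 1 | i ≟ K
    ... | yes refl | _ = ⊥-elim (<-irrefl refl a)
    ... | no _ | yes refl = ⊥-elim (<-irrefl refl b)
    ... | no _ | no _ = refl

    data Position (i : ℕ) : Set where
      end₁ : i ≡ 1 → Position i
      endₖ : i ≡ K → Position i
      mid  : 2 ≤ i → i ≤ m → Position i

    position : ∀ {i} → 1 ≤ i → i ≤ K → Position i
    position {i} a b with i ≟ 1 | i ≟ K
    ... | yes x | _ = end₁ x
    ... | no _ | yes y = endₖ y
    ... | no x | no y = mid (≤∧≢⇒< a (λ z → x (sym z))) (≤-pred (≤∧≢⇒< b y))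

    corner-at : ∀ p → corner p ≡ at p K 0 1 2
    corner-at p = cong₂ (λ s t → quad s t (nx p) (nx (nx p))) (sym pv≡) (nx-pv p)
      where
      pv≡ : p ⊕ K ≡ pv p
      pv≡ = trans (sym (pv-nx (p ⊕ K))) (cong pv (cycle p))

    corner-facet : ∀ p → Facet N (corner p)
    corner-facet p = subst (Facet N) (cong (λ z → cross (pv p) (nx z)) (nx-pv p)) (cross-facet (pv p) {2} ≤-refl 2≤m)

    pol-facet : ∀ {p i} → 1 ≤ i → i ≤ K → Facet N (pol p i)
    pol-facet {p} a b with position a b
    ... | end₁ refl = corner-facet p
    ... | endₖ refl = subst (Facet N) (sym (pol-K p)) (corner-facet p)
    ... | mid c d = subst (Facet N) (sym (pol-mid p c d)) (cross-facet p c d)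

    mid< : ∀ {i} → i ≤ m → suc i < N
    mid< b = s≤s (s≤s b)

    cross⁻ : ∀ p {i x} → i ≤ m → x < N → p ⊕ x ∈ cross p (p ⊕ i) → OneOf x 0 1 i (suc i)
    cross⁻ p {i} b x< z = at⁻ p x< 0<N 1<N (<-trans ≤-refl (mid< b)) (mid< b) z

    corner⁻ : ∀ p {x} → x < N → p ⊕ x ∈ corner p → OneOf x K 0 1 2
    corner⁻ p {x} x< z = at⁻ p x< K<N 0<N 1<N 2<N (subst (p ⊕ x ∈_) (corner-at p) z)

    cross⁺ : ∀ p {i x} → OneOf x 0 1 i (suc i) → p ⊕ x ∈ cross p (p ⊕ i)
    cross⁺ p {i} o = quad⁺ p (nx p) (p ⊕ i) (nx (p ⊕ i)) (go o)
      where
      go : ∀ {x} → OneOf x 0 1 i (suc i) → OneOf (p ⊕ x) p (nx p) (p ⊕ i) (nx (p ⊕ i))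
      go (inj₁ refl) = inj₁ refl
      go (inj₂ (inj₁ refl)) = inj₂ (inj₁ refl)
      go (inj₂ (inj₂ (inj₁ refl))) = inj₂ (inj₂ (inj₁ refl))
      go (inj₂ (inj₂ (inj₂ refl))) = inj₂ (inj₂ (inj₂ refl))

    corner⁺ : ∀ p {x} → OneOf x K 0 1 2 → p ⊕ x ∈ corner p
    corner⁺ p {x} o = subst (p ⊕ x ∈_) (sym (corner-at p)) (quad⁺ (p ⊕ K) p (nx p) (nx (nx p)) (go o))
      where
      go : ∀ {x} → OneOf x K 0 1 2 → OneOf (p ⊕ x) (p ⊕ K) p (nx p) (nx (nx p))
      go (inj₁ refl) = inj₁ refl
      go (inj₂ (inj₁ refl)) = inj₂ (inj₁ refl)
      go (inj₂ (inj₂ (inj₁ refl))) = inj₂ (inj₂ (inj₁ refl))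
      go (inj₂ (inj₂ (inj₂ refl))) = inj₂ (inj₂ (inj₂ refl))

    ⊕≢ : ∀ p {i j} → i < N → j < N → i ≢ j → p ⊕ i ≢ p ⊕ j
    ⊕≢ p a b n z = n (⊕-injective p a b z)

    none : ∀ {x a b c d : ℕ} → x ≢ a → x ≢ b → x ≢ c → x ≢ d → OneOf x a b c d → ⊥
    none a b c d (inj₁ z) = a z
    none a b c d (inj₂ (inj₁ z)) = b z
    none a b c d (inj₂ (inj₂ (inj₁ z))) = c z
    none a b c d (inj₂ (inj₂ (inj₂ z))) = d z

    ∣cross∣≤4 : ∀ p q → ∣ cross p q ∣ ≤ 4
    ∣cross∣≤4 p q = ∣quad∣≤4 p (nx p) q (nx q)

    private
      ridge₁ : ∀ p → ∣ corner p ∩ cross p (p ⊕ 2) ∣ ≡ 3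
      ridge₁ p = meet-in-three (∣cross∣≤4 (pv p) (nx p)) {p ⊕ K} {p ⊕ 0} {p ⊕ 1} {p ⊕ 2} (corner⁺ p (inj₁ refl))
            (λ z → none (λ ()) (>⇒≢ (s≤s 1≤m)) (>⇒≢ (s≤s 2≤m)) (>⇒≢ (s≤s 3≤m)) (cross⁻ p {2} {K} 2≤m K<N z))
            (corner⁺ p (inj₂ (inj₁ refl))) (cross⁺ p {2} (inj₁ refl)) (corner⁺ p (inj₂ (inj₂ (inj₁ refl)))) (cross⁺ p {2} (inj₂ (inj₁ refl)))
            (corner⁺ p (inj₂ (inj₂ (inj₂ refl)))) (cross⁺ p {2} (inj₂ (inj₂ (inj₁ refl))))
            (⊕≢ p 0<N 1<N λ ()) (⊕≢ p 0<N 2<N λ ()) (⊕≢ p 1<N 2<N λ ())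

      ridgeₘ : ∀ p → ∣ cross p (p ⊕ m) ∩ corner p ∣ ≡ 3
      ridgeₘ p = meet-in-three (∣cross∣≤4 p (p ⊕ m)) {p ⊕ m} {p ⊕ 0} {p ⊕ 1} {p ⊕ K} (cross⁺ p {m} (inj₂ (inj₂ (inj₁ refl))))
            (λ z → none (<⇒≢ ≤-refl) (>⇒≢ 1≤m) (>⇒≢ 2≤m) (>⇒≢ 3≤m) (corner⁻ p (<-trans ≤-refl K<N) z))
            (cross⁺ p {m} (inj₁ refl)) (corner⁺ p (inj₂ (inj₁ refl))) (cross⁺ p {m} (inj₂ (inj₁ refl))) (corner⁺ p (inj₂ (inj₂ (inj₁ refl))))
            (cross⁺ p {m} (inj₂ (inj₂ (inj₂ refl)))) (corner⁺ p (inj₁ refl))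
            (⊕≢ p 0<N 1<N λ ()) (⊕≢ p 0<N K<N λ ()) (⊕≢ p 1<N K<N (<⇒≢ (s≤s 1≤m)))

      ridgeᵢ : ∀ p i → 2 ≤ i → suc i ≤ m → ∣ cross p (p ⊕ i) ∩ cross p (p ⊕ suc i) ∣ ≡ 3
      ridgeᵢ p i c d = meet-in-three (∣cross∣≤4 p (p ⊕ i)) {p ⊕ i} {p ⊕ 0} {p ⊕ 1} {p ⊕ suc i} (cross⁺ p {i} (inj₂ (inj₂ (inj₁ refl))))
            (λ z → none (>⇒≢ (<-trans (s≤s z≤n) c)) (>⇒≢ c) (<⇒≢ ≤-refl) (<⇒≢ (n≤1+n (suc i))) (cross⁻ p {suc i} {i} d (<-trans ≤-refl (<-trans ≤-refl (mid< d))) z))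
            (cross⁺ p {i} (inj₁ refl)) (cross⁺ p {suc i} (inj₁ refl)) (cross⁺ p {i} (inj₂ (inj₁ refl))) (cross⁺ p {suc i} (inj₂ (inj₁ refl)))
            (cross⁺ p {i} (inj₂ (inj₂ (inj₂ refl)))) (cross⁺ p {suc i} (inj₂ (inj₂ (inj₁ refl))))
            (⊕≢ p 0<N 1<N λ ()) (⊕≢ p 0<N i< λ ()) (⊕≢ p 1<N i< (<⇒≢ (s≤s (<-trans (s≤s z≤n) c))))
        where
        i< : suc i < N
        i< = <-trans ≤-refl (mid< d)

    ridge : ∀ p {i} → 1 ≤ i → i < K → ∣ pol p i ∩ pol p (suc i) ∣ ≡ 3
    ridge p {i} a b with position a (<⇒≤ b) | i ≟ m
    ... | endₖ refl | _ = ⊥-elim (<-irrefl refl b)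
    ... | end₁ refl | _ = subst (λ w → ∣ corner p ∩ w ∣ ≡ 3) (sym (pol-mid p {2} ≤-refl 2≤m)) (ridge₁ p)
    ... | mid c d | yes refl = subst₂ (λ v w → ∣ v ∩ w ∣ ≡ 3) (sym (pol-mid p c d)) (sym (pol-K p)) (ridgeₘ p)
    ... | mid c d | no i≢m = subst₂ (λ v w → ∣ v ∩ w ∣ ≡ 3) (sym (pol-mid p c d)) (sym (pol-mid p (s≤s a) i<m)) (ridgeᵢ p i c i<m)
      where
      i<m = ≤∧≢⇒< d i≢m

-- Incidence and adjacency.

module Order where
  open import Data.Fin using (Fin)
  open import Data.Fin.Subset using (Subset; _∈_; _⊆_; _∩_; _∪_; ⁅_⁆; ∣_∣)
  open import Data.Fin.Subset.Properties using (x∈p∪q⁺; x∈p∪q⁻; x∈⁅x⁆; x∈⁅y⁆⇒x≡y; ∩-comm)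
  open import Data.Sum.Base using (swap)
  open CycleSeq
  open GaleEvenness using (Facet)
  open CyclicSets
  open Facets

  pair⊆ : ∀ {n} {a b : Fin n} {F} → a ∈ F → b ∈ F → ⁅ a ⁆ ∪ ⁅ b ⁆ ⊆ F
  pair⊆ {a = a} {b} p q z with x∈p∪q⁻ ⁅ a ⁆ ⁅ b ⁆ z
  ... | inj₁ u rewrite x∈⁅y⁆⇒x≡y a u = p
  ... | inj₂ u rewrite x∈⁅y⁆⇒x≡y b u = q

  left : ∀ {n} {a b : Fin n} → a ∈ ⁅ a ⁆ ∪ ⁅ b ⁆
  left {a = a} = x∈p∪q⁺ (inj₁ (x∈⁅x⁆ a))

  right : ∀ {n} {a b : Fin n} → b ∈ ⁅ a ⁆ ∪ ⁅ b ⁆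
  right {a = a} {b} = x∈p∪q⁺ {p = ⁅ a ⁆} (inj₂ (x∈⁅x⁆ b))

  Adjacent : ∀ {n} → Subset n → Subset n → Set
  Adjacent v w = ∣ v ∩ w ∣ ≡ 3

  Adjacent-sym : ∀ {n} {v w : Subset n} → Adjacent v w → Adjacent w v
  Adjacent-sym {v = v} {w} e = trans (cong ∣_∣ (∩-comm w v)) e

  module Geometry (m : ℕ) (3≤m : 3 ≤ m) where
    open Cyclic m 3≤m public
    open Evenness m 3≤m public
    open Polygons.Polar m 3≤m public

    2≤m : 2 ≤ m
    2≤m = ≤-trans (n≤1+n 2) 3≤m
    1≤m : 1 ≤ m
    1≤m = ≤-trans (n≤1+n 1) 2≤m

    cross-turn : ∀ p {i j} → i + j ≡ N → cross p (p ⊕ i) ≡ cross (p ⊕ i) (p ⊕ i ⊕ j)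
    cross-turn p {i} {j} e = trans (cross-comm p (p ⊕ i)) (cong (cross (p ⊕ i)) (sym (⊕-back p {i} {j} e)))

    halves : ∀ r s {x} → x ∈ cross r s → (x ≡ r ⊎ x ≡ nx r) ⊎ (x ≡ s ⊎ x ≡ nx s)
    halves r s z with quad⁻ r (nx r) s (nx s) z
    ... | inj₁ u = inj₁ (inj₁ u)
    ... | inj₂ (inj₁ u) = inj₁ (inj₂ u)
    ... | inj₂ (inj₂ (inj₁ u)) = inj₂ (inj₁ u)
    ... | inj₂ (inj₂ (inj₂ u)) = inj₂ (inj₂ u)

    nx-injective : ∀ {r s} → nx r ≡ nx s → r ≡ s
    nx-injective {r} {s} e = trans (sym (pv-nx r)) (trans (cong pv e) (pv-nx s))

    private
      half : ∀ p r {i} → 2 ≤ i → i ≤ m → p ≡ r ⊎ p ≡ nx r → nx p ∈ cross r (r ⊕ i) →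
             ∃[ l ] (1 ≤ l × l ≤ K × cross r (r ⊕ i) ≡ pol p l)
      half p r {i} a b (inj₁ refl) z = i , <⇒≤ a , ≤-trans b (n≤1+n m) , sym (pol-mid p a b)
      half p r {i} a b (inj₂ refl) z with cross⁻ r {i} {2} b (s≤s (s≤s 1≤m)) z
      ... | inj₁ ()
      ... | inj₂ (inj₁ ())
      ... | inj₂ (inj₂ (inj₁ refl)) = 1 , ≤-refl , s≤s z≤n , cong (λ s → cross s (nx (nx r))) (sym (pv-nx r))
      ... | inj₂ (inj₂ (inj₂ refl)) = ⊥-elim (<-irrefl refl a)

    -- A facet {r, r + 1, s, s + 1} can contain p and p + 1 as one of its pairs, or with p = r + 1
    -- and s = p + 1, which is the corner, or the same with r and s exchanged.
    on-polygon : ∀ p {w} → Facet N w → p ∈ w → nx p ∈ w → ∃[ l ] (1 ≤ l × l ≤ K × w ≡ pol p l)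
    on-polygon p f y z with facet-cross f
    ... | r , i , a , b , refl with halves r (r ⊕ i) y
    ...   | inj₁ u = half p r a b u z
    ...   | inj₂ u = subst (λ w → ∃[ l ] (1 ≤ l × l ≤ K × w ≡ pol p l)) (sym turn)
                       (half p (r ⊕ i) (+-cancelˡ-≤ i 2 (N ∸ i) (≤-trans (≤-reflexive (+-comm i 2)) (≤-trans (s≤s (s≤s b)) (≤-reflexive (sym i+j)))))
                          (+-cancelˡ-≤ i (N ∸ i) m (≤-trans (≤-reflexive i+j) (+-monoˡ-≤ m a))) u (subst (nx p ∈_) turn z))
      where
      i+j : i + (N ∸ i) ≡ N
      i+j = m+[n∸m]≡n (≤-trans b (≤-trans (n≤1+n m) (n≤1+n K)))
      turn = cross-turn r {i} {N ∸ i} i+j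

    near-end : ∀ p {l} → 2 ≤ l → l ≤ m → Adjacent (corner p) (cross p (p ⊕ l)) → l ≡ 2 ⊎ l ≡ m
    near-end p {l} a b e with l ≟ 2 | l ≟ m
    ... | yes x | _ = inj₁ x
    ... | no _ | yes x = inj₂ x
    ... | no x | no y = ⊥-elim (missing-two (∣cross∣≤4 (pv p) (nx p)) {p ⊕ K} {p ⊕ 2}
          (corner⁺ p (inj₁ refl)) (λ z → none (λ ()) (>⇒≢ (s≤s 1≤m)) (>⇒≢ (s≤s b)) (λ e → y (sym (suc-injective e))) (cross⁻ p {l} {K} b ≤-refl z))
          (corner⁺ p (inj₂ (inj₂ (inj₂ refl)))) (λ z → none (λ ()) (λ ()) (λ e → x (sym e)) (<⇒≢ (s≤s a)) (cross⁻ p {l} {2} b (s≤s (s≤s 1≤m)) z))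
          (⊕≢ p ≤-refl (s≤s (s≤s 1≤m)) (>⇒≢ (s≤s 2≤m))) e)

    near-mid : ∀ p {i l} → 2 ≤ i → i ≤ m → 2 ≤ l → l ≤ m → Adjacent (cross p (p ⊕ i)) (cross p (p ⊕ l)) → l ≡ i ⊎ (l ≡ suc i ⊎ suc l ≡ i)
    near-mid p {i} {l} a b c d e with l ≟ i | l ≟ suc i | suc l ≟ i
    ... | yes x | _ | _ = inj₁ x
    ... | no _ | yes x | _ = inj₂ (inj₁ x)
    ... | no _ | no _ | yes x = inj₂ (inj₂ x)
    ... | no x | no y | no z = ⊥-elim (missing-two (∣cross∣≤4 p (p ⊕ i)) {p ⊕ i} {p ⊕ suc i}
          (cross⁺ p {i} (inj₂ (inj₂ (inj₁ refl)))) (λ u → none (>⇒≢ (<-trans (s≤s z≤n) a)) (>⇒≢ a) (λ e → x (sym e)) (λ e → z (sym e)) (cross⁻ p {l} {i} d (<-trans ≤-refl i<) u))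
          (cross⁺ p {i} (inj₂ (inj₂ (inj₂ refl)))) (λ u → none (λ ()) (>⇒≢ (s≤s (<-trans (s≤s z≤n) a))) (λ e → y (sym e)) (λ e → x (sym (suc-injective e))) (cross⁻ p {l} {suc i} d i< u))
          (⊕≢ p (<-trans ≤-refl i<) i< (<⇒≢ ≤-refl)) e)
      where
      i< : suc i < N
      i< = mid< b

    neighbours : ∀ p {i l} → 1 ≤ i → suc i ≤ m → 1 ≤ l → l ≤ K → Adjacent (pol p (suc i)) (pol p l) → pol p l ≢ pol p (suc i) →
                 pol p l ≡ pol p (2 + i) ⊎ pol p l ≡ pol p i
    neighbours p {i} {l} a b c d e ne with position c d
    ... | mid c′ d′ = [ (λ z → ⊥-elim (ne (cong (pol p) z))) , [ (λ z → inj₁ (cong (pol p) z)) , (λ z → inj₂ (cong (pol p) (suc-injective z))) ]′ ]′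
          (near-mid p {suc i} (s≤s a) b c′ d′ (subst₂ Adjacent (pol-mid p (s≤s a) b) (pol-mid p c′ d′) e))
    ... | end₁ refl = swap (ends (near-end p (s≤s a) b (subst (Adjacent (corner p)) (pol-mid p (s≤s a) b) (Adjacent-sym {v = pol p (suc i)} e))))
      where
      ends : suc i ≡ 2 ⊎ suc i ≡ m → corner p ≡ pol p i ⊎ corner p ≡ pol p (2 + i)
      ends (inj₁ refl) = inj₁ refl
      ends (inj₂ refl) = inj₂ (sym (pol-K p))
    ... | endₖ refl = subst (λ w → w ≡ pol p (2 + i) ⊎ w ≡ pol p i) (sym (pol-K p))
          (ends (near-end p (s≤s a) b (subst₂ Adjacent (pol-K p) (pol-mid p (s≤s a) b) (Adjacent-sym {v = pol p (suc i)} e))))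
      where
      ends : suc i ≡ 2 ⊎ suc i ≡ m → corner p ≡ pol p (2 + i) ⊎ corner p ≡ pol p i
      ends (inj₁ refl) = inj₂ refl
      ends (inj₂ refl) = inj₁ (sym (pol-K p))

    neighbours₁ : ∀ p {l} → 1 ≤ l → l ≤ K → Adjacent (pol p 1) (pol p l) → pol p l ≢ pol p 1 → pol p l ≡ pol p 2 ⊎ pol p l ≡ pol p m
    neighbours₁ p {l} c d e ne with position c d
    ... | end₁ refl = ⊥-elim (ne refl)
    ... | endₖ refl = ⊥-elim (ne (pol-K p))
    ... | mid c′ d′ = [ (λ z → inj₁ (cong (pol p) z)) , (λ z → inj₂ (cong (pol p) z)) ]′ (near-end p c′ d′ (subst (Adjacent (corner p)) (pol-mid p c′ d′) e))

    pol-∋ : ∀ p {i} → 1 ≤ i → i ≤ K → p ∈ pol p i × nx p ∈ pol p i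
    pol-∋ p {i} a b with position a b
    ... | end₁ refl = corner⁺ p {0} (inj₂ (inj₁ refl)) , corner⁺ p {1} (inj₂ (inj₂ (inj₁ refl)))
    ... | endₖ refl rewrite pol-K p = corner⁺ p {0} (inj₂ (inj₁ refl)) , corner⁺ p {1} (inj₂ (inj₂ (inj₁ refl)))
    ... | mid c d rewrite pol-mid p c d = cross⁺ p {i} {0} (inj₁ refl) , cross⁺ p {i} {1} (inj₂ (inj₁ refl))

    mid≢corner : ∀ p {i} → 2 ≤ i → i ≤ m → pol p i ≢ pol p 1
    mid≢corner p {i} a b e′ with i ≟ 2
    ... | yes refl = none (λ ()) (>⇒≢ (s≤s 1≤m)) (>⇒≢ (s≤s 2≤m)) (>⇒≢ (s≤s 3≤m))
          (cross⁻ p {2} {K} 2≤m ≤-refl (subst (p ⊕ K ∈_) (trans (sym e′) (pol-mid p a b)) (corner⁺ p (inj₁ refl))))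
    ... | no x = none (λ ()) (λ ()) (λ e → x (sym e)) (<⇒≢ (s≤s a))
          (cross⁻ p {i} {2} b (s≤s (s≤s 1≤m)) (subst (p ⊕ 2 ∈_) (trans (sym e′) (pol-mid p a b)) (corner⁺ p (inj₂ (inj₂ (inj₂ refl))))))

    pol-injective : ∀ p {i j} → 1 ≤ i → i ≤ m → 1 ≤ j → j ≤ m → pol p i ≡ pol p j → i ≡ j
    pol-injective p {i} {j} a b c d e with position a (≤-trans b (n≤1+n m)) | position c (≤-trans d (n≤1+n m))
    ... | endₖ refl | _ = ⊥-elim (<-irrefl refl b)
    ... | _ | endₖ refl = ⊥-elim (<-irrefl refl d)
    ... | end₁ refl | end₁ refl = refl
    ... | mid a′ b′ | end₁ refl = ⊥-elim (mid≢corner p a′ b′ e)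
    ... | end₁ refl | mid c′ d′ = ⊥-elim (mid≢corner p c′ d′ (sym e))
    ... | mid a′ b′ | mid c′ d′ with i ≟ j | i ≟ suc j
    ...   | yes x | _ = x
    ...   | no x | no y = ⊥-elim (none (>⇒≢ a) (>⇒≢ a′) x y (cross⁻ p {j} {i} d (<-trans ≤-refl (mid< b))
            (subst (p ⊕ i ∈_) (trans (sym (pol-mid p a′ b′)) (trans e (pol-mid p c′ d′))) (cross⁺ p {i} (inj₂ (inj₂ (inj₁ refl)))))))
    ...   | no x | yes refl = ⊥-elim (none (λ ()) (λ ()) (>⇒≢ (s≤s (n≤1+n j))) (>⇒≢ ≤-refl) (cross⁻ p {j} {suc i} d (mid< b)
            (subst (p ⊕ suc i ∈_) (trans (sym (pol-mid p a′ b′)) (trans e (pol-mid p c′ d′))) (cross⁺ p {i} (inj₂ (inj₂ (inj₂ refl)))))))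

-- From unique sinks to a landscape.

module Orientation where
  open import Data.Fin using (Fin)
  open import Data.Fin.Properties using (any?)
  open import Data.Fin.Subset using (Subset; _∈_; _∉_; _⊆_; _∪_; ⁅_⁆; ∣_∣)
  open import Data.Fin.Subset.Properties using (_∈?_)
  open Landscapes using (Landscape)
  open CycleSeq
  open GaleEvenness using (Facet)
  open CyclicSets
  open Facets
  open Order

  module _ (m : ℕ) (3≤m : 3 ≤ m) where
    open Geometry m 3≤m

    module Ordered (h : V → ℕ) (_⟶_ : V → V → Set)
      (arc : ∀ {v w} → v ⟶ w → Facet N v × Facet N w × Adjacent v w)
      (orient : ∀ {v w} → Facet N v → Facet N w → Adjacent v w → v ⟶ w ⊎ w ⟶ v)
      (descends : ∀ {v w} → v ⟶ w → h w < h v)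
      (unique : ∀ {G F v w} → Facet N F → G ⊆ F →
         Facet N v → G ⊆ v → (∀ {u} → Facet N u → G ⊆ u → Adjacent v u → u ≢ v → h v < h u) →
         Facet N w → G ⊆ w → (∀ {u} → Facet N u → G ⊆ u → Adjacent w u → u ≢ w → h w < h u) → v ≡ w) where

      H : Fin N → ℕ → ℕ
      H p i = h (pol p i)

      toward : ∀ {v w} → Facet N v → Facet N w → Adjacent v w → h w < h v → v ⟶ w
      toward a b c l with orient a b c
      ... | inj₁ x = x
      ... | inj₂ x = ⊥-elim (<-asym l (descends x))

      irreflexive : ∀ {v w} → v ⟶ w → w ≢ v
      irreflexive x refl = <-irrefl refl (descends x)

      edge : ∀ {p i} → 1 ≤ i → i < K → H p i ≢ H p (suc i)
      edge {p} {i} a b with orient (pol-facet {p} a (<⇒≤ b)) (pol-facet {p} {suc i} (s≤s z≤n) b) (ridge p a b)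
      ... | inj₁ x = >⇒≢ (descends x)
      ... | inj₂ x = <⇒≢ (descends x)

      up : ∀ {p i} → 1 ≤ i → i < K → H p (suc i) < H p i → pol p i ⟶ pol p (suc i)
      up {p} {i} a b = toward (pol-facet {p} a (<⇒≤ b)) (pol-facet {p} {suc i} (s≤s z≤n) b) (ridge p a b)

      down : ∀ {p i} → 1 ≤ i → i < K → H p i < H p (suc i) → pol p (suc i) ⟶ pol p i
      down {p} {i} a b = toward (pol-facet {p} {suc i} (s≤s z≤n) b) (pol-facet {p} a (<⇒≤ b)) (Adjacent-sym {v = pol p i} (ridge p a b))

      module _ (p : Fin N) where
        open Unimodal 3≤m (H p) (cong h (sym (pol-K p))) (edge {p}) using (MinAt; first; inner)

        private
          bounds : ∀ {c} → MinAt c → 1 ≤ c × c ≤ m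
          bounds (first _ _) = ≤-refl , 1≤m
          bounds (inner a b _ _) = s≤s z≤n , ≤-pred b

          minimal : ∀ {c} → MinAt c → ∀ {u} → Facet N u → ⁅ p ⁆ ∪ ⁅ nx p ⁆ ⊆ u → Adjacent (pol p c) u → u ≢ pol p c → H p c < h u
          minimal x f g e n with on-polygon p f (g left) (g (right {a = p}))
          minimal (first x y) f g e n | l , a , b , refl = [ (λ z → subst (λ v → H p 1 < h v) (sym z) x) , (λ z → subst (λ v → H p 1 < h v) (sym z) y) ]′
            (neighbours₁ p a b e n)
          minimal (inner {c} c₁ c₂ x y) f g e n | l , a , b , refl = [ (λ z → subst (λ v → H p (suc c) < h v) (sym z) y) , (λ z → subst (λ v → H p (suc c) < h v) (sym z) x) ]′
            (neighbours p c₁ (≤-pred c₂) a b e n)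

        -- Within the face {p, p + 1} a vertex is adjacent only to its neighbours in the sequence,
        -- so local minima of the sequence are sinks of this face.
        one-minimum : ∀ {c d} → MinAt c → MinAt d → c ≡ d
        one-minimum {c} {d} x y = pol-injective p (proj₁ (bounds x)) (proj₂ (bounds x)) (proj₁ (bounds y)) (proj₂ (bounds y))
            (unique (pol-facet {p} {1} ≤-refl (s≤s z≤n)) (on ≤-refl (s≤s z≤n))
              (pol-facet {p} (proj₁ (bounds x)) c≤) (on (proj₁ (bounds x)) c≤) (minimal x)
              (pol-facet {p} (proj₁ (bounds y)) d≤) (on (proj₁ (bounds y)) d≤) (minimal y))
          where
          on : ∀ {i} → 1 ≤ i → i ≤ K → ⁅ p ⁆ ∪ ⁅ nx p ⁆ ⊆ pol p i
          on a b = pair⊆ (proj₁ (pol-∋ p a b)) (proj₂ (pol-∋ p a b))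
          c≤ = ≤-trans (proj₂ (bounds x)) (n≤1+n m)
          d≤ = ≤-trans (proj₂ (bounds y)) (n≤1+n m)

        private
          module U = Unimodal 3≤m (H p) (cong h (sym (pol-K p))) (edge {p})
        pit = λ {i} → U.pit one-minimum {i}
        pit₁ = U.pit₁ one-minimum
        peak = λ {i} → U.peak one-minimum {i}
        peak₁ = U.peak₁ one-minimum

      private
        turned : ∀ p {i j} → 2 ≤ i → 2 ≤ j → i + j ≡ N → pol p i ≡ pol (p ⊕ i) j
        turned p {i} {j} a b e = trans (pol-mid p a i≤m) (trans (cross-turn p {i} {j} e) (sym (pol-mid (p ⊕ i) b j≤m)))
          where
          i≤m : i ≤ m
          i≤m = +-cancelʳ-≤ 2 i m (≤-trans (+-monoʳ-≤ i b) (≤-reflexive (trans e (+-comm 2 m))))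
          j≤m : j ≤ m
          j≤m = +-cancelˡ-≤ 2 j m (≤-trans (+-monoˡ-≤ j a) (≤-reflexive e))

      -- An adjacent facet misses only one of the four points, so it contains one of the two pairs
      -- entirely and lies on that polygon.
      ports : ∀ {p i j w} → 1 ≤ i → 1 ≤ j → suc i + suc j ≡ suc K → pol p (suc i) ⟶ w →
              (w ≡ pol p (2 + i) ⊎ w ≡ pol p i) ⊎ (w ≡ pol (p ⊕ suc i) (2 + j) ⊎ w ≡ pol (p ⊕ suc i) j)
      ports {p} {i} {j} {w} a b e x = go (p ∈? w) (nx p ∈? w) (q ∈? w) (nx q ∈? w)
        where
        q = p ⊕ suc i
        f = proj₁ (proj₂ (arc x))
        adj = proj₂ (proj₂ (arc x))
        i<m : suc i ≤ m
        i<m = +-cancelʳ-≤ 2 (suc i) m (≤-trans (+-monoʳ-≤ (suc i) (s≤s b)) (≤-reflexive (trans e (+-comm 2 m))))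
        j<m : suc j ≤ m
        j<m = +-cancelˡ-≤ 2 (suc j) m (≤-trans (+-monoˡ-≤ (suc j) (s≤s a)) (≤-reflexive e))
        v≡ : pol p (suc i) ≡ pol q (suc j)
        v≡ = turned p (s≤s a) (s≤s b) e
        near : ∀ r {k} → 1 ≤ k → suc k ≤ m → pol p (suc i) ≡ pol r (suc k) → r ∈ w → nx r ∈ w → w ≡ pol r (2 + k) ⊎ w ≡ pol r k
        near r {k} c d v y z with on-polygon r f y z
        ... | l , c′ , d′ , refl = neighbours r c d c′ d′ (subst (λ u → Adjacent u (pol r l)) v adj) (λ z → irreflexive x (trans z (sym v)))
        i< : 2 + i < N
        i< = s≤s (s≤s i<m)
        two : ∀ {s t} → OneOf s 0 1 (suc i) (2 + i) → OneOf t 0 1 (suc i) (2 + i) → s < N → t < N → s ≢ t → p ⊕ s ∉ w → p ⊕ t ∉ w → ⊥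
        two {s} {t} os ot s< t< n y z = missing-two (∣cross∣≤4 p q) {p ⊕ s} {p ⊕ t} (cross⁺ p {suc i} os) y (cross⁺ p {suc i} ot) z (⊕≢ p s< t< n)
          (subst (λ u → Adjacent u w) (pol-mid p (s≤s a) i<m) adj)
        o₀ : OneOf 0 0 1 (suc i) (2 + i)
        o₀ = inj₁ refl
        o₁ : OneOf 1 0 1 (suc i) (2 + i)
        o₁ = inj₂ (inj₁ refl)
        o₂ : OneOf (suc i) 0 1 (suc i) (2 + i)
        o₂ = inj₂ (inj₂ (inj₁ refl))
        o₃ : OneOf (2 + i) 0 1 (suc i) (2 + i)
        o₃ = inj₂ (inj₂ (inj₂ refl))
        0< : 0 < N
        0< = s≤s z≤n
        1< : 1 < N
        1< = s≤s (s≤s z≤n)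
        si< : suc i < N
        si< = <-trans ≤-refl i<
        go : Dec (p ∈ w) → Dec (nx p ∈ w) → Dec (q ∈ w) → Dec (nx q ∈ w) → (w ≡ pol p (2 + i) ⊎ w ≡ pol p i) ⊎ (w ≡ pol q (2 + j) ⊎ w ≡ pol q j)
        go (yes y) (yes z) _ _ = inj₁ (near p a i<m refl y z)
        go _ _ (yes y) (yes z) = inj₂ (near q b j<m v≡ y z)
        go (no y) _ (no z) _ = ⊥-elim (two {0} {suc i} o₀ o₂ 0< si< (λ ()) y z)
        go (no y) _ _ (no z) = ⊥-elim (two {0} {2 + i} o₀ o₃ 0< i< (λ ()) y z)
        go _ (no y) (no z) _ = ⊥-elim (two {1} {suc i} o₁ o₂ 1< si< (<⇒≢ (s≤s a)) y z)
        go _ (no y) _ (no z) = ⊥-elim (two {1} {2 + i} o₁ o₃ 1< i< (λ ()) y z)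

      -- The face of all facets containing p + 1 and q + 1. Its four vertices are the crossings of p
      -- or p + 1 with q or q + 1; the bounds on i keep all of them proper, and opposite ones are
      -- not adjacent.
      module Square {p : Fin N} {i : ℕ} (2≤i : 2 ≤ i) (3+i≤K : 3 + i ≤ K) where
        q : Fin N
        q = p ⊕ suc i
        G : Subset N
        G = ⁅ nx p ⁆ ∪ ⁅ nx q ⁆
        private
          2+i≤m : 2 + i ≤ m
          2+i≤m = ≤-pred 3+i≤K
          1+i≤m = ≤-trans (n≤1+n _) 2+i≤m
          i≤m = ≤-trans (n≤1+n _) 1+i≤m
          2≤1+i = ≤-trans 2≤i (n≤1+n i)
          2≤2+i = ≤-trans 2≤1+i (n≤1+n (suc i))
          3+i< : 3 + i < N
          3+i< = s≤s 3+i≤K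
          2+i< = <-trans ≤-refl 3+i<
          1+i< = <-trans ≤-refl 2+i<
          0< : 0 < N
          0< = s≤s z≤n
          1< : 1 < N
          1< = s≤s (s≤s z≤n)
          2< : 2 < N
          2< = s≤s (s≤s 1≤m)
          q≡ : nx p ⊕ i ≡ q
          q≡ = ⊕-+ p 1 i
          nxq≡ : nx p ⊕ suc i ≡ nx q
          nxq≡ = cong nx q≡

        p₀₀ : pol p (suc i) ≡ cross p q
        p₀₀ = pol-mid p 2≤1+i 1+i≤m
        p₀₁ : pol p (2 + i) ≡ cross p (nx q)
        p₀₁ = pol-mid p 2≤2+i 2+i≤m
        p₁₀ : pol (nx p) i ≡ cross (nx p) q
        p₁₀ = trans (pol-mid (nx p) 2≤i i≤m) (cong (cross (nx p)) q≡)
        p₁₁ : pol (nx p) (suc i) ≡ cross (nx p) (nx q)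
        p₁₁ = trans (pol-mid (nx p) 2≤1+i 1+i≤m) (cong (cross (nx p)) nxq≡)

        Corner : Subset N → Set
        Corner w = (w ≡ cross p q ⊎ w ≡ cross p (nx q)) ⊎ (w ≡ cross (nx p) q ⊎ w ≡ cross (nx p) (nx q))

        private
          together : ∀ {r} → nx p ≡ r ⊎ nx p ≡ nx r → nx q ≡ r ⊎ nx q ≡ nx r → ⊥
          together (inj₁ refl) (inj₁ z) = ⊕≢ p {2 + i} {1} 2+i< 1< (λ ()) z
          together (inj₁ refl) (inj₂ z) = ⊕≢ p {2 + i} {2} 2+i< 2< (>⇒≢ (s≤s (s≤s (<⇒≤ 2≤i)))) z
          together (inj₂ z) (inj₁ refl) = ⊕≢ p {1} {3 + i} 1< 3+i< (λ ()) z
          together (inj₂ z) (inj₂ y) = ⊕≢ p {2 + i} {1} 2+i< 1< (λ ()) (trans y (sym z))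

          side : ∀ {a r} → nx a ≡ r ⊎ nx a ≡ nx r → a ≡ r ⊎ nx a ≡ r
          side (inj₁ z) = inj₂ z
          side (inj₂ z) = inj₁ (nx-injective z)

          choose : ∀ {r s} → p ≡ r ⊎ nx p ≡ r → q ≡ s ⊎ nx q ≡ s → Corner (cross r s)
          choose (inj₁ refl) (inj₁ refl) = inj₁ (inj₁ refl)
          choose (inj₁ refl) (inj₂ refl) = inj₁ (inj₂ refl)
          choose (inj₂ refl) (inj₁ refl) = inj₂ (inj₁ refl)
          choose (inj₂ refl) (inj₂ refl) = inj₂ (inj₂ refl)

        corners : ∀ {w} → Facet N w → G ⊆ w → Corner w
        corners f g with facet-cross f
        ... | r , k , _ , _ , refl with halves r (r ⊕ k) (g left) | halves r (r ⊕ k) (g (right {a = nx p}))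
        ...   | inj₁ x | inj₁ y = ⊥-elim (together x y)
        ...   | inj₂ x | inj₂ y = ⊥-elim (together x y)
        ...   | inj₁ x | inj₂ y = choose (side x) (side y)
        ...   | inj₂ x | inj₁ y = subst Corner (cross-comm (r ⊕ k) r) (choose (side x) (side y))

        private
          f₀₀ : Facet N (cross p q)
          f₀₀ = cross-facet p 2≤1+i 1+i≤m
          f₀₁ : Facet N (cross p (nx q))
          f₀₁ = cross-facet p 2≤2+i 2+i≤m
          f₁₀ : Facet N (cross (nx p) q)
          f₁₀ = subst (λ s → Facet N (cross (nx p) s)) q≡ (cross-facet (nx p) 2≤i i≤m)
          f₁₁ : Facet N (cross (nx p) (nx q))
          f₁₁ = subst (λ s → Facet N (cross (nx p) s)) nxq≡ (cross-facet (nx p) 2≤1+i 1+i≤m)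

          ∈₁ : ∀ {r s} → p ≡ r ⊎ nx p ≡ r → nx p ∈ cross r s
          ∈₁ {r} {s} (inj₁ refl) = quad⁺ r (nx r) s (nx s) (inj₂ (inj₁ refl))
          ∈₁ {r} {s} (inj₂ refl) = quad⁺ r (nx r) s (nx s) (inj₁ refl)
          ∈₂ : ∀ {r s} → q ≡ s ⊎ nx q ≡ s → nx q ∈ cross r s
          ∈₂ {r} {s} (inj₁ refl) = quad⁺ r (nx r) s (nx s) (inj₂ (inj₂ (inj₂ refl)))
          ∈₂ {r} {s} (inj₂ refl) = quad⁺ r (nx r) s (nx s) (inj₂ (inj₂ (inj₁ refl)))
          G⊆ : ∀ {r s} → p ≡ r ⊎ nx p ≡ r → q ≡ s ⊎ nx q ≡ s → G ⊆ cross r s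
          G⊆ {r} {s} x y = pair⊆ (∈₁ {r} {s} x) (∈₂ {r} {s} y)

          p∉₁₁ : p ∉ cross (nx p) (nx q)
          p∉₁₁ z = none (λ ()) (λ ()) (λ ()) (λ ()) (at⁻ p {0} {1} {2} {2 + i} {3 + i} 0< 1< 2< 2+i< 3+i< z)
          q∉₁₁ : q ∉ cross (nx p) (nx q)
          q∉₁₁ z = none (>⇒≢ 2≤1+i) (>⇒≢ (s≤s 2≤i)) (<⇒≢ ≤-refl) (<⇒≢ (n≤1+n _)) (at⁻ p {suc i} {1} {2} {2 + i} {3 + i} 1+i< 1< 2< 2+i< 3+i< z)
          p∉₁₀ : p ∉ cross (nx p) q
          p∉₁₀ z = none (λ ()) (λ ()) (λ ()) (λ ()) (at⁻ p {0} {1} {2} {1 + i} {2 + i} 0< 1< 2< 1+i< 2+i< z)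
          nnq∉₁₀ : nx (nx q) ∉ cross (nx p) q
          nnq∉₁₀ z = none (λ ()) (>⇒≢ (s≤s (s≤s (s≤s z≤n)))) (>⇒≢ (n≤1+n _)) (>⇒≢ ≤-refl) (at⁻ p {3 + i} {1} {2} {1 + i} {2 + i} 3+i< 1< 2< 1+i< 2+i< z)

          opposite₁ : Adjacent (cross p q) (cross (nx p) (nx q)) → ⊥
          opposite₁ = missing-two (∣cross∣≤4 p q) (quad⁺ p (nx p) q (nx q) (inj₁ refl)) p∉₁₁ (quad⁺ p (nx p) q (nx q) (inj₂ (inj₂ (inj₁ refl)))) q∉₁₁
            (⊕≢ p {0} {suc i} 0< 1+i< (λ ()))
          opposite₂ : Adjacent (cross p (nx q)) (cross (nx p) q) → ⊥
          opposite₂ = missing-two (∣cross∣≤4 p (nx q)) (quad⁺ p (nx p) (nx q) (nx (nx q)) (inj₁ refl)) p∉₁₀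
            (quad⁺ p (nx p) (nx q) (nx (nx q)) (inj₂ (inj₂ (inj₂ refl)))) nnq∉₁₀ (⊕≢ p {0} {3 + i} 0< 3+i< (λ ()))

        diagonal₁ : h (cross p (nx q)) < h (cross p q) → h (cross p (nx q)) < h (cross (nx p) (nx q)) →
                    h (cross (nx p) q) < h (cross p q) → h (cross (nx p) q) < h (cross (nx p) (nx q)) → ⊥
        diagonal₁ a b c d = p∉₁₀ (subst (p ∈_) (unique f₀₁ (G⊆ (inj₁ refl) (inj₂ refl)) f₀₁ (G⊆ (inj₁ refl) (inj₂ refl)) min₁ f₁₀ (G⊆ (inj₂ refl) (inj₁ refl)) min₂)
                              (quad⁺ p (nx p) (nx q) (nx (nx q)) (inj₁ refl)))
          where
          min₁ : ∀ {u} → Facet N u → G ⊆ u → Adjacent (cross p (nx q)) u → u ≢ cross p (nx q) → h (cross p (nx q)) < h u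
          min₁ f g e n with corners f g
          ... | inj₁ (inj₁ refl) = a
          ... | inj₁ (inj₂ refl) = ⊥-elim (n refl)
          ... | inj₂ (inj₁ refl) = ⊥-elim (opposite₂ e)
          ... | inj₂ (inj₂ refl) = b
          min₂ : ∀ {u} → Facet N u → G ⊆ u → Adjacent (cross (nx p) q) u → u ≢ cross (nx p) q → h (cross (nx p) q) < h u
          min₂ f g e n with corners f g
          ... | inj₁ (inj₁ refl) = c
          ... | inj₁ (inj₂ refl) = ⊥-elim (opposite₂ (Adjacent-sym {v = cross (nx p) q} e))
          ... | inj₂ (inj₁ refl) = ⊥-elim (n refl)
          ... | inj₂ (inj₂ refl) = d

        diagonal₂ : h (cross p q) < h (cross p (nx q)) → h (cross p q) < h (cross (nx p) q) →
                    h (cross (nx p) (nx q)) < h (cross p (nx q)) → h (cross (nx p) (nx q)) < h (cross (nx p) q) → ⊥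
        diagonal₂ a b c d = p∉₁₁ (subst (p ∈_) (unique f₀₀ (G⊆ (inj₁ refl) (inj₁ refl)) f₀₀ (G⊆ (inj₁ refl) (inj₁ refl)) min₁ f₁₁ (G⊆ (inj₂ refl) (inj₂ refl)) min₂)
                              (quad⁺ p (nx p) q (nx q) (inj₁ refl)))
          where
          min₁ : ∀ {u} → Facet N u → G ⊆ u → Adjacent (cross p q) u → u ≢ cross p q → h (cross p q) < h u
          min₁ f g e n with corners f g
          ... | inj₁ (inj₁ refl) = ⊥-elim (n refl)
          ... | inj₁ (inj₂ refl) = a
          ... | inj₂ (inj₁ refl) = b
          ... | inj₂ (inj₂ refl) = ⊥-elim (opposite₁ e)
          min₂ : ∀ {u} → Facet N u → G ⊆ u → Adjacent (cross (nx p) (nx q)) u → u ≢ cross (nx p) (nx q) → h (cross (nx p) (nx q)) < h u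
          min₂ f g e n with corners f g
          ... | inj₁ (inj₁ refl) = ⊥-elim (opposite₁ (Adjacent-sym {v = cross (nx p) (nx q)} e))
          ... | inj₁ (inj₂ refl) = c
          ... | inj₂ (inj₁ refl) = d
          ... | inj₂ (inj₂ refl) = ⊥-elim (n refl)

      landscape : Landscape h _⟶_ m
      landscape = record
        { Poly = Fin N ; nx = nx ; pv = pv ; nx-pv = nx-pv ; pv-nx = pv-nx ; 3≤m = 3≤m
        ; cycle = cycle ; connected = connected ; Pol = pol ; corner = λ p → sym (pol-K p)
        ; shift = λ p → trans (pol-mid p {2} ≤-refl 2≤m) (cong (λ z → cross z (nx (nx p))) (sym (pv-nx p)))
        ; swap = λ {p} → turned p
        ; edge = λ {p} → edge {p}
        ; quad₁ = λ {p} {i} a b x₁ x₂ x₃ x₄ → let open Square {p} {i} a b in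
            diagonal₁ (subst₂ _<_ (cong h p₀₁) (cong h p₀₀) x₁) (subst₂ _<_ (cong h p₀₁) (cong h p₁₁) x₂) (subst₂ _<_ (cong h p₁₀) (cong h p₀₀) x₃) (subst₂ _<_ (cong h p₁₀) (cong h p₁₁) x₄)
        ; quad₂ = λ {p} {i} a b x₁ x₂ x₃ x₄ → let open Square {p} {i} a b in
            diagonal₂ (subst₂ _<_ (cong h p₀₀) (cong h p₀₁) x₁) (subst₂ _<_ (cong h p₀₀) (cong h p₁₀) x₂) (subst₂ _<_ (cong h p₁₁) (cong h p₀₁) x₃) (subst₂ _<_ (cong h p₁₁) (cong h p₁₀) x₄)
        ; peak = λ {p} → peak p ; pit = λ {p} → pit p ; peak₁ = λ {p} → peak₁ p ; pit₁ = λ {p} → pit₁ p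
        ; any? = λ P d → any? d
        ; descends = descends ; up = λ {p} → up {p} ; down = λ {p} → down {p} ; ports = λ {p} → ports {p} }

-- Assembling the bound.

module Conclusion where
  open import Defs
  import Data.Nat.Solver as Solver
  open import Data.Bool using (Bool; T)
  open import Data.Integer using (+_)
  open import Data.Rational using (_/_)
  import Data.Rational as Q
  open import Data.Fin using (Fin)
  open import Data.Fin.Subset using (Subset; _⊆_)
  open import Data.List using (allFin)
  open import Data.List.Extrema.Nat using (argmin; f[argmin]≤f[xs])
  open import Data.List.Membership.Propositional.Properties using (∈-allFin)
  import Data.List.Relation.Unary.All as All
  open Landscapes using (Landscape)
  open Frames
  open Phase1
  open Phase3 using (Bounds)
  open Expect
  open Reachability
  open GaleEvenness using (Facet; gale⁺; gale⁻)
  open Order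
  open Orientation

  highest : (ℕ → ℕ) → ℕ → ℕ
  highest f zero    = 0
  highest f (suc n) = f (suc n) ⊔ highest f n

  ≤highest : ∀ f n {j} → 1 ≤ j → j ≤ n → f j ≤ highest f n
  ≤highest f zero {suc j} a ()
  ≤highest f (suc n) a b = [ (λ c → ≤-trans (≤highest f n a (≤-pred c)) (m≤n⊔m (f (suc n)) (highest f n))) , (λ { refl → m≤m⊔n (f (suc n)) (highest f n) }) ]′ (m≤n⇒m<n∨m≡n b)

  highest< : ∀ f n {t} → 0 < t → (∀ {j} → 1 ≤ j → j ≤ n → f j < t) → highest f n < t
  highest< f zero a g = a
  highest< f (suc n) a g = ⊔-lub (g (s≤s z≤n) ≤-refl) (highest< f n a (λ b c → g b (≤-trans c (n≤1+n n))))

  walk-++ : ∀ {n} {D : Subset n → Subset n → Bool} {u v w k l} → Walk D u v k → Walk D v w l → Walk D u w (k + l)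
  walk-++ here q = q
  walk-++ (step a p) q = step a (walk-++ p q)

  module AUSO (m : ℕ) (3≤m : 3 ≤ m) (D : Subset (suc (suc m)) → Subset (suc (suc m)) → Bool)
              (orientation : IsOrientation (suc (suc m)) D) (acyclic : Acyclic (suc (suc m)) D) (sinks : UniqueSink (suc (suc m)) D) where
    open Geometry m 3≤m
    open Closure D

    _⟶_ : V → V → Set
    v ⟶ w = T (D v w)

    h : V → ℕ
    h = rank (allSubsets N)

    descends : ∀ {v w} → v ⟶ w → h w < h v
    descends = rank-< (allSubsets-complete N) λ v r → uncycle v (sound {λ u w → ∃[ k ] Walk D u w (suc k)} (λ a → 0 , step a here) (λ (k , p) (l , q) → k + suc l , walk-++ p q) (allSubsets N) r)
      where
      uncycle : ∀ v → ∃[ k ] Walk D v v (suc k) → ⊥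
      uncycle v (k , p) = acyclic v k p

    arc : ∀ {v w} → v ⟶ w → Facet N v × Facet N w × Adjacent v w
    arc {v} {w} x = let a , b , c = proj₁ orientation v w x in gale⁻ a , gale⁻ b , c

    orient : ∀ {v w} → Facet N v → Facet N w → Adjacent v w → v ⟶ w ⊎ w ⟶ v
    orient {v} {w} a b c = proj₂ orientation v w (gale⁺ a , gale⁺ b , c)

    -- Arcs lead to lower adjacent vertices, so a vertex lower than its neighbours in a face is a
    -- sink of that face.
    unique : ∀ {G F v w} → Facet N F → G ⊆ F →
       Facet N v → G ⊆ v → (∀ {u} → Facet N u → G ⊆ u → Adjacent v u → u ≢ v → h v < h u) →
       Facet N w → G ⊆ w → (∀ {u} → Facet N u → G ⊆ u → Adjacent w u → u ≢ w → h w < h u) → v ≡ w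
    unique {G} {F} {v} {w} f g fv gv mv fw gw mw = proj₂ (proj₂ (sinks G (F , gale⁺ f , g))) v w (sink fv gv mv) (sink fw gw mw)
      where
      sink : ∀ {v} → Facet N v → G ⊆ v → (∀ {u} → Facet N u → G ⊆ u → Adjacent v u → u ≢ v → h v < h u) → IsSinkIn N D (InFace N G) v
      sink fv gv mv = (gale⁺ fv , gv) , λ u (_ , gu) x → let _ , fu , e = arc x in
        <-asym (descends x) (mv fu gu e λ { refl → <-irrefl refl (descends x) })

    L : Landscape h _⟶_ m
    L = Ordered.landscape m 3≤m h _⟶_ arc orient descends unique

    open Landscape L using (H; Below)

    -- The polygon with the lowest maximum; a descending walk is above every other polygon no longer
    -- than it is above this one.
    κ : Fin N
    κ = argmin (λ y → highest (H y) K) (e 0) (allFin N)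

    best : Late.Best L κ
    best {t} f y b = f λ a c → ≤-<-trans (≤highest (H κ) K a c) (≤-<-trans
      (All.lookup (f[argmin]≤f[xs] {f = λ y → highest (H y) K} (e 0) (allFin N)) (∈-allFin y)) (highest< (H y) K (≤-<-trans z≤n (b {1} ≤-refl (s≤s z≤n))) b))

    bound : ∀ v → Vertex N v → ExpectedSteps N D v Q.≤ + (34 * N) / 1
    bound v f = start (facet-cross (gale⁻ f))
      where
      steps = stepBounds N D
      arithmetic : suc (4 * (4 * suc m) + (4 + suc (4 * suc (suc m) + (4 + 12 * m)))) ≤ 34 * suc (suc m)
      -- The coefficients of m are 16 for phase 1 (four sides at cost 4), 4 for phase 2 and 12 for
      -- phase 3. The total 32 m + 34 falls short of 34 (m + 2) by 2 m + 34.
      arithmetic = ≤-trans (m≤m+n _ (2 * m + 34)) (≤-reflexive (solve 1 (λ x →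
          con 1 :+ (con 4 :* (con 4 :* (con 1 :+ x)) :+ (con 4 :+ (con 1 :+ (con 4 :* (con 1 :+ (con 1 :+ x)) :+ (con 4 :+ con 12 :* x))))) :+ (con 2 :* x :+ con 34)
          := con 34 :* (con 1 :+ (con 1 :+ x))) refl m))
        where open Solver.+-*-Solver
      start : ∃[ p ] ∃[ i ] (2 ≤ i × i ≤ m × v ≡ cross p (p ⊕ i)) → ExpectedSteps N D v Q.≤ + (34 * N) / 1
      start (p , i , a , b , v≡) = subst (λ v → ExpectedSteps N D v Q.≤ + (34 * N) / 1) (trans (pol-mid p a b) (sym v≡))
        (Bounds.mono steps {2 ^ N} {pol p i} arithmetic (Exploring.everywhere steps L (2 ^ N) κ (Framed.frameAt L p a (s≤s b)) best))

open import Defs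
open import Data.Integer using (+_)
open import Data.Rational using (ℚ; _/_)
open import Data.Fin.Subset using (Subset)
open import Data.Bool using (Bool)
import Data.Rational as Q

open Conclusion

theorem1p1 : ∃[ C ] (∀ (n : ℕ) → 5 ≤ n →
    (D : Subset n → Subset n → Bool) → IsAUSO n D →
    (vst : Subset n) → Vertex n vst →
    ExpectedSteps n D vst Q.≤ (+ (C * n) / 1))
theorem1p1 = 34 , λ { (suc (suc m)) (s≤s (s≤s 3≤m)) D (orientation , acyclic , sinks) vst →
  AUSO.bound m 3≤m D orientation acyclic sinks vst }
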